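{- Let $H$ be a finite, simple, connected undirected graph. There are positive integers $d=d(\varepsilon,H)$ and $\ell=\ell(\varepsilon,H)$ depending only on $\varepsilon$ and $H$, and a constant $\delta=\delta(\varepsilon,H)>0$, such that for every planar graph $G$ that is $\varepsilon$-far from $H$-free, $\mathrm{RLBD}(G,H,d,\ell)$ finds a copy of $H$ with probability at least $\delta$. The query complexity of $\mathrm{RLBD}(G,H,d,\ell)$ is $O(d^{\ell})$, which depends only on $\varepsilon$ and $H$.
   Context: Access to $G=(V,E)$, $V=\{1,\dots,n\}$, is via the random neighbor oracle: a query on vertex $v$ returns a uniformly random neighbor of $v$, independently of all other queries. $\mathrm{Traverse}(G,v,d,\ell)$: set $L_0=\{v\}$; for $j=1,\dots,\ell$, every $u\in L_{j-1}$ makes $d$ random neighbor queries, obtaining a set $\Gamma_u$, and the edges $(u,x)$, $x\in\Gamma_u$, are recorded; $L_j$ is the union of the $\Gamma_u$ minus the vertices of $L_0\cup\dots\cup L_{j-1}$; return the subgraph formed by all recorded edges. $\mathrm{RLBD}(G,H,d,\ell)$: pick $v\in V$ uniformly at random, run $\mathrm{Traverse}(G,v,d,\ell)$, and "find a copy of $H$" (reject) iff the returned subgraph contains a (not necessarily induced) copy of $H$. $G$ is $\varepsilon$-far from $H$-free if more than $\varepsilon|V|$ edges must be deleted from $G$ to obtain a graph with no subgraph isomorphic to $H$. -}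

module Defs where

open import Data.Bool using (Bool; true; false; _∧_; _∨_; not; if_then_else_)
open import Data.Nat as ℕ using (ℕ; zero; suc; _≤_; _<_)
open import Data.Fin as Fin using (Fin; toℕ)
open import Data.Fin.Properties using (_≟_)
open import Data.List using (List; []; _∷_; _++_; map; filterᵇ; length; concatMap; foldr; deduplicate; upTo; allFin)
open import Data.List.Membership.Propositional using (_∈_)
open import Data.List.Relation.Unary.All using (All)
open import Data.List.Relation.Binary.Sublist.Propositional using (_⊆_)
open import Data.Bool.ListAction using (any; all)
open import Data.Maybe using (Maybe; just; nothing)
open import Data.Product using (Σ; ∃; _×_; _,_; proj₁; proj₂)
open import Data.Sum using (_⊎_)
open import Data.Integer using (+_)
open import Data.Rational.Unnormalised as ℚ using (ℚᵘ; 1ℚᵘ; 0ℚᵘ)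
open import Relation.Binary.PropositionalEquality using (_≡_)
open import Relation.Nullary.Decidable using (⌊_⌋)
open import Function.Definitions using (Injective)

record Graph (n : ℕ) : Set where
  field
    adj    : Fin n → Fin n → Bool
    sym    : ∀ i j → adj i j ≡ adj j i
    irrefl : ∀ i → adj i i ≡ false
open Graph public

_==_ : ∀ {n} → Fin n → Fin n → Bool
x == y = ⌊ x ≟ y ⌋

data Walk {n} (G : Graph n) : Fin n → Fin n → Set where
  here : ∀ {x} → Walk G x x
  step : ∀ {x y z} → adj G x y ≡ true → Walk G y z → Walk G x z

Connected : ∀ {n} → Graph n → Set
Connected G = ∀ a b → Walk G a b

allPairs : ∀ n → List (Fin n × Fin n)
allPairs n = concatMap (λ i → map (λ j → (i , j)) (allFin n)) (allFin n)

edgeCount : ∀ {n} → Graph n → ℕ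
edgeCount {n} G = length (filterᵇ (λ p → adj G (proj₁ p) (proj₂ p) ∧ ⌊ toℕ (proj₁ p) ℕ.<? toℕ (proj₂ p) ⌋) (allPairs n))

CopyOf : ∀ {k n} → Graph k → Graph n → Set
CopyOf {k} {n} H G = Σ (Fin k → Fin n) λ f → Injective _≡_ _≡_ f ×
  (∀ a b → adj H a b ≡ true → adj G (f a) (f b) ≡ true)

Free : ∀ {k n} → Graph k → Graph n → Set
Free H G = CopyOf H G → ⊥'
  where open import Data.Empty renaming (⊥ to ⊥')

_⊑_ : ∀ {n} → Graph n → Graph n → Set
G' ⊑ G = ∀ i j → adj G' i j ≡ true → adj G i j ≡ true

ℕ→ℚ : ℕ → ℚᵘ
ℕ→ℚ m = (+ m) ℚ./ 1

Far : ∀ {k n} → ℚᵘ → Graph k → Graph n → Set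
Far {n = n} ε H G = ∀ (G' : Graph n) → G' ⊑ G → Free H G' →
  ε ℚ.* ℕ→ℚ n ℚ.< ℕ→ℚ (edgeCount G ℕ.∸ edgeCount G')

-- Planarity, via combinatorial embeddings (rotation systems) and
-- Euler's formula (Heffter–Edmonds–Ringel; cf. hypermaps in the Coq
-- four colour theorem).

iter : ∀ {A : Set} → (A → A) → ℕ → A → A
iter f zero x = x
iter f (suc k) x = f (iter f k x)

record Rotation {n} (G : Graph n) : Set where
  field
    rot      : Fin n → Fin n → Fin n
    closed   : ∀ v u → adj G v u ≡ true → adj G v (rot v u) ≡ true
    inj      : ∀ v u w → adj G v u ≡ true → adj G v w ≡ true → rot v u ≡ rot v w → u ≡ w
    cyclic   : ∀ v u w → adj G v u ≡ true → adj G v w ≡ true → ∃ λ t → iter (rot v) t u ≡ w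
open Rotation public

darts : ∀ {n} → Graph n → List (Fin n × Fin n)
darts {n} G = filterᵇ (λ p → adj G (proj₁ p) (proj₂ p)) (allPairs n)

faceStep : ∀ {n} {G : Graph n} → Rotation G → Fin n × Fin n → Fin n × Fin n
faceStep ρ (u , v) = (v , rot ρ v u)

dartEq : ∀ {n} → Fin n × Fin n → Fin n × Fin n → Bool
dartEq (a , b) (c , d) = (a == c) ∧ (b == d)

-- y lies in the φ-orbit of x (orbits have length ≤ n·n)
inOrbit : ∀ {n} {G : Graph n} → Rotation G → Fin n × Fin n → Fin n × Fin n → Bool
inOrbit {n} ρ x y = any (λ t → dartEq (iter (faceStep ρ) t x) y) (upTo (n ℕ.* n))

dartKey : ∀ {n} → Fin n × Fin n → ℕ
dartKey {n} (a , b) = toℕ a ℕ.* n ℕ.+ toℕ b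

-- number of faces = number of φ-orbits (counted by minimal representatives)
faceCount : ∀ {n} {G : Graph n} → Rotation G → ℕ
faceCount {G = G} ρ = length (filterᵇ
  (λ x → all (λ y → not (inOrbit ρ x y) ∨ ⌊ dartKey x ℕ.≤? dartKey y ⌋) (darts G))
  (darts G))

reachWithin : ∀ {n} → Graph n → ℕ → Fin n → Fin n → Bool
reachWithin G zero u v = u == v
reachWithin {n} G (suc t) u v = (u == v) ∨ any (λ w → adj G u w ∧ reachWithin G t w v) (allFin n)

componentCount : ∀ {n} → Graph n → ℕ
componentCount {n} G = length (filterᵇ
  (λ u → all (λ v → not (reachWithin G n u v) ∨ ⌊ toℕ u ℕ.≤? toℕ v ⌋) (allFin n))
  (allFin n))

isolatedCount : ∀ {n} → Graph n → ℕ
isolatedCount {n} G = length (filterᵇ (λ u → not (any (adj G u) (allFin n))) (allFin n))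

-- Euler: every component with an edge satisfies V − E + F = 2 (genus 0);
-- an isolated vertex counts as one face.
Planar : ∀ {n} → Graph n → Set
Planar {n} G = Σ (Rotation G) λ ρ →
  n ℕ.+ faceCount ρ ℕ.+ isolatedCount G ≡ edgeCount G ℕ.+ 2 ℕ.* componentCount G

Dist : Set → Set
Dist A = List (ℚᵘ × A)

ret : ∀ {A : Set} → A → Dist A
ret x = (1ℚᵘ , x) ∷ []

_>>=_ : ∀ {A B : Set} → Dist A → (A → Dist B) → Dist B
D >>= f = concatMap (λ p → map (λ q → (proj₁ p ℚ.* proj₁ q , proj₂ q)) (f (proj₂ p))) D

uniform : ∀ {A : Set} → List A → Dist (Maybe A)
uniform [] = ret nothing
uniform xs@(_ ∷ _) = map (λ x → (+ 1 ℚ./ length xs , just x)) xs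

weight : ∀ {A : Set} → Dist A → ℚᵘ
weight = foldr (λ p s → proj₁ p ℚ.+ s) 0ℚᵘ

-- Pr_D[P] ≥ δ : some sub-collection of outcomes all satisfying P has
-- total weight ≥ δ (weights are nonnegative, so this is Pr ≥ δ)
PrAtLeast : ∀ {A : Set} → Dist A → (A → Set) → ℚᵘ → Set
PrAtLeast D P δ = ∃ λ S → S ⊆ D × All (λ p → P (proj₂ p)) S × δ ℚ.≤ weight S

neighbours : ∀ {n} → Graph n → Fin n → List (Fin n)
neighbours {n} G u = filterᵇ (adj G u) (allFin n)

query : ∀ {n} → Graph n → Fin n → Dist (Maybe (Fin n))
query G u = uniform (neighbours G u)

queries : ∀ {n} → Graph n → Fin n → ℕ → Dist (List (Fin n))
queries G u zero = ret []
queries G u (suc d) = queries G u d >>= λ xs → query G u >>= λ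
  { nothing → ret xs ; (just x) → ret (x ∷ xs) }

layerEdges : ∀ {n} → Graph n → ℕ → List (Fin n) → Dist (List (Fin n × Fin n))
layerEdges G d [] = ret []
layerEdges G d (u ∷ us) = queries G u d >>= λ Γ → layerEdges G d us >>= λ es →
  ret (map (λ x → (u , x)) Γ ++ es)

record TState (n : ℕ) : Set where
  constructor tstate
  field
    visited  : List (Fin n)
    layer    : List (Fin n)
    recorded : List (Fin n × Fin n)
    nQueries : ℕ
open TState public

elemᵇ : ∀ {n} → Fin n → List (Fin n) → Bool
elemᵇ x = any (x ==_)

traverseFrom : ∀ {n} → Graph n → ℕ → ℕ → TState n → Dist (TState n)
traverseFrom G d zero s = ret s
traverseFrom G d (suc l) s = layerEdges G d (layer s) >>= λ es →
  let new = deduplicate _≟_ (filterᵇ (λ x → not (elemᵇ x (visited s))) (map proj₂ es))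
  in traverseFrom G d l (tstate (visited s ++ new) new (recorded s ++ es)
                                (nQueries s ℕ.+ d ℕ.* length (layer s)))

Traverse : ∀ {n} → Graph n → Fin n → ℕ → ℕ → Dist (TState n)
Traverse G v d ℓ = traverseFrom G d ℓ (tstate (v ∷ []) (v ∷ []) [] 0)

RLBD : ∀ {n k} → Graph n → Graph k → ℕ → ℕ → Dist (Maybe (Fin n × TState n))
RLBD {n} G H d ℓ = uniform (allFin n) >>= λ
  { nothing → ret nothing
  ; (just v) → Traverse G v d ℓ >>= λ s → ret (just (v , s)) }

ContainsCopy : ∀ {k n} → Graph k → Fin n → List (Fin n × Fin n) → Set
ContainsCopy {k} {n} H v es = Σ (Fin k → Fin n) λ f → Injective _≡_ _≡_ f ×
  (∀ a → f a ∈ (v ∷ map proj₁ es ++ map proj₂ es)) ×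
  (∀ a b → adj H a b ≡ true → ((f a , f b) ∈ es) ⊎ ((f b , f a) ∈ es))

FindsCopy : ∀ {k n} → Graph k → Maybe (Fin n × TState n) → Set
FindsCopy H nothing = ⊥'
  where open import Data.Empty renaming (⊥ to ⊥')
FindsCopy H (just (v , s)) = ContainsCopy H v (recorded s)

QueryCount : ∀ {n} → Maybe (Fin n × TState n) → ℕ
QueryCount nothing = 0
QueryCount (just (_ , s)) = nQueries s

geomSum : ℕ → ℕ → ℕ
geomSum d zero = 0
geomSum d (suc l) = geomSum d l ℕ.+ d ℕ.^ suc l

{-# OPTIONS --safe #-}
{-
If G is ε-far from H-free, deleting copies of H greedily produces linearly many
edge-disjoint copies. A random colouring makes each vertex play one role (vertex
of H) only, at the cost of a constant fraction of the copies.

Say that role a determines role b if copies that agree in a agree in b. Let K be a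
connected set of roles that all determine t ∈ K, and let v be a role adjacent to K.
Contracting the parts of the copies with roles in K turns the pairs (image of v,
image of t) into the edges of a planar, hence degenerate, simple graph; keeping for
each vertex only its heaviest outgoing pair makes v determine t or t determine v, and
again costs a constant fraction. So we may assume that every connected set of roles
has a top, a role determined by all the others in the set. Finally, vertices whose
degree in G is much larger than the number of copies through them are discarded,
which costs little since G has at most 3n edges.

Now a random neighbour of a vertex x of role a continues, with constant probability,
some copy through x, for each neighbour b of a. With constant probability this
happens, for every b, at every queried vertex. Then a copy is found: climb to the top t of
all roles, delete t, climb to the top of each component of the remaining roles, and
so on. Every piece determines all the tops above it, so pieces coming from different
copies fit together.

The density of planar minors comes from Euler's formula as follows. List the edges;
merging endpoints along the list and faces along the reversed list, no edge merges
both, because a union of face classes is a circulation and has no net flow across the cut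
given by a primal class. Euler's formula says that the two processes make at least as many merges as
there are edges, hence every edge merges exactly once. If the list
starts with the contracted and ends with the deleted edges, the edges of a simple minor
make at most |V| primal merges, and at most 2|E|/3 dual ones, since every
dual class with a boundary has at least three boundary darts.
-}
module Submission where

open import Defs
open import Data.Bool using (Bool; true; false; _∧_; _∨_; not; if_then_else_; T?)
open import Data.Nat as ℕ using (ℕ; zero; suc; _+_; _*_; _∸_; _^_; _≤_; z≤n; s≤s)
import Data.Nat.Properties as ℕₚ
open import Data.Nat.Tactic.RingSolver using (solve-∀)
open import Data.Fin as Fin using (Fin; zero; suc; toℕ)
open import Data.Fin.Properties as Finₚ using (_≟_)
open import Data.List using (List; []; _∷_; _++_; map; filterᵇ; length; concatMap; deduplicate; allFin; cartesianProduct)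
import Data.List.Properties as Listₚ
open import Data.List.Membership.Propositional using (_∈_; _∉_; lose; find)
import Data.List.Membership.Propositional.Properties as ∈ₚ
open import Data.List.Membership.DecPropositional using () renaming (_∈?_ to member?)
open import Data.List.Relation.Unary.All as All using (All; []; _∷_)
import Data.List.Relation.Unary.All.Properties as Allₚ
open import Data.List.Relation.Unary.Any as Any using (Any; here; there)
open import Data.List.Relation.Unary.AllPairs using ([]; _∷_)
open import Data.List.Relation.Unary.Unique.Propositional using (Unique)
import Data.List.Relation.Unary.Unique.Propositional.Properties as Uniqueₚ
open import Data.List.Relation.Unary.Unique.DecPropositional.Properties using (deduplicate-!)
open import Data.List.Relation.Binary.Sublist.Propositional using (_⊆_; []; _∷_; _∷ʳ_)
import Data.List.Relation.Binary.Sublist.Propositional.Properties as ⊆ₚ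
open import Data.Bool.ListAction using (any; all)
open import Data.Maybe using (Maybe; just; nothing)
open import Data.Product using (Σ; ∃; _×_; _,_; proj₁; proj₂)
open import Data.Product.Properties using (≡-dec)
open import Data.Sum as Sum using (_⊎_; inj₁; inj₂; [_,_]′)
open import Data.Empty using (⊥; ⊥-elim)
open import Data.Unit using (⊤; tt)
import Data.Integer as ℤ
import Data.Integer.Properties as ℤₚ
open import Data.Rational.Unnormalised as ℚ using (ℚᵘ; 0ℚᵘ; 1ℚᵘ; _<_)
import Data.Rational.Unnormalised.Properties as ℚₚ
open import Function using (_∘_; id)
open import Function.Definitions using (Injective)
open import Relation.Nullary using (¬_; Dec; yes; no)
open import Relation.Nullary.Decidable using (⌊_⌋; ¬?; _×-dec_; _→-dec_; map′)
open import Relation.Binary using (DecidableEquality; IsEquivalence)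
open import Relation.Binary.PropositionalEquality using (_≡_; _≢_; refl; trans; cong; cong₂; subst; subst₂; module ≡-Reasoning) renaming (sym to ≡-sym)

-- Counting in lists

true≢false : true ≢ false
true≢false ()

≡true? : (b : Bool) → Dec (b ≡ true)
≡true? true  = yes refl
≡true? false = no λ ()

⌊⌋⁺ : ∀ {A : Set} (a? : Dec A) → A → ⌊ a? ⌋ ≡ true
⌊⌋⁺ (yes _) _ = refl
⌊⌋⁺ (no ¬a) a = ⊥-elim (¬a a)

⌊⌋⁻ : ∀ {A : Set} (a? : Dec A) → ⌊ a? ⌋ ≡ true → A
⌊⌋⁻ (yes a) _ = a

⌊⌋-false : ∀ {A : Set} (a? : Dec A) → ¬ A → ⌊ a? ⌋ ≡ false
⌊⌋-false (yes a) ¬a = ⊥-elim (¬a a)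
⌊⌋-false (no _)  _  = refl

⌊⌋-cong : ∀ {A B : Set} (a? : Dec A) (b? : Dec B) → (A → B) → (B → A) → ⌊ a? ⌋ ≡ ⌊ b? ⌋
⌊⌋-cong (yes a) b? f g = ≡-sym (⌊⌋⁺ b? (f a))
⌊⌋-cong (no ¬a) b? f g = ≡-sym (⌊⌋-false b? (¬a ∘ g))

not⁺ : ∀ {b} → b ≢ true → not b ≡ true
not⁺ {true}  h = ⊥-elim (h refl)
not⁺ {false} h = refl

not⁻ : ∀ {b} → not b ≡ true → b ≢ true
not⁻ {false} _ ()

not⌊⌋⁻ : ∀ {A : Set} (a? : Dec A) → not ⌊ a? ⌋ ≢ true → A
not⌊⌋⁻ (yes a) _ = a
not⌊⌋⁻ (no _)  h = ⊥-elim (h refl)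

∧⁺ : ∀ {a b} → a ≡ true → b ≡ true → a ∧ b ≡ true
∧⁺ refl refl = refl

∧⁻ : ∀ {a b} → a ∧ b ≡ true → a ≡ true × b ≡ true
∧⁻ {true} h = refl , h

∨⁺ˡ : ∀ {a b} → a ≡ true → a ∨ b ≡ true
∨⁺ˡ refl = refl

∨⁺ʳ : ∀ {a b} → b ≡ true → a ∨ b ≡ true
∨⁺ʳ {true}  _ = refl
∨⁺ʳ {false} h = h

∨⁻ : ∀ {a b} → a ∨ b ≡ true → a ≡ true ⊎ b ≡ true
∨⁻ {true}  h = inj₁ refl
∨⁻ {false} h = inj₂ h

any⁺ : ∀ {A : Set} (p : A → Bool) {x xs} → x ∈ xs → p x ≡ true → any p xs ≡ true
any⁺ p (here refl) h = ∨⁺ˡ h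
any⁺ p {xs = y ∷ _} (there x∈) h = ∨⁺ʳ {p y} (any⁺ p x∈ h)

any⁻ : ∀ {A : Set} (p : A → Bool) xs → any p xs ≡ true → ∃ λ x → x ∈ xs × p x ≡ true
any⁻ p (x ∷ xs) h with ∨⁻ {p x} h
... | inj₁ px = x , here refl , px
... | inj₂ h' with any⁻ p xs h'
...   | y , y∈ , py = y , there y∈ , py

all⁺ : ∀ {A : Set} (p : A → Bool) xs → (∀ {x} → x ∈ xs → p x ≡ true) → all p xs ≡ true
all⁺ p []       h = refl
all⁺ p (x ∷ xs) h = ∧⁺ (h (here refl)) (all⁺ p xs (h ∘ there))

all⁻ : ∀ {A : Set} (p : A → Bool) xs {x} → all p xs ≡ true → x ∈ xs → p x ≡ true
all⁻ p (y ∷ xs) h (here refl) = proj₁ (∧⁻ {p y} h)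
all⁻ p (y ∷ xs) h (there x∈)  = all⁻ p xs (proj₂ (∧⁻ {p y} h)) x∈

∈-filterᵇ⁺ : ∀ {A : Set} (p : A → Bool) {x xs} → x ∈ xs → p x ≡ true → x ∈ filterᵇ p xs
∈-filterᵇ⁺ p {xs = y ∷ xs} x∈ px with p y in eq
∈-filterᵇ⁺ p (here refl) px | true  = here refl
∈-filterᵇ⁺ p (there x∈)  px | true  = there (∈-filterᵇ⁺ p x∈ px)
∈-filterᵇ⁺ p (here refl) px | false = ⊥-elim (true≢false (trans (≡-sym px) eq))
∈-filterᵇ⁺ p (there x∈)  px | false = ∈-filterᵇ⁺ p x∈ px

∈-filterᵇ⁻ : ∀ {A : Set} (p : A → Bool) {x} xs → x ∈ filterᵇ p xs → x ∈ xs × p x ≡ true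
∈-filterᵇ⁻ p (y ∷ xs) x∈ with p y in eq
∈-filterᵇ⁻ p (y ∷ xs) (here refl) | true = here refl , eq
∈-filterᵇ⁻ p (y ∷ xs) (there x∈)  | true with ∈-filterᵇ⁻ p xs x∈
... | x∈' , px = there x∈' , px
∈-filterᵇ⁻ p (y ∷ xs) x∈          | false with ∈-filterᵇ⁻ p xs x∈
... | x∈' , px = there x∈' , px

Unique-filterᵇ : ∀ {A : Set} (p : A → Bool) {xs} → Unique xs → Unique (filterᵇ p xs)
Unique-filterᵇ p {[]} [] = []
Unique-filterᵇ p {x ∷ xs} (x∉ ∷ u) with p x
... | true  = All.tabulate (λ {y} y∈ → All.lookup x∉ (proj₁ (∈-filterᵇ⁻ p xs y∈))) ∷ Unique-filterᵇ p u
... | false = Unique-filterᵇ p u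

Unique-map : ∀ {A B : Set} (f : A → B) xs → Unique xs →
  (∀ {x y} → x ∈ xs → y ∈ xs → f x ≡ f y → x ≡ y) → Unique (map f xs)
Unique-map f [] [] h = []
Unique-map f (x ∷ xs) (x∉ ∷ u) h =
  All.tabulate (λ {z} z∈ fx≡z → let (y , y∈ , z≡fy) = ∈ₚ.∈-map⁻ f z∈
    in All.lookup x∉ y∈ (h (here refl) (there y∈) (trans fx≡z z≡fy)))
  ∷ Unique-map f xs u (λ a b → h (there a) (there b))

Unique-⊆⇒length≤ : ∀ {A : Set} {xs ys : List A} → Unique xs → (∀ {x} → x ∈ xs → x ∈ ys) → length xs ≤ length ys
Unique-⊆⇒length≤ {xs = []} _ _ = z≤n
Unique-⊆⇒length≤ {xs = x ∷ xs} (x∉ ∷ u) sub with ∈ₚ.∈-∃++ (sub (here refl))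
... | as , bs , refl = subst (suc (length xs) ≤_) (≡-sym len) (s≤s (Unique-⊆⇒length≤ u sub'))
  where
  len : length (as ++ x ∷ bs) ≡ suc (length (as ++ bs))
  len = trans (Listₚ.length-++ as) (trans (ℕₚ.+-suc (length as) (length bs)) (cong suc (≡-sym (Listₚ.length-++ as))))
  sub' : ∀ {y} → y ∈ xs → y ∈ as ++ bs
  sub' {y} y∈ with ∈ₚ.∈-++⁻ as (sub (there y∈))
  ... | inj₁ y∈as = ∈ₚ.∈-++⁺ˡ y∈as
  ... | inj₂ (here y≡x) = ⊥-elim (All.lookup x∉ y∈ (≡-sym y≡x))
  ... | inj₂ (there y∈bs) = ∈ₚ.∈-++⁺ʳ as y∈bs

injection⇒length≤ : ∀ {A B : Set} (f : A → B) (xs : List A) (ys : List B) → Unique xs →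
  (∀ {x y} → x ∈ xs → y ∈ xs → f x ≡ f y → x ≡ y) → (∀ {x} → x ∈ xs → f x ∈ ys) →
  length xs ≤ length ys
injection⇒length≤ f xs ys u inj into =
  subst (_≤ length ys) (Listₚ.length-map f xs)
    (Unique-⊆⇒length≤ (Unique-map f xs u inj)
      (λ z∈ → let (x , x∈ , z≡) = ∈ₚ.∈-map⁻ f z∈ in subst (_∈ ys) (≡-sym z≡) (into x∈)))

# : ∀ {A : Set} → (A → Bool) → List A → ℕ
# p xs = length (filterᵇ p xs)

#-split : ∀ {A : Set} (p q : A → Bool) xs →
  # p xs ≡ # (λ x → p x ∧ q x) xs + # (λ x → p x ∧ not (q x)) xs
#-split p q [] = refl
#-split p q (x ∷ xs) with p x | q x
... | true  | true  = cong suc (#-split p q xs)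
... | true  | false = trans (cong suc (#-split p q xs)) (≡-sym (ℕₚ.+-suc _ _))
... | false | _     = #-split p q xs

#-mono : ∀ {A : Set} (p q : A → Bool) xs → (∀ {x} → x ∈ xs → p x ≡ true → q x ≡ true) → # p xs ≤ # q xs
#-mono p q [] h = z≤n
#-mono p q (x ∷ xs) h with p x in ep | q x in eq
... | true  | true  = s≤s (#-mono p q xs (h ∘ there))
... | true  | false = ⊥-elim (true≢false (trans (≡-sym (h (here refl) ep)) eq))
... | false | true  = ℕₚ.m≤n⇒m≤1+n (#-mono p q xs (h ∘ there))
... | false | false = #-mono p q xs (h ∘ there)

#-cong : ∀ {A : Set} (p q : A → Bool) xs → (∀ {x} → x ∈ xs → p x ≡ q x) → # p xs ≡ # q xs
#-cong p q xs h = ℕₚ.≤-antisym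
  (#-mono p q xs (λ x∈ px → trans (≡-sym (h x∈)) px))
  (#-mono q p xs (λ x∈ qx → trans (h x∈) qx))

#-all : ∀ {A : Set} (p : A → Bool) xs → (∀ {x} → x ∈ xs → p x ≡ true) → # p xs ≡ length xs
#-all p [] h = refl
#-all p (x ∷ xs) h with p x | h (here refl)
... | true | _ = cong suc (#-all p xs (h ∘ there))

#≤length : ∀ {A : Set} (p : A → Bool) xs → # p xs ≤ length xs
#≤length p xs = Listₚ.length-filter _ xs

#-partition : ∀ {A : Set} (q : A → Bool) xs → length xs ≡ # q xs + # (not ∘ q) xs
#-partition q [] = refl
#-partition q (x ∷ xs) with q x
... | true  = cong suc (#-partition q xs)
... | false = trans (cong suc (#-partition q xs)) (≡-sym (ℕₚ.+-suc _ _))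

#-disjoint-∨ : ∀ {A : Set} (p q : A → Bool) xs → (∀ x → p x ≡ true → q x ≡ true → ⊥) →
  # (λ x → p x ∨ q x) xs ≡ # p xs + # q xs
#-disjoint-∨ p q [] h = refl
#-disjoint-∨ p q (x ∷ xs) h with p x in ep | q x in eq
... | true  | true  = ⊥-elim (h x ep eq)
... | true  | false = cong suc (#-disjoint-∨ p q xs h)
... | false | true  = trans (cong suc (#-disjoint-∨ p q xs h)) (≡-sym (ℕₚ.+-suc _ _))
... | false | false = #-disjoint-∨ p q xs h

#-pos : ∀ {A : Set} (p : A → Bool) {x} xs → x ∈ xs → p x ≡ true → 1 ≤ # p xs
#-pos p xs x∈ px with filterᵇ p xs | ∈-filterᵇ⁺ p x∈ px
... | _ ∷ _ | _ = s≤s z≤n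

#-pos⁻ : ∀ {A : Set} (p : A → Bool) xs → 1 ≤ # p xs → ∃ λ x → x ∈ xs × p x ≡ true
#-pos⁻ p xs h with filterᵇ p xs in eq
#-pos⁻ p xs () | []
... | x ∷ _ = x , ∈-filterᵇ⁻ p xs (subst (x ∈_) (≡-sym eq) (here refl))

#-remove : ∀ {A : Set} (p q : A → Bool) {r} xs → Unique xs → r ∈ xs → p r ≡ true → q r ≡ false →
  (∀ x → x ≢ r → q x ≡ p x) → # p xs ≡ suc (# q xs)
#-remove p q (x ∷ xs) (x∉ ∷ u) (here refl) pr qr h with p x | q x | pr | qr
... | true | false | _ | _ = cong suc (#-cong p q xs (λ y∈ → ≡-sym (h _ (λ y≡ → All.lookup x∉ y∈ (≡-sym y≡)))))
#-remove p q {r} (x ∷ xs) (x∉ ∷ u) (there r∈) pr qr h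
  with p x | q x | h x (λ x≡r → All.lookup x∉ r∈ x≡r)
... | true  | true  | _ = cong suc (#-remove p q xs u r∈ pr qr h)
... | false | false | _ = #-remove p q xs u r∈ pr qr h

∈-singleton⁻ : ∀ {A : Set} {x y : A} → x ∈ y ∷ [] → x ≡ y
∈-singleton⁻ (here e) = e

module _ {A B : Set} (_≟B_ : DecidableEquality B) (f : A → B) where

  -- Fibres over distinct values are disjoint, so the one over `y` can be removed from `zs` without
  -- touching the others.
  fibres-≤ : ∀ k (ys : List B) (zs : List A) → Unique ys →
    (∀ {y} → y ∈ ys → k ≤ # (λ z → ⌊ f z ≟B y ⌋) zs) → k * length ys ≤ length zs
  fibres-≤ k [] zs u h = subst (_≤ length zs) (≡-sym (ℕₚ.*-zeroʳ k)) z≤n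
  fibres-≤ k (y ∷ ys) zs (y∉ ∷ u) h = begin
    k * suc (length ys)             ≡⟨ ℕₚ.*-suc k (length ys) ⟩
    k + k * length ys               ≤⟨ ℕₚ.+-mono-≤ (h (here refl)) (fibres-≤ k ys rest u h') ⟩
    # at zs + length rest           ≡⟨ #-partition at zs ⟨
    length zs                       ∎
    where
    open ℕₚ.≤-Reasoning
    at = λ z → ⌊ f z ≟B y ⌋
    rest = filterᵇ (not ∘ at) zs
    h' : ∀ {y'} → y' ∈ ys → k ≤ # (λ z → ⌊ f z ≟B y' ⌋) rest
    h' {y'} y'∈ = ℕₚ.≤-trans (h (there y'∈)) (kept zs)
      where
      kept : ∀ zs → # (λ z → ⌊ f z ≟B y' ⌋) zs ≤ # (λ z → ⌊ f z ≟B y' ⌋) (filterᵇ (not ∘ at) zs)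
      kept [] = z≤n
      kept (z ∷ zs) with f z ≟B y
      ... | yes fz≡y with f z ≟B y'
      ...   | yes fz≡y' = ⊥-elim (All.lookup y∉ y'∈ (trans (≡-sym fz≡y) fz≡y'))
      ...   | no _ = kept zs
      kept (z ∷ zs) | no _ with f z ≟B y'
      ...   | yes _ = s≤s (kept zs)
      ...   | no _ = kept zs

  -- Pigeonhole: the fibre over `y₀` is split off and compared with the heaviest fibre among the
  -- remaining elements.
  heaviest-fibre : ∀ (p : A → Bool) xs (y₀ : B) ys → (∀ {x} → x ∈ xs → p x ≡ true → f x ∈ y₀ ∷ ys) →
    ∃ λ y → # p xs ≤ suc (length ys) * # (λ x → p x ∧ ⌊ f x ≟B y ⌋) xs
  heaviest-fibre p xs y₀ [] h = y₀ , ℕₚ.≤-trans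
    (#-mono p _ xs (λ {x} x∈ px → ∧⁺ px (⌊⌋⁺ (f x ≟B y₀) (∈-singleton⁻ (h x∈ px)))))
    (ℕₚ.≤-reflexive (≡-sym (ℕₚ.*-identityˡ _)))
  heaviest-fibre p xs y₀ (y₁ ∷ ys) h
    with heaviest-fibre (λ x → p x ∧ not ⌊ f x ≟B y₀ ⌋) xs y₁ ys h'
    where
    h' : ∀ {x} → x ∈ xs → p x ∧ not ⌊ f x ≟B y₀ ⌋ ≡ true → f x ∈ y₁ ∷ ys
    h' {x} x∈ e with ∧⁻ {p x} e
    ... | px , ne with h x∈ px
    ...   | here fx≡ = ⊥-elim (not⁻ ne (⌊⌋⁺ (f x ≟B y₀) fx≡))
    ...   | there i = i
  ... | y , le with ℕₚ.≤-total (# (λ x → p x ∧ ⌊ f x ≟B y₀ ⌋) xs) (# (λ x → p x ∧ ⌊ f x ≟B y ⌋) xs)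
  ...   | inj₁ a≤b = y , (begin
    # p xs                       ≡⟨ #-split p (λ x → ⌊ f x ≟B y₀ ⌋) xs ⟩
    # at₀ xs + # r xs            ≤⟨ ℕₚ.+-mono-≤ a≤b (ℕₚ.≤-trans le (ℕₚ.*-monoʳ-≤ (suc (length ys)) sub)) ⟩
    suc (suc (length ys)) * # (λ x → p x ∧ ⌊ f x ≟B y ⌋) xs ∎)
    where
    open ℕₚ.≤-Reasoning
    at₀ = λ x → p x ∧ ⌊ f x ≟B y₀ ⌋
    r = λ x → p x ∧ not ⌊ f x ≟B y₀ ⌋
    sub : # (λ x → r x ∧ ⌊ f x ≟B y ⌋) xs ≤ # (λ x → p x ∧ ⌊ f x ≟B y ⌋) xs
    sub = #-mono _ _ xs (λ {x} _ e → let (e₁ , e₂) = ∧⁻ {r x} e in ∧⁺ (proj₁ (∧⁻ {p x} e₁)) e₂)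
  ...   | inj₂ b≤a = y₀ , (begin
    # p xs                       ≡⟨ #-split p (λ x → ⌊ f x ≟B y₀ ⌋) xs ⟩
    # at₀ xs + # r xs            ≤⟨ ℕₚ.+-monoʳ-≤ (# at₀ xs) (ℕₚ.≤-trans le (ℕₚ.*-monoʳ-≤ (suc (length ys)) (ℕₚ.≤-trans sub b≤a))) ⟩
    suc (suc (length ys)) * # at₀ xs ∎)
    where
    open ℕₚ.≤-Reasoning
    at₀ = λ x → p x ∧ ⌊ f x ≟B y₀ ⌋
    r = λ x → p x ∧ not ⌊ f x ≟B y₀ ⌋
    sub : # (λ x → r x ∧ ⌊ f x ≟B y ⌋) xs ≤ # (λ x → p x ∧ ⌊ f x ≟B y ⌋) xs
    sub = #-mono _ _ xs (λ {x} _ e → let (e₁ , e₂) = ∧⁻ {r x} e in ∧⁺ (proj₁ (∧⁻ {p x} e₁)) e₂)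

least : ∀ {n} (p : Fin n → Bool) {x} → p x ≡ true →
  ∃ λ y → p y ≡ true × (∀ z → p z ≡ true → toℕ y ≤ toℕ z)
least {suc n} p {x} px with ≡true? (p zero)
... | yes p0 = zero , p0 , λ _ _ → z≤n
least {suc n} p {zero} px | no ¬p0 = ⊥-elim (¬p0 px)
least {suc n} p {suc x} px | no ¬p0 with least (p ∘ suc) px
... | y , py , min = suc y , py , λ { zero pz → ⊥-elim (¬p0 pz) ; (suc z) pz → s≤s (min z pz) }

∈-allPairs : ∀ {n} (a b : Fin n) → (a , b) ∈ allPairs n
∈-allPairs {n} a b = ∈ₚ.∈-concatMap⁺ (λ i → map (λ j → (i , j)) (allFin n)) (lose (∈ₚ.∈-allFin a) (∈ₚ.∈-map⁺ (a ,_) (∈ₚ.∈-allFin b)))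

Unique-allPairs : ∀ n → Unique (allPairs n)
Unique-allPairs n = go (allFin n) (Uniqueₚ.allFin⁺ n)
  where
  row : Fin n → List (Fin n × Fin n)
  row i = map (λ j → (i , j)) (allFin n)
  fst : ∀ is {z} → z ∈ concatMap row is → proj₁ z ∈ is
  fst (i ∷ is) z∈ with ∈ₚ.∈-++⁻ (row i) z∈
  ... | inj₁ z∈row = let (_ , _ , e) = ∈ₚ.∈-map⁻ (i ,_) z∈row in here (cong proj₁ e)
  ... | inj₂ z∈' = there (fst is z∈')
  go : ∀ is → Unique is → Unique (concatMap row is)
  go [] [] = []
  go (i ∷ is) (i∉ ∷ u) = Uniqueₚ.++⁺ (Unique-map (i ,_) (allFin n) (Uniqueₚ.allFin⁺ n) (λ _ _ → cong proj₂)) (go is u)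
    λ { (z∈row , z∈') → let (_ , _ , e) = ∈ₚ.∈-map⁻ (i ,_) z∈row in
        All.lookup i∉ (fst is z∈') (≡-sym (cong proj₁ e)) }

-- Union-find labellings

module UnionFind {A : Set} (_≟A_ : DecidableEquality A) where

  Idem : (A → A) → Set
  Idem lab = ∀ x → lab (lab x) ≡ lab x

  -- The class of `b` takes over the label of `a`; if the two classes differ, `lab b` is the root
  -- that disappears.
  join : (A → A) → A → A → A → A
  join lab a b x = if ⌊ lab x ≟A lab b ⌋ then lab a else lab x

  flag : (A → A) → A → A → ℕ
  flag lab a b = if ⌊ lab a ≟A lab b ⌋ then 0 else 1

  roots : (A → A) → List A → ℕ
  roots lab = # (λ x → ⌊ lab x ≟A x ⌋)

  module _ (lab : A → A) (a b : A) where

    join-cases : ∀ x → (lab x ≡ lab b × join lab a b x ≡ lab a) ⊎ (lab x ≢ lab b × join lab a b x ≡ lab x)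
    join-cases x with lab x ≟A lab b
    ... | yes e = inj₁ (e , refl)
    ... | no ¬e = inj₂ (¬e , refl)

    join-glues : join lab a b a ≡ join lab a b b
    join-glues with join-cases a | join-cases b
    ... | inj₁ (_ , e) | inj₁ (_ , e') = trans e (≡-sym e')
    ... | inj₂ (_ , e) | inj₁ (_ , e') = trans e (≡-sym e')
    ... | _            | inj₂ (¬e , _) = ⊥-elim (¬e refl)

    join-preserves : ∀ {x y} → lab x ≡ lab y → join lab a b x ≡ join lab a b y
    join-preserves e rewrite e = refl

    join-idem : Idem lab → Idem (join lab a b)
    join-idem idem x with join-cases x
    ... | inj₁ (_ , e) rewrite e with join-cases (lab a)
    ...   | inj₁ (_ , e') = e'
    ...   | inj₂ (_ , e') = trans e' (idem a)
    join-idem idem x | inj₂ (ne , e) rewrite e with join-cases (lab x)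
    ...   | inj₁ (e' , _) = ⊥-elim (ne (trans (≡-sym (idem x)) e'))
    ...   | inj₂ (_ , e') = trans e' (idem x)

    -- Induction principle for labellings: iterated over the joins, it turns equality of labels into
    -- any equivalence that every join respects.
    join-sound : ∀ {R : A → A → Set} → IsEquivalence R → (∀ {x y} → lab x ≡ lab y → R x y) → R a b →
      ∀ {x y} → join lab a b x ≡ join lab a b y → R x y
    join-sound eq h Rab {x} {y} e with join-cases x | join-cases y
    ... | inj₁ (ex , _)  | inj₁ (ey , _)  = h (trans ex (≡-sym ey))
    ... | inj₁ (ex , jx) | inj₂ (_ , jy)  = IsEquivalence.trans eq (h ex) (IsEquivalence.trans eq (IsEquivalence.sym eq Rab) (h (trans (≡-sym jx) (trans e jy))))
    ... | inj₂ (_ , jx)  | inj₁ (ey , jy) = IsEquivalence.trans eq (h (trans (≡-sym jx) (trans e jy))) (IsEquivalence.trans eq Rab (IsEquivalence.sym eq (h ey)))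
    ... | inj₂ (_ , jx)  | inj₂ (_ , jy)  = h (trans (≡-sym jx) (trans e jy))

    join-closed : ∀ {P : A → Set} → P (lab a) → ∀ x → P (lab x) → P (join lab a b x)
    join-closed {P} pa x px with join-cases x
    ... | inj₁ (_ , e) = subst P (≡-sym e) pa
    ... | inj₂ (_ , e) = subst P (≡-sym e) px

    -- `lab b` is the only element whose status as a root can change, and it must lie in `xs` for
    -- the loss to be seen there.
    roots-join : Idem lab → ∀ {xs} → Unique xs → lab a ≡ lab b ⊎ lab b ∈ xs →
      roots lab xs ≡ roots (join lab a b) xs + flag lab a b
    roots-join idem {xs} u h with lab a ≟A lab b
    ... | yes e = trans (#-cong _ _ xs (λ {x} _ → ⌊⌋-cong (lab x ≟A x) (join lab a b x ≟A x) (trans (same x)) (trans (≡-sym (same x)))))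
                        (≡-sym (ℕₚ.+-identityʳ _))
      where
      same : ∀ x → join lab a b x ≡ lab x
      same x with join-cases x
      ... | inj₁ (ex , j) = trans j (trans e (≡-sym ex))
      ... | inj₂ (_ , j)  = j
    roots-join idem {xs} u (inj₁ e) | no ne = ⊥-elim (ne e)
    roots-join idem {xs} u (inj₂ b∈) | no ne = trans
      (#-remove _ _ xs u b∈ (⌊⌋⁺ (lab (lab b) ≟A lab b) (idem b)) (⌊⌋-false (join lab a b (lab b) ≟A lab b) lost) other)
      (ℕₚ.+-comm 1 _)
      where
      lost : join lab a b (lab b) ≢ lab b
      lost e with join-cases (lab b)
      ... | inj₁ (_ , j) = ne (trans (≡-sym j) e)
      ... | inj₂ (n , _) = n (idem b)
      other : ∀ x → x ≢ lab b → ⌊ join lab a b x ≟A x ⌋ ≡ ⌊ lab x ≟A x ⌋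
      other x x≢ = ⌊⌋-cong (join lab a b x ≟A x) (lab x ≟A x) to from
        where
        to : join lab a b x ≡ x → lab x ≡ x
        to e with join-cases x
        ... | inj₁ (ex , j) = ⊥-elim (ne (trans (≡-sym (idem a)) (trans (cong lab (trans (≡-sym j) e)) ex)))
        ... | inj₂ (_ , j)  = trans (≡-sym j) e
        from : lab x ≡ x → join lab a b x ≡ x
        from e with join-cases x
        ... | inj₁ (ex , j) = ⊥-elim (x≢ (trans (≡-sym e) ex))
        ... | inj₂ (_ , j)  = trans j e

-- Primal and dual merges

Dart : ℕ → Set
Dart n = Fin n × Fin n

_≟D_ : ∀ {n} → DecidableEquality (Dart n)
_≟D_ = ≡-dec _≟_ _≟_

flip : ∀ {n} → Dart n → Dart n
flip (a , b) = (b , a)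

adjᵈ : ∀ {n} → Graph n → Dart n → Bool
adjᵈ G (a , b) = adj G a b

adjᵈ-flip : ∀ {n} (G : Graph n) d → adjᵈ G (flip d) ≡ adjᵈ G d
adjᵈ-flip G (a , b) = sym G b a

module _ {n} (G : Graph n) (ρ : Rotation G) where

  φ-dart : ∀ d → adjᵈ G d ≡ true → adjᵈ G (faceStep ρ d) ≡ true
  φ-dart (a , b) h = closed ρ b a (trans (sym G b a) h)

  φ-injective : ∀ d e → adjᵈ G d ≡ true → adjᵈ G e ≡ true → faceStep ρ d ≡ faceStep ρ e → d ≡ e
  φ-injective (a , b) (a' , b') h h' e with cong proj₁ e | cong proj₂ e
  ... | refl | e₂ = cong (_, b) (inj ρ b a a' (trans (sym G b a) h) (trans (sym G b a') h') e₂)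

  -- A φ-invariant set of darts is a circulation: φ injects the darts entering a
  -- vertex set into those leaving it, so a net inflow across a cut forces a net outflow.
  cut-balance : (s : Dart n → Bool) → (∀ d → adjᵈ G d ≡ true → s d ≡ true → s (faceStep ρ d) ≡ true) →
    (A : Fin n → Bool) → ∀ x₀ y₀ → adj G x₀ y₀ ≡ true → A x₀ ≢ true → A y₀ ≡ true →
    s (x₀ , y₀) ≡ true → s (y₀ , x₀) ≢ true →
    ∃ λ y → ∃ λ x → adj G y x ≡ true × A y ≡ true × A x ≢ true × s (y , x) ≡ true × s (x , y) ≢ true
  cut-balance s s-φ A x₀ y₀ dart₀ x₀∉ y₀∈ s₀ ¬s₀ with Finₚ.any? (λ y → Finₚ.any? (λ x → good? y x))
    where
    good? : ∀ y x → Dec (adj G y x ≡ true × A y ≡ true × A x ≢ true × s (y , x) ≡ true × s (x , y) ≢ true)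
    good? y x = ≡true? _ ×-dec ≡true? _ ×-dec ¬? (≡true? _) ×-dec ≡true? _ ×-dec ¬? (≡true? _)
  ... | yes found = found
  ... | no none = ⊥-elim (ℕₚ.<-irrefl refl (ℕₚ.<-≤-trans in-fewer out≤in'))
    where
    ds = allPairs n
    live : Dart n → Bool
    live d = adjᵈ G d ∧ s d
    head tail : Dart n → Bool
    head = A ∘ proj₂
    tail = A ∘ proj₁
    inn out both both' : Dart n → Bool
    inn d  = (live d ∧ head d) ∧ not (tail d)
    out d  = (live d ∧ tail d) ∧ not (head d)
    both d = (live d ∧ head d) ∧ tail d
    both' d = (live d ∧ tail d) ∧ head d

    -- The tail of `faceStep ρ d` is the head of `d`, so `faceStep ρ` carries live darts pointing
    -- into `A` injectively to live darts starting in `A`.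
    total : # (λ d → live d ∧ head d) ds ≤ # (λ d → live d ∧ tail d) ds
    total = injection⇒length≤ (faceStep ρ) (filterᵇ (λ d → live d ∧ head d) ds) (filterᵇ (λ d → live d ∧ tail d) ds) (Unique-filterᵇ _ (Unique-allPairs n))
      (λ {d} {e} d∈ e∈ → φ-injective d e (dart d∈) (dart e∈))
      (λ {d} d∈ → let (l , h) = ∧⁻ {live d} (proj₂ (∈-filterᵇ⁻ _ ds d∈)) ; (a , sd) = ∧⁻ {adjᵈ G d} l in
        ∈-filterᵇ⁺ (λ d → live d ∧ tail d) (∈-allPairs _ _) (∧⁺ (∧⁺ (φ-dart d a) (s-φ d a sd)) h))
      where
      dart : ∀ {d} → d ∈ filterᵇ (λ d → live d ∧ head d) ds → adjᵈ G d ≡ true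
      dart {d} d∈ = proj₁ (∧⁻ {adjᵈ G d} (proj₁ (∧⁻ {live d} (proj₂ (∈-filterᵇ⁻ _ ds d∈)))))

    both≡both' : # both ds ≡ # both' ds
    both≡both' = #-cong both both' ds λ {d} _ → swap (live d) (head d) (tail d)
      where
      swap : ∀ a b c → (a ∧ b) ∧ c ≡ (a ∧ c) ∧ b
      swap true true true = refl
      swap true true false = refl
      swap true false true = refl
      swap true false false = refl
      swap false _ _ = refl

    out≤in' : # inn ds ≤ # out ds
    out≤in' = ℕₚ.+-cancelˡ-≤ (# both ds) _ _ (begin
      # both ds + # inn ds             ≡⟨ #-split (λ d → live d ∧ head d) tail ds ⟨
      # (λ d → live d ∧ head d) ds     ≤⟨ total ⟩
      # (λ d → live d ∧ tail d) ds     ≡⟨ #-split (λ d → live d ∧ tail d) head ds ⟩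
      # both' ds + # out ds            ≡⟨ cong (_+ # out ds) both≡both' ⟨
      # both ds + # out ds             ∎)
      where open ℕₚ.≤-Reasoning

    -- Without the wanted dart, every live dart leaving `A` has a live flip, which enters `A`. The
    -- dart (x₀, y₀) enters too and is no such flip, its own flip being outside `s`.
    in-fewer : # out ds ℕ.< # inn ds
    in-fewer = subst (_≤ # inn ds) (cong suc (Listₚ.length-map flip (filterᵇ out ds)))
      (Unique-⊆⇒length≤ {xs = (x₀ , y₀) ∷ map flip (filterᵇ out ds)} uniq into)
      where
      out⁻ : ∀ {d} → d ∈ filterᵇ out ds → adjᵈ G d ≡ true × s d ≡ true × tail d ≡ true × head d ≢ true
      out⁻ {d} d∈ with ∧⁻ {live d ∧ tail d} (proj₂ (∈-filterᵇ⁻ out ds d∈))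
      ... | lt , nh with ∧⁻ {live d} lt
      ...   | l , t with ∧⁻ {adjᵈ G d} l
      ...     | a , sd = a , sd , t , not⁻ nh
      uniq : Unique ((x₀ , y₀) ∷ map flip (filterᵇ out ds))
      uniq = All.tabulate (λ z∈ e → let ((a , b) , d∈ , z≡) = ∈ₚ.∈-map⁻ flip z∈ ; (_ , sd , _) = out⁻ d∈ in
                 ¬s₀ (subst (λ w → s (flip w) ≡ true) (≡-sym (trans e z≡)) sd))
             ∷ Unique-map flip (filterᵇ out ds) (Unique-filterᵇ out (Unique-allPairs n)) (λ _ _ → cong flip)
      into : ∀ {z} → z ∈ (x₀ , y₀) ∷ map flip (filterᵇ out ds) → z ∈ filterᵇ inn ds
      into (here refl) = ∈-filterᵇ⁺ inn (∈-allPairs _ _) (∧⁺ (∧⁺ (∧⁺ dart₀ s₀) y₀∈) (not⁺ x₀∉))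
      into (there z∈) with ∈ₚ.∈-map⁻ flip z∈
      ... | (y , x) , d∈ , refl with out⁻ d∈
      ...   | a , sd , t , nh = ∈-filterᵇ⁺ inn (∈-allPairs _ _)
                (∧⁺ (∧⁺ (∧⁺ (trans (adjᵈ-flip G (y , x)) a) sxy) t) (not⁺ nh))
        where
        sxy : s (x , y) ≡ true
        sxy with ≡true? (s (x , y))
        ... | yes e = e
        ... | no ne = ⊥-elim (none (y , x , a , t , nh , sd , ne))

  open UnionFind (_≟D_ {n})
  private module P = UnionFind (_≟_ {n})

  -- Each listed dart is joined to its successor under `faceStep`; over all darts the classes become
  -- the faces.
  faceLabelFrom : List (Dart n) → Dart n → Dart n
  faceLabelFrom []       = id
  faceLabelFrom (d ∷ ds) = join (faceLabelFrom ds) d (faceStep ρ d)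

  faceLabel : Dart n → Dart n
  faceLabel = faceLabelFrom (darts G)

  -- The dual labelling merges the faces on the two sides of the listed edges,
  -- starting from the end of the list; the primal one merges endpoints from its start.
  dualLabel : List (Dart n) → Dart n → Dart n
  dualLabel []       = faceLabel
  dualLabel (e ∷ es) = join (dualLabel es) e (flip e)

  primalLabel : (Fin n → Fin n) → List (Dart n) → Fin n → Fin n
  primalLabel lab []             = lab
  primalLabel lab ((a , b) ∷ es) = primalLabel (P.join lab a b) es

  primalMerges : (Fin n → Fin n) → List (Dart n) → ℕ
  primalMerges lab []             = 0
  primalMerges lab ((a , b) ∷ es) = P.flag lab a b + primalMerges (P.join lab a b) es

  -- `later` holds the edges that the dual process, running from the end, has merged already.
  dualMerges : List (Dart n) → List (Dart n) → ℕ
  dualMerges []       later = 0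
  dualMerges (e ∷ es) later = flag (dualLabel (es ++ later)) e (flip e) + dualMerges es later

  faceLabelFrom-idem : ∀ ds → Idem (faceLabelFrom ds)
  faceLabelFrom-idem []       x = refl
  faceLabelFrom-idem (d ∷ ds) = join-idem (faceLabelFrom ds) d _ (faceLabelFrom-idem ds)

  faceLabelFrom-φ : ∀ ds {d} → d ∈ ds → faceLabelFrom ds d ≡ faceLabelFrom ds (faceStep ρ d)
  faceLabelFrom-φ (d ∷ ds) (here refl) = join-glues (faceLabelFrom ds) d _
  faceLabelFrom-φ (d ∷ ds) (there d∈)  = join-preserves (faceLabelFrom ds) d _ (faceLabelFrom-φ ds d∈)

  faceLabelFrom-dart : ∀ ds → (∀ {d} → d ∈ ds → adjᵈ G d ≡ true) → ∀ d → adjᵈ G d ≡ true → adjᵈ G (faceLabelFrom ds d) ≡ true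
  faceLabelFrom-dart []       h d a = a
  faceLabelFrom-dart (e ∷ ds) h d a = join-closed (faceLabelFrom ds) e (faceStep ρ e) {λ d → adjᵈ G d ≡ true}
    (faceLabelFrom-dart ds (h ∘ there) e (h (here refl))) d (faceLabelFrom-dart ds (h ∘ there) d a)

  ∈-darts⁺ : ∀ {d} → adjᵈ G d ≡ true → d ∈ darts G
  ∈-darts⁺ {d} a = ∈-filterᵇ⁺ _ (∈-allPairs _ _) a

  ∈-darts⁻ : ∀ {d} → d ∈ darts G → adjᵈ G d ≡ true
  ∈-darts⁻ {d} d∈ = proj₂ (∈-filterᵇ⁻ _ (allPairs n) d∈)

  dualLabel-idem : ∀ es → Idem (dualLabel es)
  dualLabel-idem []       = faceLabelFrom-idem (darts G)
  dualLabel-idem (e ∷ es) = join-idem (dualLabel es) e (flip e) (dualLabel-idem es)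

  dualLabel-φ : ∀ es d → adjᵈ G d ≡ true → dualLabel es d ≡ dualLabel es (faceStep ρ d)
  dualLabel-φ []       d a = faceLabelFrom-φ (darts G) (∈-darts⁺ a)
  dualLabel-φ (e ∷ es) d a = join-preserves (dualLabel es) e (flip e) (dualLabel-φ es d a)

  dualLabel-flip : ∀ es {e} → e ∈ es → dualLabel es e ≡ dualLabel es (flip e)
  dualLabel-flip (e ∷ es) (here refl) = join-glues (dualLabel es) e (flip e)
  dualLabel-flip (e ∷ es) (there e∈)  = join-preserves (dualLabel es) e (flip e) (dualLabel-flip es e∈)

  dualLabel-dart : ∀ es → (∀ {d} → d ∈ es → adjᵈ G d ≡ true) → ∀ d → adjᵈ G d ≡ true → adjᵈ G (dualLabel es d) ≡ true
  dualLabel-dart []       h d a = faceLabelFrom-dart (darts G) ∈-darts⁻ d a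
  dualLabel-dart (e ∷ es) h d a = join-closed (dualLabel es) e (flip e) {λ d → adjᵈ G d ≡ true}
    (dualLabel-dart es (h ∘ there) e (h (here refl))) d (dualLabel-dart es (h ∘ there) d a)

  primalLabel-preserves : ∀ {lab} es {x y} → lab x ≡ lab y → primalLabel lab es x ≡ primalLabel lab es y
  primalLabel-preserves []             e = e
  primalLabel-preserves {lab} ((a , b) ∷ es) e = primalLabel-preserves es (P.join-preserves lab a b e)

  primalLabel-edge : ∀ {lab} es {x y} → (x , y) ∈ es → primalLabel lab es x ≡ primalLabel lab es y
  primalLabel-edge {lab} ((a , b) ∷ es) (here refl) = primalLabel-preserves es (P.join-glues lab a b)
  primalLabel-edge ((a , b) ∷ es) (there e∈)  = primalLabel-edge es e∈

  primalLabel-idem : ∀ {lab} es → P.Idem lab → P.Idem (primalLabel lab es)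
  primalLabel-idem []             h = h
  primalLabel-idem {lab} ((a , b) ∷ es) h = primalLabel-idem es (P.join-idem lab a b h)

  primalLabel-sound : ∀ {R : Fin n → Fin n → Set} {lab} es → IsEquivalence R → (∀ {x y} → lab x ≡ lab y → R x y) →
    (∀ {x y} → (x , y) ∈ es → R x y) → ∀ {x y} → primalLabel lab es x ≡ primalLabel lab es y → R x y
  primalLabel-sound []             eq h he e = h e
  primalLabel-sound {lab = lab} ((a , b) ∷ es) eq h he e =
    primalLabel-sound es eq (P.join-sound lab a b eq h (he (here refl))) (he ∘ there) e

  primalLabel-++ : ∀ {lab} es fs → primalLabel lab (es ++ fs) ≡ primalLabel (primalLabel lab es) fs
  primalLabel-++ []             fs = refl
  primalLabel-++ ((a , b) ∷ es) fs = primalLabel-++ es fs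

  primalMerges-++ : ∀ {lab} es fs → primalMerges lab (es ++ fs) ≡ primalMerges lab es + primalMerges (primalLabel lab es) fs
  primalMerges-++ [] fs = refl
  primalMerges-++ {lab} ((a , b) ∷ es) fs =
    trans (cong (P.flag lab a b +_) (primalMerges-++ es fs)) (≡-sym (ℕₚ.+-assoc (P.flag lab a b) _ _))

  dualMerges-++ : ∀ es fs later → dualMerges (es ++ fs) later ≡ dualMerges es (fs ++ later) + dualMerges fs later
  dualMerges-++ [] fs later = refl
  dualMerges-++ (e ∷ es) fs later rewrite Listₚ.++-assoc es fs later | dualMerges-++ es fs later =
    ≡-sym (ℕₚ.+-assoc (flag (dualLabel (es ++ fs ++ later)) e (flip e)) _ _)

  Covers : List (Dart n) → Set
  Covers es = ∀ {x y} → adj G x y ≡ true → (x , y) ∈ es ⊎ (y , x) ∈ es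

  AllDarts : List (Dart n) → Set
  AllDarts es = ∀ {d} → d ∈ es → adjᵈ G d ≡ true

  -- Let `A` be the primal class of `b` and `s` the dual class of (a, b). This dart enters `A` and
  -- its flip is outside `s`, so `cut-balance` yields a dart of `s` leaving `A` whose flip is
  -- outside `s`. Its edge is in the list, but one from `before` lies within a primal class, one
  -- from `after` has both sides in one dual class, and (a, b) itself fits in neither orientation.
  not-both-merge : ∀ before a b after → Covers (before ++ (a , b) ∷ after) → adj G a b ≡ true →
    primalLabel id before a ≢ primalLabel id before b → dualLabel after (a , b) ≢ dualLabel after (b , a) → ⊥
  not-both-merge before a b after cov ab pa≢pb da≢db
    with cut-balance s s-φ A a b ab (pa≢pb ∘ ⌊⌋⁻ (lab a ≟ lab b)) (⌊⌋⁺ (lab b ≟ lab b) refl)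
           (⌊⌋⁺ (dl (a , b) ≟D dl (a , b)) refl) (da≢db ∘ ≡-sym ∘ ⌊⌋⁻ (dl (b , a) ≟D dl (a , b)))
    where
    lab = primalLabel id before
    dl = dualLabel after
    A : Fin n → Bool
    A y = ⌊ lab y ≟ lab b ⌋
    s : Dart n → Bool
    s d = ⌊ dl d ≟D dl (a , b) ⌋
    s-φ : ∀ d → adjᵈ G d ≡ true → s d ≡ true → s (faceStep ρ d) ≡ true
    s-φ d dd sd = ⌊⌋⁺ (dl (faceStep ρ d) ≟D dl (a , b)) (trans (≡-sym (dualLabel-φ after d dd)) (⌊⌋⁻ (dl d ≟D dl (a , b)) sd))
  ... | y , x , yx , y∈ , x∉ , s₁ , ¬s₂ = locate (cov yx)
    where
    lab = primalLabel id before
    dl = dualLabel after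
    same-lab : lab y ≡ lab x → ⊥
    same-lab e = x∉ (⌊⌋⁺ (lab x ≟ lab b) (trans (≡-sym e) (⌊⌋⁻ (lab y ≟ lab b) y∈)))
    same-dl : dl (y , x) ≡ dl (x , y) → ⊥
    same-dl e = ¬s₂ (⌊⌋⁺ (dl (x , y) ≟D dl (a , b)) (trans (≡-sym e) (⌊⌋⁻ (dl (y , x) ≟D dl (a , b)) s₁)))
    locate : (y , x) ∈ before ++ (a , b) ∷ after ⊎ (x , y) ∈ before ++ (a , b) ∷ after → ⊥
    locate (inj₁ i) with ∈ₚ.∈-++⁻ before i
    ... | inj₁ j = same-lab (primalLabel-edge before j)
    ... | inj₂ (here refl) = pa≢pb (⌊⌋⁻ (lab a ≟ lab b) y∈)
    ... | inj₂ (there j) = same-dl (dualLabel-flip after j)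
    locate (inj₂ i) with ∈ₚ.∈-++⁻ before i
    ... | inj₁ j = same-lab (≡-sym (primalLabel-edge before j))
    ... | inj₂ (here refl) = da≢db (≡-sym (⌊⌋⁻ (dl (b , a) ≟D dl (a , b)) s₁))
    ... | inj₂ (there j) = same-dl (≡-sym (dualLabel-flip after j))

  -- Every edge merges on at most one side. The surrounding lists fix the state of both processes,
  -- so that a middle segment can be counted by itself.
  merges≤length : ∀ before es after → Covers (before ++ es ++ after) → AllDarts es →
    primalMerges (primalLabel id before) es + dualMerges es after ≤ length es
  merges≤length before [] after cov h = z≤n
  merges≤length before ((a , b) ∷ es) after cov h = begin
    (pf + pms) + (df + dms)  ≡⟨ interchange pf pms df dms ⟩
    (pf + df) + (pms + dms)  ≤⟨ ℕₚ.+-mono-≤ one rest ⟩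
    suc (length es)          ∎
    where
    open ℕₚ.≤-Reasoning
    lab = primalLabel id before
    pf = P.flag lab a b
    pms = primalMerges (P.join lab a b) es
    df = flag (dualLabel (es ++ after)) (a , b) (b , a)
    dms = dualMerges es after
    interchange : ∀ a b c d → (a + b) + (c + d) ≡ (a + c) + (b + d)
    interchange = solve-∀
    one : pf + df ≤ 1
    one with lab a ≟ lab b | dualLabel (es ++ after) (a , b) ≟D dualLabel (es ++ after) (b , a)
    ... | yes _ | yes _ = z≤n
    ... | yes _ | no _  = s≤s z≤n
    ... | no _  | yes _ = s≤s z≤n
    ... | no p  | no q  = ⊥-elim (not-both-merge before a b (es ++ after) cov (h (here refl)) p q)
    shift : ∀ (xs : List (Dart n)) {y ys} → xs ++ y ∷ ys ≡ (xs ++ y ∷ []) ++ ys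
    shift xs {y} {ys} = ≡-sym (Listₚ.++-assoc xs (y ∷ []) ys)
    rest : pms + dms ≤ length es
    rest = subst (λ l → primalMerges l es + dms ≤ length es) (primalLabel-++ before ((a , b) ∷ []))
      (merges≤length (before ++ (a , b) ∷ []) es after
        (subst Covers (shift before) cov) (h ∘ there))

-- Euler's formula as a count of merges

module _ {A : Set} (_≟A_ : DecidableEquality A) where
  open UnionFind _≟A_

  -- Joining `a` and `b` either changes nothing or costs a root that lies in `xs`.
  Tracked : (A → A) → List A → A → A → Set
  Tracked lab xs a b = lab a ≡ lab b ⊎ (lab a ∈ xs × lab b ∈ xs)

  join-∈ : ∀ lab xs a b x → Tracked lab xs a b → lab x ∈ xs → join lab a b x ∈ xs
  join-∈ lab xs a b x tr x∈ with join-cases lab a b x | tr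
  ... | inj₂ (_ , e)  | _             = subst (_∈ xs) (≡-sym e) x∈
  ... | inj₁ (e , e') | inj₁ ab       = subst (_∈ xs) (≡-sym (trans e' (trans ab (≡-sym e)))) x∈
  ... | inj₁ (_ , e') | inj₂ (a∈ , _) = subst (_∈ xs) (≡-sym e') a∈

  join-tracked : ∀ lab xs a b c d → Tracked lab xs a b → Tracked lab xs c d → Tracked (join lab a b) xs c d
  join-tracked lab xs a b c d tr (inj₁ e) = inj₁ (join-preserves lab a b e)
  join-tracked lab xs a b c d tr (inj₂ (c∈ , d∈)) = inj₂ (join-∈ lab xs a b c tr c∈ , join-∈ lab xs a b d tr d∈)

  roots-step : ∀ lab a b {xs} → Idem lab → Unique xs → Tracked lab xs a b →
    roots lab xs ≡ roots (join lab a b) xs + flag lab a b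
  roots-step lab a b idem u (inj₁ e)        = roots-join lab a b idem u (inj₁ e)
  roots-step lab a b idem u (inj₂ (_ , b∈)) = roots-join lab a b idem u (inj₂ b∈)

iter-+ : ∀ {A : Set} (f : A → A) s t x → iter f (s + t) x ≡ iter f s (iter f t x)
iter-+ f zero    t x = refl
iter-+ f (suc s) t x = cong f (iter-+ f s t x)

iter-* : ∀ {A : Set} (f : A → A) p x → iter f p x ≡ x → ∀ q → iter f (q * p) x ≡ x
iter-* f p x e zero    = refl
iter-* f p x e (suc q) = trans (iter-+ f p (q * p) x) (trans (cong (iter f p) (iter-* f p x e q)) e)

module _ {n} (G : Graph n) (ρ : Rotation G) where
  open UnionFind (_≟D_ {n})
  private module P = UnionFind (_≟_ {n})
  private φ = faceStep ρ

  -- Telescoping: each effective merge destroys one root. Since `xs` only has to contain the labels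
  -- of the endpoints, merges can be bounded by the size of a small vertex set.
  roots-primal : ∀ {lab} es {xs} → P.Idem lab → Unique xs → (∀ {a b} → (a , b) ∈ es → Tracked _≟_ lab xs a b) →
    P.roots lab xs ≡ P.roots (primalLabel G ρ lab es) xs + primalMerges G ρ lab es
  roots-primal [] idem u tr = ≡-sym (ℕₚ.+-identityʳ _)
  roots-primal {lab} ((a , b) ∷ es) {xs} idem u tr = begin
    P.roots lab xs
      ≡⟨ roots-step _≟_ lab a b idem u (tr (here refl)) ⟩
    P.roots (P.join lab a b) xs + P.flag lab a b
      ≡⟨ cong (_+ P.flag lab a b) (roots-primal es (P.join-idem lab a b idem) u
           (λ {c} {d} e∈ → join-tracked _≟_ lab xs a b c d (tr (here refl)) (tr (there e∈)))) ⟩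
    (r + m) + P.flag lab a b
      ≡⟨ trans (ℕₚ.+-assoc r m _) (cong (λ k → r + k) (ℕₚ.+-comm m _)) ⟩
    r + (P.flag lab a b + m) ∎
    where
    open ≡-Reasoning
    r = P.roots (primalLabel G ρ (P.join lab a b) es) xs
    m = primalMerges G ρ (P.join lab a b) es

  dual-tracked : ∀ es later xs → (∀ {e} → e ∈ es → Tracked _≟D_ (dualLabel G ρ later) xs e (flip e)) →
    (∀ x → dualLabel G ρ later x ∈ xs → dualLabel G ρ (es ++ later) x ∈ xs) ×
    (∀ x y → Tracked _≟D_ (dualLabel G ρ later) xs x y → Tracked _≟D_ (dualLabel G ρ (es ++ later)) xs x y)
  dual-tracked [] later xs tr = (λ _ → id) , (λ _ _ → id)
  dual-tracked (e ∷ es) later xs tr with dual-tracked es later xs (tr ∘ there)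
  ... | stay , keep =
    (λ x x∈ → join-∈ _≟D_ _ xs e (flip e) x te (stay x x∈)) ,
    (λ x y t → join-tracked _≟D_ _ xs e (flip e) x y te (keep x y t))
    where te = keep e (flip e) (tr (here refl))

  roots-dual : ∀ es later {xs} → Unique xs → (∀ {e} → e ∈ es → Tracked _≟D_ (dualLabel G ρ later) xs e (flip e)) →
    roots (dualLabel G ρ later) xs ≡ roots (dualLabel G ρ (es ++ later)) xs + dualMerges G ρ es later
  roots-dual [] later u tr = ≡-sym (ℕₚ.+-identityʳ _)
  roots-dual (e ∷ es) later {xs} u tr = begin
    roots (dualLabel G ρ later) xs  ≡⟨ roots-dual es later u (tr ∘ there) ⟩
    roots lab xs + m                ≡⟨ cong (_+ m) (roots-step _≟D_ lab e (flip e) (dualLabel-idem G ρ (es ++ later)) u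
                                         (proj₂ (dual-tracked es later xs (tr ∘ there)) e (flip e) (tr (here refl)))) ⟩
    (r + f) + m                     ≡⟨ ℕₚ.+-assoc r f m ⟩
    r + (f + m)                     ∎
    where
    open ≡-Reasoning
    lab = dualLabel G ρ (es ++ later)
    m = dualMerges G ρ es later
    f = flag lab e (flip e)
    r = roots (join lab e (flip e)) xs

  iter-dart : ∀ t d → adjᵈ G d ≡ true → adjᵈ G (iter φ t d) ≡ true
  iter-dart zero    d a = a
  iter-dart (suc t) d a = φ-dart G ρ (iter φ t d) (iter-dart t d a)

  iter-cancel : ∀ t d e → adjᵈ G d ≡ true → adjᵈ G e ≡ true → iter φ t d ≡ iter φ t e → d ≡ e
  iter-cancel zero    d e a b eq = eq
  iter-cancel (suc t) d e a b eq =
    iter-cancel t d e a b (φ-injective G ρ (iter φ t d) (iter φ t e) (iter-dart t d a) (iter-dart t e b) eq)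

  -- Two of the first n * n + 1 iterates coincide, and injectivity of `faceStep` on darts cancels
  -- their common prefix. The bound matches the search range of `inOrbit`.
  face-period : ∀ d → adjᵈ G d ≡ true → ∃ λ p → suc p ≤ n * n × iter φ (suc p) d ≡ d
  face-period d a with Finₚ.pigeonhole (ℕₚ.n<1+n (n * n)) (λ i → Fin.combine (proj₁ (iter φ (toℕ i) d)) (proj₂ (iter φ (toℕ i) d)))
  ... | i , j , i<j , e with ℕₚ.m≤n⇒∃[o]m+o≡n i<j
  ...   | p , i+p≡j = p , p<nn , iter-cancel (toℕ i) _ _ (iter-dart (suc p) d a) a
            (trans (≡-sym (iter-+ φ (toℕ i) (suc p) d)) (trans (cong (λ k → iter φ k d) (trans (ℕₚ.+-suc (toℕ i) p) i+p≡j)) (≡-sym same)))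
    where
    same : iter φ (toℕ i) d ≡ iter φ (toℕ j) d
    same = let (e₁ , e₂) = Finₚ.combine-injective _ _ _ _ e in cong₂ _,_ e₁ e₂
    p<nn : suc p ≤ n * n
    p<nn = ℕₚ.≤-trans (s≤s (ℕₚ.m≤n+m p (toℕ i))) (ℕₚ.≤-trans (ℕₚ.≤-reflexive i+p≡j) (ℕₚ.≤-pred (Finₚ.toℕ<n j)))

  -- The equality case takes care of pairs that are not darts, on which the labelling is defined as
  -- well.
  FaceRel : Dart n → Dart n → Set
  FaceRel d e = d ≡ e ⊎ (adjᵈ G d ≡ true × adjᵈ G e ≡ true × ∃ λ t → iter φ t d ≡ e)

  faceRel-equiv : IsEquivalence FaceRel
  faceRel-equiv = record { refl = inj₁ refl ; sym = sy ; trans = tr }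
    where
    sy : ∀ {x y} → FaceRel x y → FaceRel y x
    sy (inj₁ e) = inj₁ (≡-sym e)
    sy {x} {y} (inj₂ (dx , dy , t , e)) with face-period x dx
    -- After the `t` steps from `x` to `y`, another `t * p` steps complete `t` full periods of `x`.
    ... | p , _ , per = inj₂ (dy , dx , t * p , (begin
      iter φ (t * p) y              ≡⟨ cong (iter φ (t * p)) e ⟨
      iter φ (t * p) (iter φ t x)   ≡⟨ iter-+ φ (t * p) t x ⟨
      iter φ (t * p + t) x          ≡⟨ cong (λ k → iter φ k x) (trans (ℕₚ.+-comm (t * p) t) (≡-sym (ℕₚ.*-suc t p))) ⟩
      iter φ (t * suc p) x          ≡⟨ iter-* φ (suc p) x per t ⟩
      x                             ∎))
      where open ≡-Reasoning
    tr : ∀ {x y z} → FaceRel x y → FaceRel y z → FaceRel x z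
    tr (inj₁ refl) h = h
    tr h (inj₁ refl) = h
    tr {x} (inj₂ (dx , _ , t , e)) (inj₂ (_ , dz , t' , e')) =
      inj₂ (dx , dz , t' + t , trans (iter-+ φ t' t x) (trans (cong (iter φ t') e) e'))

  faceLabelFrom-sound : ∀ ds → (∀ {d} → d ∈ ds → adjᵈ G d ≡ true) → ∀ {x y} →
    faceLabelFrom G ρ ds x ≡ faceLabelFrom G ρ ds y → FaceRel x y
  faceLabelFrom-sound [] h e = inj₁ e
  faceLabelFrom-sound (d ∷ ds) h e = join-sound (faceLabelFrom G ρ ds) d (φ d) faceRel-equiv
    (faceLabelFrom-sound ds (h ∘ there))
    (inj₂ (h (here refl) , φ-dart G ρ d (h (here refl)) , 1 , refl)) e

  dartEq-refl : ∀ (d : Dart n) → dartEq d d ≡ true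
  dartEq-refl (a , b) = ∧⁺ (⌊⌋⁺ (a ≟ a) refl) (⌊⌋⁺ (b ≟ b) refl)

  -- Reducing the number of steps modulo the period brings it into the range searched by `inOrbit`.
  faceRel⇒inOrbit : ∀ {x y} → adjᵈ G x ≡ true → FaceRel x y → inOrbit ρ x y ≡ true
  faceRel⇒inOrbit {x} {y} dx rel with face-period x dx
  ... | p , p<nn , per = any⁺ (λ t → dartEq (iter φ t x) y) (∈ₚ.∈-upTo⁺ r<nn) hit
    where
    open import Data.Nat.DivMod using (_%_; _/_; m≡m%n+[m/n]*n; m%n<n)
    reached : FaceRel x y → ∃ λ t → iter φ t x ≡ y
    reached (inj₁ e) = 0 , e
    reached (inj₂ (_ , _ , t , e)) = t , e
    t = proj₁ (reached rel)
    r = t % suc p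
    r<nn : r ℕ.< n * n
    r<nn = ℕₚ.<-≤-trans (m%n<n t (suc p)) p<nn
    back : iter φ r x ≡ iter φ t x
    back = ≡-sym (trans (cong (λ k → iter φ k x) (m≡m%n+[m/n]*n t (suc p)))
      (trans (iter-+ φ r _ x) (cong (iter φ r) (iter-* φ (suc p) x per (t / suc p)))))
    hit : dartEq (iter φ r x) y ≡ true
    hit = subst (λ z → dartEq (iter φ r x) z ≡ true) (trans back (proj₂ (reached rel))) (dartEq-refl (iter φ r x))

  dartKey-injective : ∀ (d e : Dart n) → dartKey d ≡ dartKey e → d ≡ e
  dartKey-injective (a , b) (c , d) e = cong₂ _,_ (proj₁ same) (proj₂ same)
    where
    key : ∀ (a b : Fin n) → toℕ (Fin.combine a b) ≡ toℕ a * n + toℕ b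
    key a b = trans (Finₚ.toℕ-combine a b) (cong (_+ toℕ b) (ℕₚ.*-comm n (toℕ a)))
    same : a ≡ c × b ≡ d
    same = Finₚ.combine-injective a b c d (Finₚ.toℕ-injective (trans (key a b) (trans e (≡-sym (key c d)))))

  Unique-darts : Unique (darts G)
  Unique-darts = Unique-filterᵇ _ (Unique-allPairs n)

  -- Representatives with equal labels share an orbit, where each has the least key, so labels
  -- separate them.
  faceCount≤roots : faceCount ρ ≤ roots (faceLabel G ρ) (darts G)
  faceCount≤roots = injection⇒length≤ lab (filterᵇ rep (darts G)) (filterᵇ isRoot (darts G))
    (Unique-filterᵇ rep Unique-darts) injective into
    where
    lab = faceLabel G ρ
    rep isRoot : Dart n → Bool
    rep x = all (λ y → not (inOrbit ρ x y) ∨ ⌊ dartKey x ℕ.≤? dartKey y ⌋) (darts G)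
    isRoot x = ⌊ lab x ≟D x ⌋
    key≤ : ∀ {x y} → x ∈ filterᵇ rep (darts G) → y ∈ darts G → lab x ≡ lab y → dartKey x ≤ dartKey y
    key≤ {x} {y} x∈ y∈ e with ∈-filterᵇ⁻ rep (darts G) x∈
    ... | x∈ds , rx with ∨⁻ {not (inOrbit ρ x y)} (all⁻ _ (darts G) rx y∈)
    ...   | inj₁ no-orb = ⊥-elim (not⁻ no-orb (faceRel⇒inOrbit (∈-darts⁻ G ρ x∈ds) (faceLabelFrom-sound (darts G) (∈-darts⁻ G ρ) e)))
    ...   | inj₂ k = ⌊⌋⁻ (dartKey x ℕ.≤? dartKey y) k
    injective : ∀ {x y} → x ∈ filterᵇ rep (darts G) → y ∈ filterᵇ rep (darts G) → lab x ≡ lab y → x ≡ y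
    injective x∈ y∈ e = dartKey-injective _ _ (ℕₚ.≤-antisym
      (key≤ x∈ (proj₁ (∈-filterᵇ⁻ rep (darts G) y∈)) e) (key≤ y∈ (proj₁ (∈-filterᵇ⁻ rep (darts G) x∈)) (≡-sym e)))
    into : ∀ {x} → x ∈ filterᵇ rep (darts G) → lab x ∈ filterᵇ isRoot (darts G)
    into {x} x∈ = ∈-filterᵇ⁺ isRoot
      (∈-darts⁺ G ρ (faceLabelFrom-dart G ρ (darts G) (∈-darts⁻ G ρ) x (∈-darts⁻ G ρ (proj₁ (∈-filterᵇ⁻ rep (darts G) x∈)))))
      (⌊⌋⁺ (lab (lab x) ≟D lab x) (faceLabelFrom-idem G ρ (darts G) x))

  module _ (es : List (Dart n)) (cov : Covers G ρ es) (allD : AllDarts G ρ es) where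
    private
      lab = primalLabel G ρ id es
      dl  = dualLabel G ρ es

    lab-adj : ∀ {x y} → adj G x y ≡ true → lab x ≡ lab y
    lab-adj a with cov a
    ... | inj₁ i = primalLabel-edge G ρ es i
    ... | inj₂ i = ≡-sym (primalLabel-edge G ρ es i)

    dl-flip : ∀ {x y} → adj G x y ≡ true → dl (x , y) ≡ dl (y , x)
    dl-flip a with cov a
    ... | inj₁ i = dualLabel-flip G ρ es i
    ... | inj₂ i = ≡-sym (dualLabel-flip G ρ es i)

    -- `faceStep ρ` sends (u, v) to (v, rot ρ v u), so a flip and a face step turn a dart at `v`
    -- into the next one around `v`. Once all edges are merged, both moves preserve the label.
    dl-star : ∀ {v u w} → adj G v u ≡ true → adj G v w ≡ true → dl (v , u) ≡ dl (v , w)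
    dl-star {v} {u} {w} vu vw with cyclic ρ v u w vu vw
    ... | t , refl = proj₂ (go t)
      where
      go : ∀ t → adj G v (iter (rot ρ v) t u) ≡ true × dl (v , u) ≡ dl (v , iter (rot ρ v) t u)
      go zero = vu , refl
      go (suc t) with go t
      ... | a , e = closed ρ v _ a , trans e (trans (dl-flip a) (dualLabel-φ G ρ es _ (trans (adjᵈ-flip G (v , _)) a)))

    reach-lab : ∀ t u v → reachWithin G t u v ≡ true → lab u ≡ lab v
    reach-lab zero u v h = cong lab (⌊⌋⁻ (u ≟ v) h)
    reach-lab (suc t) u v h with ∨⁻ {u == v} h
    ... | inj₁ e = cong lab (⌊⌋⁻ (u ≟ v) e)
    ... | inj₂ h' with any⁻ _ (allFin n) h'
    ...   | w , _ , h'' with ∧⁻ {adj G u w} h''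
    ...     | a , r = trans (lab-adj a) (reach-lab t w v r)

    isRep : Fin n → Bool
    isRep u = all (λ v → not (reachWithin G n u v) ∨ ⌊ toℕ u ℕ.≤? toℕ v ⌋) (allFin n)

    -- The least vertex of a primal class is least among the vertices it reaches, since these have
    -- its label.
    rep-of : ∀ x → ∃ λ y → lab y ≡ lab x × isRep y ≡ true
    rep-of x with least (λ y → ⌊ lab y ≟ lab x ⌋) (⌊⌋⁺ (lab x ≟ lab x) refl)
    ... | y , ly , min = y , e , all⁺ _ (allFin n) (λ {v} _ → bound v)
      where
      e = ⌊⌋⁻ (lab y ≟ lab x) ly
      bound : ∀ v → not (reachWithin G n y v) ∨ ⌊ toℕ y ℕ.≤? toℕ v ⌋ ≡ true
      bound v with ≡true? (reachWithin G n y v)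
      ... | no nr = ∨⁺ˡ (not⁺ nr)
      ... | yes r = ∨⁺ʳ {not (reachWithin G n y v)} (⌊⌋⁺ (toℕ y ℕ.≤? toℕ v) (min v (⌊⌋⁺ (lab v ≟ lab x) (trans (≡-sym (reach-lab n y v r)) e))))

    roots≤components : P.roots lab (allFin n) ≤ componentCount G
    roots≤components = injection⇒length≤ (proj₁ ∘ rep-of) (filterᵇ isRoot (allFin n)) (filterᵇ isRep (allFin n))
      (Unique-filterᵇ isRoot (Uniqueₚ.allFin⁺ n)) injective
      (λ {x} _ → ∈-filterᵇ⁺ isRep (∈ₚ.∈-allFin _) (proj₂ (proj₂ (rep-of x))))
      where
      isRoot : Fin n → Bool
      isRoot x = ⌊ lab x ≟ x ⌋
      root : ∀ {x} → x ∈ filterᵇ isRoot (allFin n) → lab x ≡ x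
      root {x} x∈ = ⌊⌋⁻ (lab x ≟ x) (proj₂ (∈-filterᵇ⁻ isRoot (allFin n) x∈))
      injective : ∀ {x y} → x ∈ filterᵇ isRoot (allFin n) → y ∈ filterᵇ isRoot (allFin n) →
        proj₁ (rep-of x) ≡ proj₁ (rep-of y) → x ≡ y
      injective {x} {y} x∈ y∈ e = trans (≡-sym (root x∈)) (trans (≡-sym (proj₁ (proj₂ (rep-of x))))
        (trans (cong lab e) (trans (proj₁ (proj₂ (rep-of y))) (root y∈))))

    -- Two non-isolated vertices are related when all darts leaving them lie in one dual class; the
    -- equality case makes the relation reflexive at isolated vertices.
    HubRel : Fin n → Fin n → Set
    HubRel x y = x ≡ y ⊎ ((∃ λ u → adj G x u ≡ true) × (∃ λ v → adj G y v ≡ true) ×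
                          (∀ {u v} → adj G x u ≡ true → adj G y v ≡ true → dl (x , u) ≡ dl (y , v)))

    hubRel-equiv : IsEquivalence HubRel
    hubRel-equiv = record { refl = inj₁ refl ; sym = sy ; trans = tr }
      where
      sy : ∀ {x y} → HubRel x y → HubRel y x
      sy (inj₁ e) = inj₁ (≡-sym e)
      sy (inj₂ (hx , hy , h)) = inj₂ (hy , hx , λ a b → ≡-sym (h b a))
      tr : ∀ {x y z} → HubRel x y → HubRel y z → HubRel x z
      tr (inj₁ refl) h = h
      tr h (inj₁ refl) = h
      tr (inj₂ (hx , (_ , a) , h)) (inj₂ (_ , hz , h')) = inj₂ (hx , hz , λ ax az → trans (h ax a) (h' a az))

    lab⇒hubRel : ∀ {x y} → lab x ≡ lab y → HubRel x y
    lab⇒hubRel = primalLabel-sound G ρ es hubRel-equiv inj₁ (λ {x} {y} e∈ → let a = allD e∈ ; a' = trans (sym G y x) a in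
      inj₂ ((y , a) , (x , a') , λ xu yv → trans (dl-star xu a) (trans (dl-flip a) (dl-star a' yv))))

    -- All darts of a component carry the same dual label, so each dual root takes up a component
    -- with an edge, and each isolated vertex is a component of its own.
    dualRoots+isolated≤components : roots dl (darts G) + isolatedCount G ≤ componentCount G
    dualRoots+isolated≤components = subst (_≤ componentCount G) len (Unique-⊆⇒length≤ uniq into)
      where
      isRoot : Dart n → Bool
      isRoot d = ⌊ dl d ≟D d ⌋
      iso : Fin n → Bool
      iso u = not (any (adj G u) (allFin n))
      rs = filterᵇ isRoot (darts G)
      is = filterᵇ iso (allFin n)
      f : Dart n → Fin n
      f = proj₁ ∘ rep-of ∘ proj₁
      len : length (map f rs ++ is) ≡ length rs + length is
      len = trans (Listₚ.length-++ (map f rs)) (cong (_+ length is) (Listₚ.length-map f rs))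
      root : ∀ {d} → d ∈ rs → dl d ≡ d × adjᵈ G d ≡ true
      root {d} d∈ = let (d∈ds , r) = ∈-filterᵇ⁻ isRoot (darts G) d∈ in ⌊⌋⁻ (dl d ≟D d) r , ∈-darts⁻ G ρ d∈ds
      injective : ∀ {d e} → d ∈ rs → e ∈ rs → f d ≡ f e → d ≡ e
      injective {a , b} {c , d} d∈ e∈ fe = trans (≡-sym (proj₁ (root d∈))) (trans same (proj₁ (root e∈)))
        where
        lab-eq : lab a ≡ lab c
        lab-eq = trans (≡-sym (proj₁ (proj₂ (rep-of a)))) (trans (cong lab fe) (proj₁ (proj₂ (rep-of c))))
        same : dl (a , b) ≡ dl (c , d)
        same with lab⇒hubRel lab-eq
        ... | inj₁ refl = dl-star (proj₂ (root d∈)) (proj₂ (root e∈))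
        ... | inj₂ (_ , _ , h) = h (proj₂ (root d∈)) (proj₂ (root e∈))
      not-iso : ∀ {d} → d ∈ rs → iso (f d) ≢ true
      not-iso {a , b} d∈ i with lab⇒hubRel (proj₁ (proj₂ (rep-of a)))
      ... | inj₁ e = not⁻ i (any⁺ (adj G (f (a , b))) (∈ₚ.∈-allFin b) (subst (λ z → adj G z b ≡ true) (≡-sym e) (proj₂ (root d∈))))
      ... | inj₂ ((u , h) , _) = not⁻ i (any⁺ (adj G (f (a , b))) (∈ₚ.∈-allFin u) h)
      uniq : Unique (map f rs ++ is)
      uniq = Uniqueₚ.++⁺ (Unique-map f rs (Unique-filterᵇ isRoot Unique-darts) injective)
        (Unique-filterᵇ iso (Uniqueₚ.allFin⁺ n))
        λ { (z∈ , z∈is) → let (d , d∈ , z≡) = ∈ₚ.∈-map⁻ f z∈ in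
            not-iso d∈ (subst (λ z → iso z ≡ true) z≡ (proj₂ (∈-filterᵇ⁻ iso (allFin n) z∈is))) }
      iso-reach : ∀ t u v → iso u ≡ true → reachWithin G t u v ≡ true → u ≡ v
      iso-reach zero u v i h = ⌊⌋⁻ (u ≟ v) h
      iso-reach (suc t) u v i h with ∨⁻ {u == v} h
      ... | inj₁ e = ⌊⌋⁻ (u ≟ v) e
      ... | inj₂ h' with any⁻ _ (allFin n) h'
      ...   | w , _ , h'' = ⊥-elim (not⁻ i (any⁺ (adj G u) (∈ₚ.∈-allFin w) (proj₁ (∧⁻ {adj G u w} h''))))
      iso-rep : ∀ u → iso u ≡ true → isRep u ≡ true
      iso-rep u i = all⁺ _ (allFin n) λ {v} _ → bound v
        where
        bound : ∀ v → not (reachWithin G n u v) ∨ ⌊ toℕ u ℕ.≤? toℕ v ⌋ ≡ true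
        bound v with ≡true? (reachWithin G n u v)
        ... | no nr = ∨⁺ˡ (not⁺ nr)
        ... | yes r = ∨⁺ʳ {not (reachWithin G n u v)} (⌊⌋⁺ (toℕ u ℕ.≤? toℕ v) (ℕₚ.≤-reflexive (cong toℕ (iso-reach n u v i r))))
      into : ∀ {z} → z ∈ map f rs ++ is → z ∈ filterᵇ isRep (allFin n)
      into {z} z∈ with ∈ₚ.∈-++⁻ (map f rs) z∈
      ... | inj₁ z∈m = let (d , _ , z≡) = ∈ₚ.∈-map⁻ f z∈m in
            ∈-filterᵇ⁺ isRep (∈ₚ.∈-allFin z) (subst (λ z → isRep z ≡ true) (≡-sym z≡) (proj₂ (proj₂ (rep-of (proj₁ d)))))
      ... | inj₂ z∈i = ∈-filterᵇ⁺ isRep (∈ₚ.∈-allFin z) (iso-rep z (proj₂ (∈-filterᵇ⁻ iso (allFin n) z∈i)))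

    -- Vertices and faces are counted as surviving roots plus merges. The surviving roots together
    -- with the isolated vertices number at most twice the components, and Euler's formula leaves
    -- the rest to the merges.
    edges≤merges : n + faceCount ρ + isolatedCount G ≡ edgeCount G + 2 * componentCount G →
      edgeCount G ≤ primalMerges G ρ id es + dualMerges G ρ es []
    edges≤merges euler = ℕₚ.+-cancelʳ-≤ (2 * C) _ _ (begin
      edgeCount G + 2 * C             ≡⟨ euler ⟨
      n + faceCount ρ + I             ≤⟨ ℕₚ.+-monoˡ-≤ I (ℕₚ.+-mono-≤ (ℕₚ.≤-reflexive vertices) faces) ⟩
      (rP + pm) + (rD + dm) + I       ≡⟨ rearrange rP pm rD dm I ⟩
      (pm + dm) + (rP + (rD + I))     ≤⟨ ℕₚ.+-monoʳ-≤ (pm + dm) (ℕₚ.+-mono-≤ roots≤components dualRoots+isolated≤components) ⟩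
      (pm + dm) + (C + C)             ≡⟨ cong (λ k → (pm + dm) + (C + k)) (ℕₚ.+-identityʳ C) ⟨
      (pm + dm) + 2 * C               ∎)
      where
      open ℕₚ.≤-Reasoning
      C = componentCount G
      I = isolatedCount G
      pm = primalMerges G ρ id es
      dm = dualMerges G ρ es []
      rP = P.roots lab (allFin n)
      rD = roots dl (darts G)
      rearrange : ∀ a b c d e → (a + b) + (c + d) + e ≡ (b + d) + (a + (c + e))
      rearrange = solve-∀
      vertices : n ≡ rP + pm
      vertices = trans (≡-sym (trans (#-all _ (allFin n) (λ {x} _ → ⌊⌋⁺ (x ≟ x) refl)) (Listₚ.length-tabulate id)))
        (roots-primal es (λ _ → refl) (Uniqueₚ.allFin⁺ n) (λ _ → inj₂ (∈ₚ.∈-allFin _ , ∈ₚ.∈-allFin _)))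
      faces : faceCount ρ ≤ rD + dm
      faces = ℕₚ.≤-trans faceCount≤roots (ℕₚ.≤-reflexive (trans
        (roots-dual es [] Unique-darts (λ {e} e∈ → inj₂ (in-darts e (allD e∈) , in-darts (flip e) (trans (adjᵈ-flip G e) (allD e∈)))))
        (cong (λ k → roots (dualLabel G ρ k) (darts G) + dm) (Listₚ.++-identityʳ es))))
        where
        in-darts : ∀ d → adjᵈ G d ≡ true → dualLabel G ρ [] d ∈ darts G
        in-darts d a = ∈-darts⁺ G ρ (dualLabel-dart G ρ [] (λ ()) d a)

-- Planar graphs have sparse minors

canonical : ∀ {n} → Dart n → Dart n
canonical (a , b) = if ⌊ toℕ a ℕ.<? toℕ b ⌋ then (a , b) else (b , a)

canonical-cases : ∀ {n} (d : Dart n) → canonical d ≡ d ⊎ canonical d ≡ flip d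
canonical-cases (a , b) with ⌊ toℕ a ℕ.<? toℕ b ⌋
... | true  = inj₁ refl
... | false = inj₂ refl

canonical-elim : ∀ {n} (P : Dart n → Set) d → P d → P (flip d) → P (canonical d)
canonical-elim P d p q with canonical-cases d
... | inj₁ e = subst P (≡-sym e) p
... | inj₂ e = subst P (≡-sym e) q

canonical-≡ : ∀ {n} (d e : Dart n) → canonical d ≡ canonical e → d ≡ e ⊎ d ≡ flip e
canonical-≡ d e c with canonical-cases d | canonical-cases e
... | inj₁ p | inj₁ q = inj₁ (trans (≡-sym p) (trans c q))
... | inj₂ p | inj₂ q = inj₁ (cong flip (trans (≡-sym p) (trans c q)))
... | inj₁ p | inj₂ q = inj₂ (trans (≡-sym p) (trans c q))
... | inj₂ p | inj₁ q = inj₂ (cong flip (trans (≡-sym p) (trans c q)))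

isEdge : ∀ {n} → Graph n → Dart n → Bool
isEdge G p = adj G (proj₁ p) (proj₂ p) ∧ ⌊ toℕ (proj₁ p) ℕ.<? toℕ (proj₂ p) ⌋

edgesOf : ∀ {n} → Graph n → List (Dart n)
edgesOf {n} G = filterᵇ (isEdge G) (allPairs n)

adj-irrefl : ∀ {n} (G : Graph n) {a b} → adj G a b ≡ true → a ≢ b
adj-irrefl G {a} h refl = true≢false (trans (≡-sym h) (irrefl G a))

canonical-∈ : ∀ {n} (G : Graph n) d → adjᵈ G d ≡ true → canonical d ∈ edgesOf G
canonical-∈ G (a , b) h with toℕ a ℕ.<? toℕ b
... | yes lt = ∈-filterᵇ⁺ (isEdge G) (∈-allPairs a b) (∧⁺ h (⌊⌋⁺ (toℕ a ℕ.<? toℕ b) lt))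
... | no nlt = ∈-filterᵇ⁺ (isEdge G) (∈-allPairs b a) (∧⁺ (trans (sym G b a) h) (⌊⌋⁺ (toℕ b ℕ.<? toℕ a)
                 (ℕₚ.≤∧≢⇒< (ℕₚ.≮⇒≥ nlt) (λ e → adj-irrefl G h (≡-sym (Finₚ.toℕ-injective e))))))

∈-edgesOf⁻ : ∀ {n} (G : Graph n) {d} → d ∈ edgesOf G → adjᵈ G d ≡ true
∈-edgesOf⁻ {n} G {d} d∈ = proj₁ (∧⁻ {adjᵈ G d} (proj₂ (∈-filterᵇ⁻ (isEdge G) (allPairs n) d∈)))

Unique-edgesOf : ∀ {n} (G : Graph n) → Unique (edgesOf G)
Unique-edgesOf {n} G = Unique-filterᵇ (isEdge G) (Unique-allPairs n)


-- Contracting the edges inside the classes of g and keeping only rs leaves a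
-- simple minor of G; xs is a set of vertices meeting every class that rs touches.
module MinorDensity {n} (G : Graph n) (ρ : Rotation G)
  (euler : n + faceCount ρ + isolatedCount G ≡ edgeCount G + 2 * componentCount G)
  (g : Fin n → Fin n) (rs : List (Dart n)) (uniq : Unique rs)
  (darts-rs : ∀ {d} → d ∈ rs → adjᵈ G d ≡ true)
  (loopless : ∀ {a b : Fin n} → (a , b) ∈ rs → g a ≢ g b)
  (simple : ∀ {a b c d : Fin n} → (a , b) ∈ rs → (c , d) ∈ rs → g a ≡ g c → g b ≡ g d → (a , b) ≡ (c , d))
  (no-reverse : ∀ {a b c d : Fin n} → (a , b) ∈ rs → (c , d) ∈ rs → g a ≡ g d → g b ≡ g c → ⊥)
  (xs : List (Fin n))
  (meets : ∀ (lab : Fin n → Fin n) → (∀ {a b} → adj G a b ≡ true → g a ≡ g b → lab a ≡ lab b) →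
           ∀ {a b} → (a , b) ∈ rs → (∃ λ x → x ∈ xs × lab a ≡ lab x) × (∃ λ x → x ∈ xs × lab b ≡ lab x))
  where

  private
    inside isR : Dart n → Bool
    inside (a , b) = ⌊ g a ≟ g b ⌋
    isR d = any (λ e → ⌊ d ≟D e ⌋ ∨ ⌊ d ≟D flip e ⌋) rs
    es = edgesOf G
    cross = filterᵇ (not ∘ inside) es
    ts = filterᵇ inside es
    deleted = filterᵇ (not ∘ isR) cross
    all-es = ts ++ rs ++ deleted

    isR⁺ : ∀ {d} → d ∈ rs → isR d ≡ true
    isR⁺ {d} d∈ = any⁺ _ d∈ (∨⁺ˡ (⌊⌋⁺ (d ≟D d) refl))

    isR⁺-flip : ∀ {d} → flip d ∈ rs → isR d ≡ true
    isR⁺-flip {d} d∈ = any⁺ _ d∈ (∨⁺ʳ {⌊ d ≟D flip d ⌋} (⌊⌋⁺ (d ≟D d) refl))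

    isR⁻ : ∀ {d} → isR d ≡ true → d ∈ rs ⊎ flip d ∈ rs
    isR⁻ {d} h = let (e , e∈ , h') = any⁻ _ rs h in
      Sum.map (λ q → subst (_∈ rs) (≡-sym (⌊⌋⁻ (d ≟D e) q)) e∈)
              (λ q → subst (_∈ rs) (≡-sym (cong flip (⌊⌋⁻ (d ≟D flip e) q))) e∈)
              (∨⁻ {⌊ d ≟D e ⌋} h')

    covers-canonical : ∀ d → adjᵈ G d ≡ true → canonical d ∈ all-es ⊎ flip (canonical d) ∈ all-es
    covers-canonical d a = by-inside (≡true? (inside c))
      where
      c = canonical d
      by-R : inside c ≢ true → Dec (isR c ≡ true) → c ∈ all-es ⊎ flip c ∈ all-es
      by-R ni (yes r) = Sum.map (∈ₚ.∈-++⁺ʳ ts ∘ ∈ₚ.∈-++⁺ˡ) (∈ₚ.∈-++⁺ʳ ts ∘ ∈ₚ.∈-++⁺ˡ) (isR⁻ r)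
      by-R ni (no nr) = inj₁ (∈ₚ.∈-++⁺ʳ ts (∈ₚ.∈-++⁺ʳ rs (∈-filterᵇ⁺ (not ∘ isR)
                          (∈-filterᵇ⁺ (not ∘ inside) (canonical-∈ G d a) (not⁺ ni)) (not⁺ nr))))
      by-inside : Dec (inside c ≡ true) → c ∈ all-es ⊎ flip c ∈ all-es
      by-inside (yes i) = inj₁ (∈ₚ.∈-++⁺ˡ (∈-filterᵇ⁺ inside (canonical-∈ G d a) i))
      by-inside (no ni) = by-R ni (≡true? (isR c))

    covers : Covers G ρ all-es
    covers {x} {y} a = by-cases (canonical-cases (x , y)) (covers-canonical (x , y) a)
      where
      by-cases : ∀ {d} → d ≡ (x , y) ⊎ d ≡ (y , x) → d ∈ all-es ⊎ flip d ∈ all-es → (x , y) ∈ all-es ⊎ (y , x) ∈ all-es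
      by-cases (inj₁ e) = Sum.map (subst (_∈ all-es) e) (subst (λ z → flip z ∈ all-es) e)
      by-cases (inj₂ e) = Sum.swap ∘ Sum.map (subst (_∈ all-es) e) (subst (λ z → flip z ∈ all-es) e)

    ts-darts : AllDarts G ρ ts
    ts-darts d∈ = ∈-edgesOf⁻ G (proj₁ (∈-filterᵇ⁻ inside es d∈))

    deleted-darts : AllDarts G ρ deleted
    deleted-darts d∈ = ∈-edgesOf⁻ G (proj₁ (∈-filterᵇ⁻ (not ∘ inside) es (proj₁ (∈-filterᵇ⁻ (not ∘ isR) cross d∈))))

    all-darts : AllDarts G ρ all-es
    all-darts d∈ = [ ts-darts , (λ i → [ darts-rs , deleted-darts ]′ (∈ₚ.∈-++⁻ rs i)) ]′ (∈ₚ.∈-++⁻ ts d∈)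

    -- The darts of `rs` may be oriented either way; `no-reverse` keeps two of them from sharing an
    -- edge.
    length-rs≤ : length rs ≤ # isR cross
    length-rs≤ = injection⇒length≤ canonical rs (filterᵇ isR cross) uniq injective into
      where
      injective : ∀ {d e} → d ∈ rs → e ∈ rs → canonical d ≡ canonical e → d ≡ e
      injective d∈ e∈ c = [ id , (λ { refl → ⊥-elim (no-reverse d∈ e∈ refl refl) }) ]′ (canonical-≡ _ _ c)
      crosses : ∀ {d} → d ∈ rs → not (inside d) ≡ true × not (inside (flip d)) ≡ true
      crosses {a , b} d∈ = not⁺ (loopless d∈ ∘ ⌊⌋⁻ (g a ≟ g b)) , not⁺ (loopless d∈ ∘ ≡-sym ∘ ⌊⌋⁻ (g b ≟ g a))
      into : ∀ {d} → d ∈ rs → canonical d ∈ filterᵇ isR cross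
      into {d} d∈ = ∈-filterᵇ⁺ isR (∈-filterᵇ⁺ (not ∘ inside) (canonical-∈ G d (darts-rs d∈))
          (canonical-elim (λ z → not (inside z) ≡ true) d (proj₁ (crosses d∈)) (proj₂ (crosses d∈))))
        (canonical-elim (λ z → isR z ≡ true) d (isR⁺ d∈) (isR⁺-flip d∈))

    length≤edges : length ts + length rs + length deleted ≤ edgeCount G
    length≤edges = begin
      length ts + length rs + length deleted     ≡⟨ ℕₚ.+-assoc (length ts) (length rs) _ ⟩
      length ts + (length rs + length deleted)   ≤⟨ ℕₚ.+-monoʳ-≤ (length ts) (ℕₚ.+-monoˡ-≤ (length deleted) length-rs≤) ⟩
      length ts + (# isR cross + length deleted) ≡⟨ cong (λ k → length ts + k) (#-partition isR cross) ⟨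
      length ts + length cross                   ≡⟨ #-partition inside es ⟨
      edgeCount G                                ∎
      where open ℕₚ.≤-Reasoning

    labT = primalLabel G ρ id ts
    pT = primalMerges G ρ id ts
    pR = primalMerges G ρ labT rs
    pD = primalMerges G ρ (primalLabel G ρ labT rs) deleted
    dT = dualMerges G ρ ts (rs ++ deleted)
    dR = dualMerges G ρ rs deleted
    dD = dualMerges G ρ deleted []

    -- every edge of ts and deleted merges at most once, so Euler's formula leaves
    -- at least length rs merges for the edges of rs
    length-rs≤merges : length rs ≤ pR + dR
    length-rs≤merges = ℕₚ.+-cancelˡ-≤ (length ts + length deleted) _ _ (begin
      (length ts + length deleted) + length rs      ≡⟨ shuffle₁ (length ts) (length deleted) (length rs) ⟩
      length ts + length rs + length deleted        ≤⟨ length≤edges ⟩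
      edgeCount G                                   ≤⟨ edges≤merges G ρ all-es covers all-darts euler ⟩
      primalMerges G ρ id all-es + dualMerges G ρ all-es [] ≡⟨ cong₂ _+_ splitP splitD ⟩
      (pT + (pR + pD)) + (dT + (dR + dD))           ≡⟨ shuffle₂ pT pR pD dT dR dD ⟩
      (pT + dT) + (pD + dD) + (pR + dR)             ≤⟨ ℕₚ.+-monoˡ-≤ (pR + dR) (ℕₚ.+-mono-≤ mT mD) ⟩
      (length ts + length deleted) + (pR + dR)      ∎)
      where
      open ℕₚ.≤-Reasoning
      shuffle₁ : ∀ a b c → (a + b) + c ≡ a + c + b
      shuffle₁ = solve-∀
      shuffle₂ : ∀ a b c d e f → (a + (b + c)) + (d + (e + f)) ≡ (a + d) + (c + f) + (b + e)
      shuffle₂ = solve-∀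
      splitP : primalMerges G ρ id all-es ≡ pT + (pR + pD)
      splitP = trans (primalMerges-++ G ρ ts (rs ++ deleted)) (cong (λ k → pT + k) (primalMerges-++ G ρ rs deleted))
      splitD : dualMerges G ρ all-es [] ≡ dT + (dR + dD)
      splitD = trans (dualMerges-++ G ρ ts (rs ++ deleted) [])
        (cong₂ _+_ (cong (dualMerges G ρ ts) (Listₚ.++-identityʳ (rs ++ deleted)))
          (trans (dualMerges-++ G ρ rs deleted []) (cong (λ l → dualMerges G ρ rs l + dD) (Listₚ.++-identityʳ deleted))))
      mT : pT + dT ≤ length ts
      mT = merges≤length G ρ [] ts (rs ++ deleted) covers ts-darts
      mD : pD + dD ≤ length deleted
      mD = subst (λ l → primalMerges G ρ l deleted + dD ≤ length deleted) (primalLabel-++ G ρ ts rs)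
        (merges≤length G ρ (ts ++ rs) deleted [] (subst (Covers G ρ)
          (trans (≡-sym (Listₚ.++-assoc ts rs deleted)) (cong ((ts ++ rs) ++_) (≡-sym (Listₚ.++-identityʳ deleted)))) covers) deleted-darts)

    labT-inside : ∀ {a b} → adj G a b ≡ true → g a ≡ g b → labT a ≡ labT b
    labT-inside {a} {b} ab e =
      [ (λ p → primalLabel-edge G ρ ts (∈-filterᵇ⁺ inside (subst (_∈ es) p c∈) (⌊⌋⁺ (g a ≟ g b) e)))
      , (λ p → ≡-sym (primalLabel-edge G ρ ts (∈-filterᵇ⁺ inside (subst (_∈ es) p c∈) (⌊⌋⁺ (g b ≟ g a) (≡-sym e)))))
      ]′ (canonical-cases (a , b))
      where c∈ = canonical-∈ G (a , b) ab

    -- After the contraction every endpoint of `rs` shares its label with an element of `xs`, so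
    -- each merge destroys a root among these labels.
    pR≤ : pR ≤ length xs
    pR≤ = begin
      pR                                     ≤⟨ ℕₚ.m≤n+m pR (P.roots (primalLabel G ρ labT rs) us) ⟩
      P.roots (primalLabel G ρ labT rs) us + pR ≡⟨ roots-primal G ρ rs (primalLabel-idem G ρ ts (λ _ → refl)) (deduplicate-! _≟_ _) tracked ⟨
      P.roots labT us                        ≤⟨ #≤length _ us ⟩
      length us                              ≤⟨ Listₚ.length-deduplicate _≟_ (map labT xs) ⟩
      length (map labT xs)                   ≡⟨ Listₚ.length-map labT xs ⟩
      length xs                              ∎
      where
      open ℕₚ.≤-Reasoning
      module P = UnionFind (_≟_ {n})
      us = deduplicate _≟_ (map labT xs)
      labelled : ∀ {a} → (∃ λ x → x ∈ xs × labT a ≡ labT x) → labT a ∈ us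
      labelled (x , x∈ , e) = ∈ₚ.∈-deduplicate⁺ _≟_ (subst (_∈ map labT xs) (≡-sym e) (∈ₚ.∈-map⁺ labT x∈))
      tracked : ∀ {a b} → (a , b) ∈ rs → Tracked _≟_ labT us a b
      tracked r∈ = let (ma , mb) = meets labT labT-inside r∈ in inj₂ (labelled ma , labelled mb)

    dl = dualLabel G ρ deleted
    rs± = rs ++ map flip rs

    proper : Dart n → Bool
    proper d = not ⌊ dl d ≟D dl (flip d) ⌋

    zs = filterᵇ proper rs±
    ys = deduplicate _≟D_ (map dl zs)

    ∈-rs±⁻ : ∀ {d} → d ∈ rs± → d ∈ rs ⊎ flip d ∈ rs
    ∈-rs±⁻ d∈ with ∈ₚ.∈-++⁻ rs d∈
    ... | inj₁ i = inj₁ i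
    ... | inj₂ i with ∈ₚ.∈-map⁻ flip i
    ...   | e , e∈ , refl = inj₂ e∈

    ∈-rs±⁺ : ∀ {d} → d ∈ rs ⊎ flip d ∈ rs → d ∈ rs±
    ∈-rs±⁺ (inj₁ i) = ∈ₚ.∈-++⁺ˡ i
    ∈-rs±⁺ {d} (inj₂ i) = ∈ₚ.∈-++⁺ʳ rs (∈ₚ.∈-map⁺ flip i)

    rs±-dart : ∀ {d} → d ∈ rs± → adjᵈ G d ≡ true
    rs±-dart {d} d∈ with ∈-rs±⁻ d∈
    ... | inj₁ i = darts-rs i
    ... | inj₂ i = trans (≡-sym (adjᵈ-flip G d)) (darts-rs i)

    rs±-loopless : ∀ {a b} → (a , b) ∈ rs± → g a ≢ g b
    rs±-loopless d∈ with ∈-rs±⁻ d∈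
    ... | inj₁ i = loopless i
    ... | inj₂ i = loopless i ∘ ≡-sym

    rs±-simple : ∀ {a b c d} → (a , b) ∈ rs± → (c , d) ∈ rs± → g a ≡ g c → g b ≡ g d → (a , b) ≡ (c , d)
    rs±-simple p q e f with ∈-rs±⁻ p | ∈-rs±⁻ q
    ... | inj₁ i | inj₁ j = simple i j e f
    ... | inj₂ i | inj₂ j = cong flip (simple i j f e)
    ... | inj₁ i | inj₂ j = ⊥-elim (no-reverse i j e f)
    ... | inj₂ i | inj₁ j = ⊥-elim (no-reverse i j f e)

    -- The edge of such a dart can be neither contracted, as its ends have different images under
    -- `g`, nor deleted, as its sides have different dual labels.
    crossing-dart : ∀ {y x} → adj G y x ≡ true → g y ≢ g x → dl (y , x) ≢ dl (x , y) → (y , x) ∈ zs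
    crossing-dart {y} {x} a ne dne = ∈-filterᵇ⁺ proper (∈-rs±⁺ (locate (covers a))) (not⁺ (dne ∘ ⌊⌋⁻ (_ ≟D _)))
      where
      part : ∀ {d} → d ∈ all-es → inside d ≢ true → dl d ≢ dl (flip d) → d ∈ rs
      part {d} d∈ ni nd with ∈ₚ.∈-++⁻ ts d∈
      ... | inj₁ i = ⊥-elim (ni (proj₂ (∈-filterᵇ⁻ inside es i)))
      ... | inj₂ i with ∈ₚ.∈-++⁻ rs i
      ...   | inj₁ j = j
      ...   | inj₂ j = ⊥-elim (nd (dualLabel-flip G ρ deleted j))
      locate : (y , x) ∈ all-es ⊎ (x , y) ∈ all-es → (y , x) ∈ rs ⊎ (x , y) ∈ rs
      locate (inj₁ i) = inj₁ (part i (ne ∘ ⌊⌋⁻ (g y ≟ g x)) dne)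
      locate (inj₂ i) = inj₂ (part i (ne ∘ ≡-sym ∘ ⌊⌋⁻ (g x ≟ g y)) (dne ∘ ≡-sym))

    OnBoundary : Dart n → Fin n → Fin n → Set
    OnBoundary y u v = dl (u , v) ≡ y × dl (v , u) ≢ y

    -- Modulo `g`, the first dart runs from `a` to `b`, the second leaves `b` and the third enters
    -- `a`. If the last two coincided, their dart would run from `b` to `a` and, by simplicity, be
    -- (b, a), which is outside the dual class `y`.
    three-darts-at : ∀ {a b y₁ x₁ y₂ x₂ y} → (a , b) ∈ rs± → OnBoundary y a b →
      adj G y₁ x₁ ≡ true → g y₁ ≡ g b → g x₁ ≢ g b → OnBoundary y y₁ x₁ →
      adj G y₂ x₂ ≡ true → g y₂ ≢ g a → g x₂ ≡ g a → OnBoundary y y₂ x₂ →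
      3 ≤ # (λ z → ⌊ dl z ≟D y ⌋) zs
    three-darts-at {a} {b} {y₁} {x₁} {y₂} {x₂} {y} r∈ (s₀ , t₀) adj₁ gy₁ gx₁ (s₁ , t₁) adj₂ gy₂ gx₂ (s₂ , t₂) =
      Unique-⊆⇒length≤ {xs = (a , b) ∷ (y₁ , x₁) ∷ (y₂ , x₂) ∷ []} uniq₃
        (All.lookup {P = _∈ filterᵇ (λ z → ⌊ dl z ≟D y ⌋) zs}
          (∈-filterᵇ⁺ _ z₀∈ (⌊⌋⁺ (dl (a , b) ≟D y) s₀) ∷ ∈-filterᵇ⁺ _ z₁∈ (⌊⌋⁺ (dl (y₁ , x₁) ≟D y) s₁) ∷
           ∈-filterᵇ⁺ _ z₂∈ (⌊⌋⁺ (dl (y₂ , x₂) ≟D y) s₂) ∷ []))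
      where
      ga≢gb : g a ≢ g b
      ga≢gb = rs±-loopless r∈
      sided : ∀ {u v} → OnBoundary y u v → dl (u , v) ≢ dl (v , u)
      sided (p , q) e = q (trans (≡-sym e) p)
      z₀∈ : (a , b) ∈ zs
      z₀∈ = crossing-dart (rs±-dart r∈) ga≢gb (sided (s₀ , t₀))
      z₁∈ : (y₁ , x₁) ∈ zs
      z₁∈ = crossing-dart adj₁ (λ e → gx₁ (trans (≡-sym e) gy₁)) (sided (s₁ , t₁))
      z₂∈ : (y₂ , x₂) ∈ zs
      z₂∈ = crossing-dart adj₂ (λ e → gy₂ (trans e gx₂)) (sided (s₂ , t₂))
      z₁≢z₂ : (y₁ , x₁) ≢ (y₂ , x₂)
      z₁≢z₂ e = t₀ (trans (cong dl (≡-sym (rs±-simple (proj₁ (∈-filterᵇ⁻ proper rs± z₁∈))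
        (∈-rs±⁺ {b , a} (Sum.swap (∈-rs±⁻ r∈))) gy₁ (trans (cong (g ∘ proj₂) e) gx₂)))) s₁)
      uniq₃ : Unique ((a , b) ∷ (y₁ , x₁) ∷ (y₂ , x₂) ∷ [])
      uniq₃ = ((λ e → ga≢gb (trans (cong (g ∘ proj₁) e) gy₁)) ∷ (λ e → ga≢gb (≡-sym (trans (cong (g ∘ proj₂) e) gx₂))) ∷ [])
            ∷ (z₁≢z₂ ∷ []) ∷ [] ∷ []

    -- The boundary of a dual class is balanced at every contracted vertex, so a
    -- boundary dart is preceded and followed by two further ones.
    three-darts-of : ∀ {a b y} → (a , b) ∈ zs → y ≡ dl (a , b) → 3 ≤ # (λ z → ⌊ dl z ≟D y ⌋) zs
    three-darts-of {a} {b} {y} z∈ y≡ = finish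
        (cut-balance G ρ s s-φ (λ x → ⌊ g x ≟ g b ⌋) a b (rs±-dart r∈) (ga≢gb ∘ ⌊⌋⁻ (g a ≟ g b)) (⌊⌋⁺ (g b ≟ g b) refl) s-ab ¬s-ba)
        -- The cut is the complement of the class of `a`, so the dart leaving it enters that class.
        (cut-balance G ρ s s-φ (λ x → not ⌊ g x ≟ g a ⌋) a b (rs±-dart r∈) (λ h → not⁻ h (⌊⌋⁺ (g a ≟ g a) refl))
          (not⁺ (ga≢gb ∘ ≡-sym ∘ ⌊⌋⁻ (g b ≟ g a))) s-ab ¬s-ba)
      where
      r∈ = proj₁ (∈-filterᵇ⁻ proper rs± z∈)
      ga≢gb : g a ≢ g b
      ga≢gb = rs±-loopless r∈
      s : Dart n → Bool
      s d = ⌊ dl d ≟D y ⌋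
      s-φ : ∀ d → adjᵈ G d ≡ true → s d ≡ true → s (faceStep ρ d) ≡ true
      s-φ d dd sd = ⌊⌋⁺ (dl (faceStep ρ d) ≟D y) (trans (≡-sym (dualLabel-φ G ρ deleted d dd)) (⌊⌋⁻ (dl d ≟D y) sd))
      boundary₀ : OnBoundary y a b
      boundary₀ = ≡-sym y≡ , λ e → not⁻ (proj₂ (∈-filterᵇ⁻ proper rs± z∈)) (⌊⌋⁺ (dl (a , b) ≟D dl (b , a)) (trans (≡-sym y≡) (≡-sym e)))
      s-ab : s (a , b) ≡ true
      s-ab = ⌊⌋⁺ (dl (a , b) ≟D y) (proj₁ boundary₀)
      ¬s-ba : s (b , a) ≢ true
      ¬s-ba h = proj₂ boundary₀ (⌊⌋⁻ (dl (b , a) ≟D y) h)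
      boundary : ∀ {u v} → s (u , v) ≡ true → s (v , u) ≢ true → OnBoundary y u v
      boundary {u} {v} p q = ⌊⌋⁻ (dl (u , v) ≟D y) p , q ∘ ⌊⌋⁺ (dl (v , u) ≟D y)
      finish : (∃ λ y₁ → ∃ λ x₁ → adj G y₁ x₁ ≡ true × ⌊ g y₁ ≟ g b ⌋ ≡ true × ⌊ g x₁ ≟ g b ⌋ ≢ true × s (y₁ , x₁) ≡ true × s (x₁ , y₁) ≢ true) →
        (∃ λ y₂ → ∃ λ x₂ → adj G y₂ x₂ ≡ true × not ⌊ g y₂ ≟ g a ⌋ ≡ true × not ⌊ g x₂ ≟ g a ⌋ ≢ true × s (y₂ , x₂) ≡ true × s (x₂ , y₂) ≢ true) →
        3 ≤ # (λ z → ⌊ dl z ≟D y ⌋) zs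
      finish (y₁ , x₁ , adj₁ , in₁ , out₁ , s₁ , t₁) (y₂ , x₂ , adj₂ , out₂ , in₂ , s₂ , t₂) = three-darts-at r∈ boundary₀
        adj₁ (⌊⌋⁻ (g y₁ ≟ g b) in₁) (out₁ ∘ ⌊⌋⁺ (g x₁ ≟ g b)) (boundary s₁ t₁)
        adj₂ (not⁻ out₂ ∘ ⌊⌋⁺ (g y₂ ≟ g a)) (not⌊⌋⁻ (g x₂ ≟ g a) in₂) (boundary s₂ t₂)

    three-darts : ∀ {y} → y ∈ ys → 3 ≤ # (λ z → ⌊ dl z ≟D y ⌋) zs
    three-darts {y} y∈ = let (_ , z∈ , y≡) = ∈ₚ.∈-map⁻ dl (∈ₚ.∈-deduplicate⁻ _≟D_ (map dl zs) y∈) in three-darts-of z∈ y≡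

    -- A merge along `rs` involves two dual classes with a boundary dart over `rs`, and the labels
    -- of all such classes are in `ys`.
    dR≤ : dR ≤ length ys
    dR≤ = begin
      dR                                               ≤⟨ ℕₚ.m≤n+m dR _ ⟩
      D.roots (dualLabel G ρ (rs ++ deleted)) ys + dR  ≡⟨ roots-dual G ρ rs deleted (deduplicate-! _≟D_ _) tracked ⟨
      D.roots dl ys                                    ≤⟨ #≤length _ ys ⟩
      length ys                                        ∎
      where
      open ℕₚ.≤-Reasoning
      module D = UnionFind (_≟D_ {n})
      tracked : ∀ {e} → e ∈ rs → Tracked _≟D_ dl ys e (flip e)
      tracked {e} e∈ = by-cases (dl e ≟D dl (flip e))
        where
        in-ys : ∀ {d} → d ∈ zs → dl d ∈ ys
        in-ys d∈ = ∈ₚ.∈-deduplicate⁺ _≟D_ (∈ₚ.∈-map⁺ dl d∈)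
        by-cases : Dec (dl e ≡ dl (flip e)) → Tracked _≟D_ dl ys e (flip e)
        by-cases (yes eq) = inj₁ eq
        by-cases (no ne) = inj₂ (in-ys (∈-filterᵇ⁺ proper (∈-rs±⁺ (inj₁ e∈)) (not⁺ (ne ∘ ⌊⌋⁻ (dl e ≟D dl (flip e))))) ,
                                 in-ys (∈-filterᵇ⁺ proper (∈-rs±⁺ (inj₂ e∈)) (not⁺ (ne ∘ ≡-sym ∘ ⌊⌋⁻ (dl (flip e) ≟D dl e)))))

  -- With R edges, X elements of `xs` and Y dual classes, R ≤ X + Y by the merges and 3Y ≤ 2R by the
  -- boundary darts; hence 3R ≤ 3X + 2R.
  minor-density : length rs ≤ 3 * length xs
  minor-density = ℕₚ.+-cancelˡ-≤ (2 * length rs) _ _ (begin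
    2 * length rs + length rs            ≡⟨ ℕₚ.+-comm (2 * length rs) _ ⟩
    3 * length rs                        ≤⟨ ℕₚ.*-monoʳ-≤ 3 (ℕₚ.≤-trans length-rs≤merges (ℕₚ.+-mono-≤ pR≤ dR≤)) ⟩
    3 * (length xs + length ys)          ≡⟨ ℕₚ.*-distribˡ-+ 3 (length xs) _ ⟩
    3 * length xs + 3 * length ys        ≤⟨ ℕₚ.+-monoʳ-≤ (3 * length xs) (fibres-≤ _≟D_ dl 3 ys zs (deduplicate-! _≟D_ _) three-darts) ⟩
    3 * length xs + length zs            ≤⟨ ℕₚ.+-monoʳ-≤ (3 * length xs) (#≤length proper rs±) ⟩
    3 * length xs + length rs±           ≡⟨ cong (λ k → 3 * length xs + k) (trans (Listₚ.length-++ rs) (cong (λ k → length rs + k) (trans (Listₚ.length-map flip rs) (≡-sym (ℕₚ.+-identityʳ _))))) ⟩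
    3 * length xs + 2 * length rs        ≡⟨ ℕₚ.+-comm (3 * length xs) _ ⟩
    2 * length rs + 3 * length xs        ∎)
    where open ℕₚ.≤-Reasoning

-- With nothing contracted and nothing deleted, the graph is a simple minor of itself.
edgeCount≤3n : ∀ {n} (G : Graph n) → Planar G → edgeCount G ≤ 3 * n
edgeCount≤3n {n} G (ρ , euler) = subst (λ k → edgeCount G ≤ 3 * k) (Listₚ.length-tabulate {n = n} id)
  (MinorDensity.minor-density G ρ euler id (edgesOf G) (Unique-edgesOf G) (∈-edgesOf⁻ G)
    (λ d∈ → adj-irrefl G (∈-edgesOf⁻ G d∈))
    (λ { _ _ refl refl → refl })
    (λ { p q refl refl → ℕₚ.<-asym (ordered p) (ordered q) })
    (allFin n)
    (λ lab _ {a} {b} _ → (a , ∈ₚ.∈-allFin a , refl) , (b , ∈ₚ.∈-allFin b , refl)))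
  where
  ordered : ∀ {d} → d ∈ edgesOf G → toℕ (proj₁ d) ℕ.< toℕ (proj₂ d)
  ordered {a , b} d∈ = ⌊⌋⁻ (toℕ a ℕ.<? toℕ b) (proj₂ (∧⁻ {adj G a b} (proj₂ (∈-filterᵇ⁻ (isEdge G) (allPairs n) d∈))))

-- Random cuts and role colourings

consᵇ : ∀ {n} → Bool → (Fin n → Bool) → Fin (suc n) → Bool
consᵇ b A zero    = b
consᵇ b A (suc i) = A i

-- The sum of `F` over all subsets of `Fin n`: an expectation over a random subset, multiplied by 2
-- ^ n to stay among the natural numbers.
total : ∀ n → ((Fin n → Bool) → ℕ) → ℕ
total zero    F = F (λ ())
total (suc n) F = total n (λ A → F (consᵇ true A)) + total n (λ A → F (consᵇ false A))

total-+ : ∀ n F F' → total n (λ A → F A + F' A) ≡ total n F + total n F'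
total-+ zero    F F' = refl
total-+ (suc n) F F' = trans (cong₂ _+_ (total-+ n (λ A → F (consᵇ true A)) (λ A → F' (consᵇ true A)))
                                        (total-+ n (λ A → F (consᵇ false A)) (λ A → F' (consᵇ false A))))
  (shuffle (total n (λ A → F (consᵇ true A))) _ _ _)
  where
  shuffle : ∀ a b c d → (a + b) + (c + d) ≡ (a + c) + (b + d)
  shuffle = solve-∀

total-cong : ∀ n F F' → (∀ A → F A ≡ F' A) → total n F ≡ total n F'
total-cong zero    F F' h = h _
total-cong (suc n) F F' h = cong₂ _+_ (total-cong n _ _ (λ A → h _)) (total-cong n _ _ (λ A → h _))

total-const : ∀ n k → total n (λ _ → k) ≡ 2 ^ n * k
total-const zero    k = ≡-sym (ℕₚ.+-identityʳ k)
total-const (suc n) k rewrite total-const n k = shuffle (2 ^ n) k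
  where
  shuffle : ∀ a b → a * b + a * b ≡ 2 * a * b
  shuffle = solve-∀

total-max : ∀ n F → ∃ λ A → total n F ≤ 2 ^ n * F A
total-max zero    F = (λ ()) , ℕₚ.≤-reflexive (≡-sym (ℕₚ.+-identityʳ _))
total-max (suc n) F with total-max n (λ A → F (consᵇ true A)) | total-max n (λ A → F (consᵇ false A))
... | A , le | A' , le' with ℕₚ.≤-total (F (consᵇ true A)) (F (consᵇ false A'))
...   | inj₁ h = consᵇ false A' , ℕₚ.≤-trans (ℕₚ.+-mono-≤ (ℕₚ.≤-trans le (ℕₚ.*-monoʳ-≤ (2 ^ n) h)) le') (ℕₚ.≤-reflexive (shuffle (2 ^ n) _))
  where
  shuffle : ∀ a b → a * b + a * b ≡ 2 * a * b
  shuffle = solve-∀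
...   | inj₂ h = consᵇ true A , ℕₚ.≤-trans (ℕₚ.+-mono-≤ le (ℕₚ.≤-trans le' (ℕₚ.*-monoʳ-≤ (2 ^ n) h))) (ℕₚ.≤-reflexive (shuffle (2 ^ n) _))
  where
  shuffle : ∀ a b → a * b + a * b ≡ 2 * a * b
  shuffle = solve-∀

bit : Bool → ℕ
bit true  = 1
bit false = 0

total-bit : ∀ n (x : Fin n) → 2 * total n (λ A → bit (A x)) ≡ 2 ^ n
total-bit (suc n) zero rewrite total-const n 1 | total-const n 0 = shuffle (2 ^ n)
  where
  shuffle : ∀ a → 2 * (a * 1 + a * 0) ≡ 2 * a
  shuffle = solve-∀
total-bit (suc n) (suc x) = trans (shuffle (total n (λ A → bit (A x)))) (cong (2 *_) (total-bit n x))
  where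
  shuffle : ∀ a → 2 * (a + a) ≡ 2 * (2 * a)
  shuffle = solve-∀

total-bit-not : ∀ n (x : Fin n) → 2 * total n (λ A → bit (not (A x))) ≡ 2 ^ n
total-bit-not (suc n) zero rewrite total-const n 1 | total-const n 0 = shuffle (2 ^ n)
  where
  shuffle : ∀ a → 2 * (a * 0 + a * 1) ≡ 2 * a
  shuffle = solve-∀
total-bit-not (suc n) (suc x) = trans (shuffle (total n (λ A → bit (not (A x))))) (cong (2 *_) (total-bit-not n x))
  where
  shuffle : ∀ a → 2 * (a + a) ≡ 2 * (2 * a)
  shuffle = solve-∀

total-cut : ∀ n (x y : Fin n) → x ≢ y → 4 * total n (λ A → bit (A x ∧ not (A y))) ≡ 2 ^ n
total-cut (suc n) zero zero x≢y = ⊥-elim (x≢y refl)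
total-cut (suc n) zero (suc y) _ rewrite total-const n 0 =
  trans (shuffle (2 ^ n) (total n (λ A → bit (not (A y))))) (cong (2 *_) (total-bit-not n y))
  where
  shuffle : ∀ a b → 4 * (b + a * 0) ≡ 2 * (2 * b)
  shuffle = solve-∀
total-cut (suc n) (suc x) zero _ = begin
  4 * (total n (λ A → bit (A x ∧ false)) + total n (λ A → bit (A x ∧ true)))
    ≡⟨ cong (4 *_) (cong₂ _+_ (total-cong n _ _ (λ A → cong bit (∧-falseʳ (A x)))) (total-cong n _ _ (λ A → cong bit (∧-trueʳ (A x))))) ⟩
  4 * (total n (λ _ → 0) + total n (λ A → bit (A x)))
    ≡⟨ cong (λ k → 4 * (k + total n (λ A → bit (A x)))) (total-const n 0) ⟩
  4 * (2 ^ n * 0 + total n (λ A → bit (A x)))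
    ≡⟨ shuffle (2 ^ n) _ ⟩
  2 * (2 * total n (λ A → bit (A x)))
    ≡⟨ cong (2 *_) (total-bit n x) ⟩
  2 * 2 ^ n ∎
  where
  open ≡-Reasoning
  ∧-falseʳ : ∀ b → b ∧ false ≡ false
  ∧-falseʳ true  = refl
  ∧-falseʳ false = refl
  ∧-trueʳ : ∀ b → b ∧ true ≡ b
  ∧-trueʳ true  = refl
  ∧-trueʳ false = refl
  shuffle : ∀ a b → 4 * (a * 0 + b) ≡ 2 * (2 * b)
  shuffle = solve-∀
total-cut (suc n) (suc x) (suc y) x≢y =
  trans (shuffle (total n (λ A → bit (A x ∧ not (A y))))) (cong (2 *_) (total-cut n x y (x≢y ∘ cong suc)))
  where
  shuffle : ∀ a → 4 * (a + a) ≡ 2 * (4 * a)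
  shuffle = solve-∀

-- A uniformly random cut separates x from y in the right direction with probability 1/4.
directed-cut : ∀ {I : Set} {n} (f g : I → Fin n) (is : List I) → (∀ {i} → i ∈ is → f i ≢ g i) →
  ∃ λ A → length is ≤ 4 * # (λ i → A (f i) ∧ not (A (g i))) is
directed-cut {I} {n} f g is f≢g with total-max n (λ A → # (λ i → A (f i) ∧ not (A (g i))) is)
... | A , le = A , ℕₚ.*-cancelˡ-≤ (2 ^ n) {{ℕₚ.m^n≢0 2 n}} (begin
  2 ^ n * length is                                                    ≤⟨ expected is f≢g ⟩
  4 * total n (λ A → # (λ i → A (f i) ∧ not (A (g i))) is)             ≤⟨ ℕₚ.*-monoʳ-≤ 4 le ⟩
  4 * (2 ^ n * # (λ i → A (f i) ∧ not (A (g i))) is)                   ≡⟨ swap (2 ^ n) _ ⟩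
  2 ^ n * (4 * # (λ i → A (f i) ∧ not (A (g i))) is)                   ∎)
  where
  open ℕₚ.≤-Reasoning
  swap : ∀ a b → 4 * (a * b) ≡ a * (4 * b)
  swap = solve-∀
  #-cons : ∀ (p : I → Bool) i is → # p (i ∷ is) ≡ bit (p i) + # p is
  #-cons p i is with p i
  ... | true  = refl
  ... | false = refl
  expected : ∀ is → (∀ {i} → i ∈ is → f i ≢ g i) →
    2 ^ n * length is ≤ 4 * total n (λ A → # (λ i → A (f i) ∧ not (A (g i))) is)
  expected [] h = ℕₚ.≤-trans (ℕₚ.≤-reflexive (ℕₚ.*-zeroʳ (2 ^ n))) z≤n
  expected (i ∷ is) h = begin
    2 ^ n * suc (length is)                 ≡⟨ ℕₚ.*-suc (2 ^ n) _ ⟩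
    2 ^ n + 2 ^ n * length is               ≤⟨ ℕₚ.+-mono-≤ (ℕₚ.≤-reflexive (≡-sym (total-cut n (f i) (g i) (h (here refl))))) (expected is (h ∘ there)) ⟩
    4 * X + 4 * Y                           ≡⟨ ℕₚ.*-distribˡ-+ 4 X Y ⟨
    4 * (X + Y)                             ≡⟨ cong (4 *_) (≡-sym (trans (total-cong n _ _ (λ A → #-cons (λ i → A (f i) ∧ not (A (g i))) i is)) (total-+ n _ _))) ⟩
    4 * total n (λ A → # (λ i → A (f i) ∧ not (A (g i))) (i ∷ is)) ∎
    where
    X = total n (λ A → bit (A (f i) ∧ not (A (g i))))
    Y = total n (λ A → # (λ i → A (f i) ∧ not (A (g i))) is)

#-filterᵇ : ∀ {A : Set} (p q : A → Bool) xs → # q (filterᵇ p xs) ≡ # (λ x → p x ∧ q x) xs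
#-filterᵇ p q [] = refl
#-filterᵇ p q (x ∷ xs) with p x
... | false = #-filterᵇ p q xs
... | true with q x
...   | true  = cong suc (#-filterᵇ p q xs)
...   | false = #-filterᵇ p q xs

Mask : ℕ → Set
Mask N = Fin N → Bool

∣_∣ᵐ : ∀ {N} → Mask N → ℕ
∣_∣ᵐ {N} S = # S (allFin N)

_⊑ᵐ_ : ∀ {N} → Mask N → Mask N → Set
S' ⊑ᵐ S = ∀ i → S' i ≡ true → S i ≡ true

costs : ∀ {X : Set} → (X → ℕ) → List X → ℕ
costs K []       = 1
costs K (x ∷ xs) = K x * costs K xs

-- Hereditary properties can be enforced one after another: later shrinking keeps the earlier ones,
-- and the losses multiply. `Q` is the hereditary hypothesis that each single step relies on.
shrink-all : ∀ {N} {X : Set} (P : X → Mask N → Set) (K : X → ℕ) (Q : Mask N → Set) →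
  (∀ {x S S'} → S' ⊑ᵐ S → P x S → P x S') → (∀ {S S'} → S' ⊑ᵐ S → Q S → Q S') →
  (∀ x S → Q S → ∃ λ S' → S' ⊑ᵐ S × ∣ S ∣ᵐ ≤ K x * ∣ S' ∣ᵐ × P x S') →
  ∀ xs S → Q S → ∃ λ S' → S' ⊑ᵐ S × ∣ S ∣ᵐ ≤ costs K xs * ∣ S' ∣ᵐ × (∀ {x} → x ∈ xs → P x S')
shrink-all P K Q her herQ step' [] S q = S , (λ _ → id) , ℕₚ.≤-reflexive (≡-sym (ℕₚ.+-identityʳ _)) , λ ()
shrink-all P K Q her herQ step' (x ∷ xs) S q with step' x S q
... | S₁ , sub₁ , le₁ , p₁ with shrink-all P K Q her herQ step' xs S₁ (herQ sub₁ q)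
...   | S₂ , sub₂ , le₂ , ps = S₂ , (λ i → sub₁ i ∘ sub₂ i) ,
  ℕₚ.≤-trans le₁ (ℕₚ.≤-trans (ℕₚ.*-monoʳ-≤ (K x) le₂) (ℕₚ.≤-reflexive (≡-sym (ℕₚ.*-assoc (K x) _ _)))) ,
  λ { (here refl) → her sub₂ p₁ ; (there x∈) → ps x∈ }

module _ {N n m} (c : Fin N → Fin m → Fin n) where

  Roles : Mask N → Set
  Roles S = ∀ {i j a b} → S i ≡ true → S j ≡ true → c i a ≡ c j b → a ≡ b

  roles-cost : ℕ
  roles-cost = costs (λ _ → 4) (allPairs m)

  -- For each ordered pair of distinct roles a directed cut keeps the copies with the first role
  -- inside and the second outside, at the cost of a factor 4; then no vertex plays both.
  colour-roles : (∀ i → Injective _≡_ _≡_ (c i)) →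
    ∃ λ S → N ≤ roles-cost * ∣ S ∣ᵐ × Roles S
  colour-roles inj-c with shrink-all Sep (λ _ → 4) (λ _ → ⊤) her (λ _ _ → tt) separate (allPairs m) (λ _ → true) tt
    where
    Sep : Fin m × Fin m → Mask N → Set
    Sep (a , b) S = ∀ {i j} → S i ≡ true → S j ≡ true → c i a ≡ c j b → a ≡ b
    her : ∀ {x S S'} → S' ⊑ᵐ S → Sep x S → Sep x S'
    her sub p si sj = p (sub _ si) (sub _ sj)
    separate : ∀ x S → ⊤ → ∃ λ S' → S' ⊑ᵐ S × ∣ S ∣ᵐ ≤ 4 * ∣ S' ∣ᵐ × Sep x S'
    separate (a , b) S _ = by-cases (a ≟ b)
      where
      by-cases : Dec (a ≡ b) → ∃ λ S' → S' ⊑ᵐ S × ∣ S ∣ᵐ ≤ 4 * ∣ S' ∣ᵐ × Sep (a , b) S'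
      by-cases (yes a≡b) = S , (λ _ → id) , ℕₚ.m≤n*m _ 4 , λ _ _ _ → a≡b
      by-cases (no a≢b) = (λ i → S i ∧ cut i) , (λ i → proj₁ ∘ ∧⁻ {S i}) ,
          subst (λ k → ∣ S ∣ᵐ ≤ 4 * k) (#-filterᵇ S cut (allFin N)) (proj₂ found) ,
          λ {i} {j} si sj e → ⊥-elim (not⁻ (proj₂ (∧⁻ {A (c j a)} (proj₂ (∧⁻ {S j} sj))))
            (subst (λ z → A z ≡ true) e (proj₁ (∧⁻ {A (c i a)} (proj₂ (∧⁻ {S i} si))))))
        where
        found = directed-cut (λ i → c i a) (λ i → c i b) (filterᵇ S (allFin N)) (λ {i} _ e → a≢b (inj-c i e))
        A = proj₁ found
        cut : Fin N → Bool
        cut i = A (c i a) ∧ not (A (c i b))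
  ... | S , _ , le , sep = S , subst (_≤ roles-cost * ∣ S ∣ᵐ) full le ,
    λ {i} {j} {a} {b} → sep (∈-allPairs a b)
    where
    full : ∣ (λ (_ : Fin N) → true) ∣ᵐ ≡ N
    full = trans (#-all _ (allFin N) (λ _ → refl)) (Listₚ.length-tabulate id)

-- Roles that determine each other

-- A connected set of roles, without repetition, in an order that attaches each role to the part
-- built before; inductions follow this order.
data ConnList {m} (H : Graph m) : List (Fin m) → Set where
  one : ∀ v → ConnList H (v ∷ [])
  add : ∀ {v w L} → ConnList H L → w ∈ L → adj H v w ≡ true → v ∉ L → ConnList H (v ∷ L)

connList? : ∀ {m} (H : Graph m) L → Dec (ConnList H L)
connList? H [] = no λ ()
connList? H (v ∷ []) = yes (one v)
connList? H (v ∷ L@(_ ∷ _)) with connList? H L | Any.any? (λ w → ≡true? (adj H v w)) L | member? _≟_ v L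
... | no nc | _ | _ = no λ { (add c _ _ _) → nc c }
... | yes c | no na | _ = no λ { (add _ w∈ a _) → na (lose w∈ a) }
... | yes c | yes _ | yes v∈ = no λ { (add _ _ _ v∉) → v∉ v∈ }
... | yes c | yes an | no v∉ with find an
...   | w , w∈ , a = yes (add c w∈ a v∉)

-- A finite list containing all connected sets of roles, so that tops can be enforced for all of
-- them at a cost depending on `m` only.
listsUpTo : ∀ {m} → ℕ → List (List (Fin m))
listsUpTo zero        = [] ∷ []
listsUpTo {m} (suc k) = [] ∷ concatMap (λ v → map (v ∷_) (listsUpTo k)) (allFin m)

∈-listsUpTo : ∀ {m} k (L : List (Fin m)) → length L ≤ k → L ∈ listsUpTo k
∈-listsUpTo zero    []      _ = here refl
∈-listsUpTo (suc k) []      _ = here refl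
∈-listsUpTo (suc k) (v ∷ L) (s≤s le) = there (∈ₚ.∈-concatMap⁺ (λ v → map (v ∷_) (listsUpTo k))
  (lose (∈ₚ.∈-allFin v) (∈ₚ.∈-map⁺ (v ∷_) (∈-listsUpTo k L le))))

module Family {n} (G : Graph n) (ρ : Rotation G)
  (euler : n + faceCount ρ + isolatedCount G ≡ edgeCount G + 2 * componentCount G)
  {m} (H : Graph m) {N} (c : Fin N → Fin m → Fin n)
  (hom : ∀ i {a b} → adj H a b ≡ true → adj G (c i a) (c i b) ≡ true) where

  Ixs : List (Fin N)
  Ixs = allFin N

  Det : Mask N → Fin m → Fin m → Set
  Det S a b = ∀ {i j} → S i ≡ true → S j ≡ true → c i a ≡ c j a → c i b ≡ c j b

  HasTop : List (Fin m) → Mask N → Set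
  HasTop L S = ConnList H L → ∃ λ t → t ∈ L × (∀ {a} → a ∈ L → Det S a t)

  -- At most six partners, listed as a head and a tail in the form used by `heaviest-fibre`. That
  -- `x` occurs in role `p` makes each removal of `x` shrink the family.
  FewPartners : Mask N → Fin m → Fin m → Set
  FewPartners S p q = ∃ λ x → (∃ λ i → S i ≡ true × c i p ≡ x) ×
    ∃ λ y → ∃ λ ys → length ys ≤ 5 × (∀ {i} → S i ≡ true → c i p ≡ x → c i q ∈ y ∷ ys)

  -- The pairs (c i v , c i t) are the edges of a simple minor of G, obtained by
  -- contracting the roles of L, all of which determine t.
  module LowDegree (S : Mask N) (roles : Roles c S) {L} (conn : ConnList H L) {v t w}
    (t∈L : t ∈ L) (top : ∀ {a} → a ∈ L → Det S a t) (v∉L : v ∉ L) (w∈L : w ∈ L) (vw : adj H v w ≡ true) where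

    private
      v≢t : v ≢ t
      v≢t refl = v∉L t∈L

      samePair : Fin N → Fin N → Bool
      samePair i j = ⌊ c i v ≟ c j v ⌋ ∧ ⌊ c i t ≟ c j t ⌋

      -- Marks one copy, of least index, for every pair (c i v , c i t), so that the edges of the
      -- minor are pairwise distinct.
      isFirst : Fin N → Bool
      isFirst i = S i ∧ all (λ j → not (S j ∧ samePair i j) ∨ ⌊ toℕ i ℕ.≤? toℕ j ⌋) Ixs

      firsts : List (Fin N)
      firsts = filterᵇ isFirst Ixs

      firsts-S : ∀ {i} → i ∈ firsts → S i ≡ true
      firsts-S {i} i∈ = proj₁ (∧⁻ {S i} (proj₂ (∈-filterᵇ⁻ isFirst Ixs i∈)))

      firsts-≤ : ∀ {i j} → i ∈ firsts → S j ≡ true → c i v ≡ c j v → c i t ≡ c j t → toℕ i ≤ toℕ j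
      firsts-≤ {i} {j} i∈ sj e f
        with ∨⁻ {not (S j ∧ samePair i j)} (all⁻ _ Ixs (proj₂ (∧⁻ {S i} (proj₂ (∈-filterᵇ⁻ isFirst Ixs i∈)))) (∈ₚ.∈-allFin j))
      ... | inj₁ h = ⊥-elim (not⁻ h (∧⁺ sj (∧⁺ (⌊⌋⁺ (c i v ≟ c j v) e) (⌊⌋⁺ (c i t ≟ c j t) f))))
      ... | inj₂ h = ⌊⌋⁻ (toℕ i ℕ.≤? toℕ j) h

      firsts-unique : ∀ {i j} → i ∈ firsts → j ∈ firsts → c i v ≡ c j v → c i t ≡ c j t → i ≡ j
      firsts-unique i∈ j∈ e f = Finₚ.toℕ-injective (ℕₚ.≤-antisym
        (firsts-≤ i∈ (firsts-S j∈) e f) (firsts-≤ j∈ (firsts-S i∈) (≡-sym e) (≡-sym f)))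

      first-of : ∀ {i} → S i ≡ true → ∃ λ j → j ∈ firsts × c j v ≡ c i v × c j t ≡ c i t
      first-of {i} si with least (λ j → S j ∧ samePair i j) {i} (∧⁺ si (∧⁺ (⌊⌋⁺ (c i v ≟ c i v) refl) (⌊⌋⁺ (c i t ≟ c i t) refl)))
      ... | j , pj , min with ∧⁻ {S j} pj
      ...   | sj , sp with ∧⁻ {⌊ c i v ≟ c j v ⌋} sp
      ...     | e , f = j , ∈-filterᵇ⁺ isFirst (∈ₚ.∈-allFin j) (∧⁺ sj (all⁺ _ Ixs (λ {k} _ → bound k))) , ≡-sym e' , ≡-sym f'
        where
        e' = ⌊⌋⁻ (c i v ≟ c j v) e
        f' = ⌊⌋⁻ (c i t ≟ c j t) f
        bound : ∀ k → not (S k ∧ samePair j k) ∨ ⌊ toℕ j ℕ.≤? toℕ k ⌋ ≡ true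
        bound k with ≡true? (S k ∧ samePair j k)
        ... | no nh = ∨⁺ˡ (not⁺ nh)
        ... | yes h = let (sk , sp') = ∧⁻ {S k} h ; (e'' , f'') = ∧⁻ {⌊ c j v ≟ c k v ⌋} sp' in
          ∨⁺ʳ {not (S k ∧ samePair j k)} (⌊⌋⁺ (toℕ j ℕ.≤? toℕ k) (min k (∧⁺ sk (∧⁺
            (⌊⌋⁺ (c i v ≟ c k v) (trans e' (⌊⌋⁻ (c j v ≟ c k v) e'')))
            (⌊⌋⁺ (c i t ≟ c k t) (trans f' (⌊⌋⁻ (c j t ≟ c k t) f'')))))))

      Inside : Fin n → Fin N → Fin m → Set
      Inside x i p = S i ≡ true × p ∈ L × c i p ≡ x

      inside? : ∀ x → Dec (∃ λ i → ∃ λ p → Inside x i p)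
      inside? x = Finₚ.any? (λ i → Finₚ.any? (λ p → ≡true? (S i) ×-dec (member? _≟_ p L) ×-dec (c i p ≟ x)))

      -- A vertex with a role in `L` is contracted to the vertex of role `t` in a copy through it.
      -- The choice of copy is immaterial, as every role of `L` determines `t`.
      class : ∀ x → Dec (∃ λ i → ∃ λ p → Inside x i p) → Fin n
      class x (yes (i , _)) = c i t
      class x (no _)        = x

      g : Fin n → Fin n
      g x = class x (inside? x)

      g-inside : ∀ {i p} → S i ≡ true → p ∈ L → g (c i p) ≡ c i t
      g-inside {i} {p} si p∈ = go (inside? (c i p))
        where
        go : ∀ d → class (c i p) d ≡ c i t
        go (no none) = ⊥-elim (none (i , p , si , p∈ , refl))
        go (yes (j , q , sj , q∈ , e)) with roles sj si e
        ... | refl = top p∈ sj si e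

      g-v : ∀ {i} → S i ≡ true → g (c i v) ≡ c i v
      g-v {i} si = go (inside? (c i v))
        where
        go : ∀ d → class (c i v) d ≡ c i v
        go (no _) = refl
        go (yes (j , q , sj , q∈ , e)) with roles sj si e
        ... | refl = ⊥-elim (v∉L q∈)

      -- A genuine edge of `G` which the contraction turns into the pair (c i v , c i t).
      edge : Fin N → Dart n
      edge i = c i v , c i w

      rs : List (Dart n)
      rs = map edge firsts

      roleValues : Fin m → List (Fin n)
      roleValues p = filterᵇ (λ x → any (λ i → S i ∧ ⌊ c i p ≟ x ⌋) Ixs) (allFin n)

      ∈-roleValues⁺ : ∀ p {i} → S i ≡ true → c i p ∈ roleValues p
      ∈-roleValues⁺ p {i} si = ∈-filterᵇ⁺ _ (∈ₚ.∈-allFin _) (any⁺ _ (∈ₚ.∈-allFin i) (∧⁺ si (⌊⌋⁺ (c i p ≟ c i p) refl)))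

      ∈-roleValues⁻ : ∀ p {x} → x ∈ roleValues p → ∃ λ i → S i ≡ true × c i p ≡ x
      ∈-roleValues⁻ p {x} x∈ with any⁻ _ Ixs (proj₂ (∈-filterᵇ⁻ _ (allFin n) x∈))
      ... | i , _ , h with ∧⁻ {S i} h
      ...   | si , e = i , si , ⌊⌋⁻ (c i p ≟ x) e

      rs⁻ : ∀ {d} → d ∈ rs → ∃ λ i → i ∈ firsts × S i ≡ true × d ≡ edge i
      rs⁻ d∈ with ∈ₚ.∈-map⁻ edge d∈
      ... | i , i∈ , e = i , i∈ , firsts-S i∈ , e

      loopless' : ∀ {a b} → (a , b) ∈ rs → g a ≢ g b
      loopless' d∈ e with rs⁻ d∈
      ... | i , _ , si , refl = v≢t (roles si si (trans (≡-sym (g-v si)) (trans e (g-inside si w∈L))))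

      simple' : ∀ {a b a' b'} → (a , b) ∈ rs → (a' , b') ∈ rs → g a ≡ g a' → g b ≡ g b' → (a , b) ≡ (a' , b')
      simple' p q e f with rs⁻ p | rs⁻ q
      ... | i , i∈ , si , refl | j , j∈ , sj , refl = cong edge (firsts-unique i∈ j∈
        (trans (≡-sym (g-v si)) (trans e (g-v sj)))
        (trans (≡-sym (g-inside si w∈L)) (trans f (g-inside sj w∈L))))

      no-reverse' : ∀ {a b a' b'} → (a , b) ∈ rs → (a' , b') ∈ rs → g a ≡ g b' → g b ≡ g a' → ⊥
      no-reverse' p q e f with rs⁻ p | rs⁻ q
      ... | i , i∈ , si , refl | j , j∈ , sj , refl =
        v≢t (roles si sj (trans (≡-sym (g-v si)) (trans e (g-inside sj w∈L))))

      uniq-rs : Unique rs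
      uniq-rs = Unique-map edge firsts (Unique-filterᵇ isFirst (Uniqueₚ.allFin⁺ N))
        (λ i∈ j∈ e → firsts-unique i∈ j∈ (cong proj₁ e) (top w∈L (firsts-S i∈) (firsts-S j∈) (cong proj₂ e)))

      -- Within one copy the vertices with roles in `L` are connected by contracted edges; the
      -- induction follows the order of `K`.
      connected : ∀ (lab : Fin n → Fin n) → (∀ {a b} → adj G a b ≡ true → g a ≡ g b → lab a ≡ lab b) → ∀ {i} → S i ≡ true →
        ∀ {K} → ConnList H K → (∀ {a} → a ∈ K → a ∈ L) → ∀ {p q} → p ∈ K → q ∈ K → lab (c i p) ≡ lab (c i q)
      connected lab h si (one v') sub (here refl) (here refl) = refl
      connected lab h {i} si (add {v'} {w'} cK w'∈ a _) sub p∈ q∈ = trans (to-w p∈) (≡-sym (to-w q∈))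
        where
        to-w : ∀ {p} → p ∈ _ → lab (c i p) ≡ lab (c i w')
        to-w (here refl) = h (hom i a) (trans (g-inside si (sub (here refl))) (≡-sym (g-inside si (sub (there w'∈)))))
        to-w (there p∈') = connected lab h si cK (sub ∘ there) p∈' w'∈

      xs = roleValues v ++ roleValues t

      meets' : ∀ (lab : Fin n → Fin n) → (∀ {a b} → adj G a b ≡ true → g a ≡ g b → lab a ≡ lab b) →
        ∀ {a b} → (a , b) ∈ rs → (∃ λ x → x ∈ xs × lab a ≡ lab x) × (∃ λ x → x ∈ xs × lab b ≡ lab x)
      meets' lab h d∈ with rs⁻ d∈
      ... | i , _ , si , refl = (c i v , ∈ₚ.∈-++⁺ˡ (∈-roleValues⁺ v si) , refl) ,
        (c i t , ∈ₚ.∈-++⁺ʳ (roleValues v) (∈-roleValues⁺ t si) , connected lab h si conn id w∈L t∈L)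

      pairs≤ : length firsts ≤ 3 * (length (roleValues v) + length (roleValues t))
      pairs≤ = begin
        length firsts       ≡⟨ Listₚ.length-map edge firsts ⟨
        length rs           ≤⟨ MinorDensity.minor-density G ρ euler g rs uniq-rs darts' loopless' simple' no-reverse' xs meets' ⟩
        3 * length xs       ≡⟨ cong (3 *_) (Listₚ.length-++ (roleValues v)) ⟩
        3 * (length (roleValues v) + length (roleValues t)) ∎
        where
        open ℕₚ.≤-Reasoning
        darts' : ∀ {d} → d ∈ rs → adjᵈ G d ≡ true
        darts' d∈ with rs⁻ d∈
        ... | i , _ , _ , refl = hom i vw

      degree : Fin m → Fin n → ℕ
      degree p x = # (λ i → ⌊ c i p ≟ x ⌋) firsts

      few : ∀ p q → (∀ {i} → S i ≡ true → ∃ λ j → j ∈ firsts × c j p ≡ c i p × c j q ≡ c i q) →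
        Any (λ x → degree p x ≤ 6) (roleValues p) → FewPartners S p q
      few p q first h with find h
      ... | x , x∈ , deg≤ with ∈-roleValues⁻ p x∈
      ...   | i , si , e = split partners (subst (_≤ 6) (≡-sym (Listₚ.length-map (λ j → c j q) at-x)) deg≤) partner
        where
        at-x = filterᵇ (λ j → ⌊ c j p ≟ x ⌋) firsts
        partners = map (λ j → c j q) at-x
        partner : ∀ {i} → S i ≡ true → c i p ≡ x → c i q ∈ partners
        partner {i} si e with first si
        ... | j , j∈ , e₁ , e₂ = subst (_∈ partners) e₂ (∈ₚ.∈-map⁺ (λ j → c j q)
                (∈-filterᵇ⁺ (λ j → ⌊ c j p ≟ x ⌋) j∈ (⌊⌋⁺ (c j p ≟ x) (trans e₁ e))))
        split : ∀ ps → length ps ≤ 6 → (∀ {i} → S i ≡ true → c i p ≡ x → c i q ∈ ps) → FewPartners S p q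
        split [] _ partner with partner si e
        ... | ()
        split (y ∷ ys) len partner = x , (i , si , e) , y , ys , ℕₚ.≤-pred len , partner

    -- Let U and W count the vertices in roles `v` and `t`, and F the pairs. If all degrees were at
    -- least 7, then 7(U + W) ≤ 2F ≤ 6(U + W), although U is positive.
    low-degree : (∃ λ i → S i ≡ true) → FewPartners S v t ⊎ FewPartners S t v
    low-degree (i₀ , s₀) with Any.any? (λ x → degree v x ℕ.≤? 6) (roleValues v) | Any.any? (λ x → degree t x ℕ.≤? 6) (roleValues t)
    ... | yes h | _ = inj₁ (few v t first-of h)
    ... | no _ | yes h = inj₂ (few t v (λ si → let (j , j∈ , e , f) = first-of si in j , j∈ , f , e) h)
    ... | no nu | no nw = ⊥-elim (ℕₚ.<-irrefl refl (begin-strict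
      6 * (U + W)           <⟨ ℕₚ.*-monoˡ-< (U + W) {{ℕ.>-nonZero (ℕₚ.≤-trans 1≤U (ℕₚ.m≤m+n U W))}} (ℕₚ.n<1+n 6) ⟩
      7 * (U + W)           ≡⟨ ℕₚ.*-distribˡ-+ 7 U W ⟩
      7 * U + 7 * W         ≤⟨ ℕₚ.+-mono-≤ (many v nu) (many t nw) ⟩
      F + F                 ≤⟨ ℕₚ.+-mono-≤ pairs≤ pairs≤ ⟩
      3 * (U + W) + 3 * (U + W) ≡⟨ double (U + W) ⟩
      6 * (U + W)           ∎))
      where
      open ℕₚ.≤-Reasoning
      U = length (roleValues v)
      W = length (roleValues t)
      F = length firsts
      double : ∀ a → 3 * a + 3 * a ≡ 6 * a
      double = solve-∀
      1≤U : 1 ≤ U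
      1≤U = #-pos _ (allFin n) (∈ₚ.∈-allFin (c i₀ v)) (any⁺ _ (∈ₚ.∈-allFin i₀) (∧⁺ s₀ (⌊⌋⁺ (c i₀ v ≟ c i₀ v) refl)))
      many : ∀ p → ¬ Any (λ x → degree p x ≤ 6) (roleValues p) → 7 * length (roleValues p) ≤ F
      many p none = fibres-≤ _≟_ (λ i → c i p) 7 (roleValues p) firsts (Unique-filterᵇ _ (Uniqueₚ.allFin⁺ n))
        (λ x∈ → ℕₚ.≰⇒> (λ le → none (lose x∈ le)))

  Det-mono : ∀ {S S' a b} → S' ⊑ᵐ S → Det S a b → Det S' a b
  Det-mono sub d si sj = d (sub _ si) (sub _ sj)

  Roles-mono : ∀ {S S'} → S' ⊑ᵐ S → Roles c S → Roles c S'
  Roles-mono sub r si sj = r (sub _ si) (sub _ sj)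

  HasTop-mono : ∀ {L S S'} → S' ⊑ᵐ S → HasTop L S → HasTop L S'
  HasTop-mono sub h conn with h conn
  ... | t , t∈ , d = t , t∈ , λ a∈ → Det-mono sub (d a∈)

  avoid : Mask N → Fin m → Fin n → Mask N
  avoid S p x i = S i ∧ not ⌊ c i p ≟ x ⌋

  -- Keep, among the copies with x in role p, those with the commonest partner in role q.
  absorb : ∀ S p q → (few : FewPartners S p q) → ∀ O → O ⊑ᵐ avoid S p (proj₁ few) → Det O p q →
    ∃ λ O' → O' ⊑ᵐ S × Det O' p q × # (λ i → S i ∧ ⌊ c i p ≟ proj₁ few ⌋) Ixs + 6 * ∣ O ∣ᵐ ≤ 6 * ∣ O' ∣ᵐ
  absorb S p q (x , _ , y₀ , ys , ys≤5 , partner) O O⊑ detO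
    with heaviest-fibre _≟_ (λ i → c i q) (λ i → S i ∧ ⌊ c i p ≟ x ⌋) Ixs y₀ ys
           (λ {i} _ h → let (si , e) = ∧⁻ {S i} h in partner si (⌊⌋⁻ (c i p ≟ x) e))
  ... | y , le = O' , sub , det , bound
    where
    B : Mask N
    B i = (S i ∧ ⌊ c i p ≟ x ⌋) ∧ ⌊ c i q ≟ y ⌋
    O' : Mask N
    O' i = B i ∨ O i
    B⁻ : ∀ {i} → B i ≡ true → S i ≡ true × c i p ≡ x × c i q ≡ y
    B⁻ {i} h with ∧⁻ {S i ∧ ⌊ c i p ≟ x ⌋} h
    ... | h₁ , h₂ with ∧⁻ {S i} h₁
    ...   | si , h₃ = si , ⌊⌋⁻ (c i p ≟ x) h₃ , ⌊⌋⁻ (c i q ≟ y) h₂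
    O⁻ : ∀ {i} → O i ≡ true → S i ≡ true × c i p ≢ x
    O⁻ {i} h with ∧⁻ {S i} (O⊑ i h)
    ... | si , ne = si , λ e → not⁻ ne (⌊⌋⁺ (c i p ≟ x) e)
    sub : O' ⊑ᵐ S
    sub i h with ∨⁻ {B i} h
    ... | inj₁ b = proj₁ (B⁻ {i} b)
    ... | inj₂ o = proj₁ (O⁻ {i} o)
    -- The copies in `B` have `x` in role `p` and those in `O` avoid it, so the two parts never have
    -- to agree.
    det : Det O' p q
    det {i} {j} hi hj e with ∨⁻ {B i} hi | ∨⁻ {B j} hj
    ... | inj₁ bi | inj₁ bj = trans (proj₂ (proj₂ (B⁻ {i} bi))) (≡-sym (proj₂ (proj₂ (B⁻ {j} bj))))
    ... | inj₁ bi | inj₂ oj = ⊥-elim (proj₂ (O⁻ {j} oj) (trans (≡-sym e) (proj₁ (proj₂ (B⁻ {i} bi)))))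
    ... | inj₂ oi | inj₁ bj = ⊥-elim (proj₂ (O⁻ {i} oi) (trans e (proj₁ (proj₂ (B⁻ {j} bj)))))
    ... | inj₂ oi | inj₂ oj = detO oi oj e
    bound : # (λ i → S i ∧ ⌊ c i p ≟ x ⌋) Ixs + 6 * ∣ O ∣ᵐ ≤ 6 * ∣ O' ∣ᵐ
    bound = begin
      # (λ i → S i ∧ ⌊ c i p ≟ x ⌋) Ixs + 6 * ∣ O ∣ᵐ ≤⟨ ℕₚ.+-monoˡ-≤ (6 * ∣ O ∣ᵐ) (ℕₚ.≤-trans le (ℕₚ.*-monoˡ-≤ ∣ B ∣ᵐ (s≤s ys≤5))) ⟩
      6 * ∣ B ∣ᵐ + 6 * ∣ O ∣ᵐ ≡⟨ ℕₚ.*-distribˡ-+ 6 ∣ B ∣ᵐ ∣ O ∣ᵐ ⟨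
      6 * (∣ B ∣ᵐ + ∣ O ∣ᵐ)   ≡⟨ cong (6 *_) (#-disjoint-∨ B O Ixs (λ i b o → proj₂ (O⁻ {i} o) (proj₁ (proj₂ (B⁻ {i} b))))) ⟨
      6 * ∣ O' ∣ᵐ ∎
      where open ℕₚ.≤-Reasoning

  avoid-smaller : ∀ S p q (few : FewPartners S p q) {k} → ∣ S ∣ᵐ ≤ suc k → ∣ avoid S p (proj₁ few) ∣ᵐ ≤ k
  avoid-smaller S p q (x , (i , si , e) , _) {k} le = ℕₚ.≤-pred (begin
    suc ∣ avoid S p x ∣ᵐ          ≤⟨ ℕₚ.+-monoˡ-≤ _ (#-pos (λ i → S i ∧ ⌊ c i p ≟ x ⌋) Ixs (∈ₚ.∈-allFin i) (∧⁺ si (⌊⌋⁺ (c i p ≟ x) e))) ⟩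
    # (λ i → S i ∧ ⌊ c i p ≟ x ⌋) Ixs + ∣ avoid S p x ∣ᵐ ≡⟨ #-split S (λ i → ⌊ c i p ≟ x ⌋) Ixs ⟨
    ∣ S ∣ᵐ                        ≤⟨ le ⟩
    suc k                         ∎)
    where open ℕₚ.≤-Reasoning

  module _ {L} (conn : ConnList H L) {v t w} (t∈L : t ∈ L) (v∉L : v ∉ L) (w∈L : w ∈ L) (vw : adj H v w ≡ true) where

    Oriented : Mask N → Set
    Oriented S = ∃ λ O₁ → ∃ λ O₂ → O₁ ⊑ᵐ S × O₂ ⊑ᵐ S × Det O₁ v t × Det O₂ t v × ∣ S ∣ᵐ ≤ 6 * ∣ O₁ ∣ᵐ + 6 * ∣ O₂ ∣ᵐ

    own-v : ∀ S (few : FewPartners S v t) → Oriented (avoid S v (proj₁ few)) → Oriented S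
    own-v S few (O₁ , O₂ , sub₁ , sub₂ , d₁ , d₂ , le) =
      finish (absorb S v t few O₁ sub₁ d₁)
      where
      open ℕₚ.≤-Reasoning
      x = proj₁ few
      A = # (λ i → S i ∧ ⌊ c i v ≟ x ⌋) Ixs
      finish : (∃ λ O' → O' ⊑ᵐ S × Det O' v t × A + 6 * ∣ O₁ ∣ᵐ ≤ 6 * ∣ O' ∣ᵐ) → Oriented S
      finish (O' , sub' , d' , le') = O' , O₂ , sub' , (λ i → proj₁ ∘ ∧⁻ {S i} ∘ sub₂ i) , d' , d₂ , (begin
        ∣ S ∣ᵐ                                 ≡⟨ #-split S (λ i → ⌊ c i v ≟ x ⌋) Ixs ⟩
        A + ∣ avoid S v x ∣ᵐ                   ≤⟨ ℕₚ.+-monoʳ-≤ A le ⟩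
        A + (6 * ∣ O₁ ∣ᵐ + 6 * ∣ O₂ ∣ᵐ)        ≡⟨ ℕₚ.+-assoc A _ _ ⟨
        A + 6 * ∣ O₁ ∣ᵐ + 6 * ∣ O₂ ∣ᵐ          ≤⟨ ℕₚ.+-monoˡ-≤ _ le' ⟩
        6 * ∣ O' ∣ᵐ + 6 * ∣ O₂ ∣ᵐ              ∎)

    own-t : ∀ S (few : FewPartners S t v) → Oriented (avoid S t (proj₁ few)) → Oriented S
    own-t S few (O₁ , O₂ , sub₁ , sub₂ , d₁ , d₂ , le) =
      finish (absorb S t v few O₂ sub₂ d₂)
      where
      open ℕₚ.≤-Reasoning
      x = proj₁ few
      A = # (λ i → S i ∧ ⌊ c i t ≟ x ⌋) Ixs
      shuffle : ∀ a b d → a + (b + d) ≡ b + (a + d)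
      shuffle = solve-∀
      finish : (∃ λ O' → O' ⊑ᵐ S × Det O' t v × A + 6 * ∣ O₂ ∣ᵐ ≤ 6 * ∣ O' ∣ᵐ) → Oriented S
      finish (O' , sub' , d' , le') = O₁ , O' , (λ i → proj₁ ∘ ∧⁻ {S i} ∘ sub₁ i) , sub' , d₁ , d' , (begin
        ∣ S ∣ᵐ                                 ≡⟨ #-split S (λ i → ⌊ c i t ≟ x ⌋) Ixs ⟩
        A + ∣ avoid S t x ∣ᵐ                   ≤⟨ ℕₚ.+-monoʳ-≤ A le ⟩
        A + (6 * ∣ O₁ ∣ᵐ + 6 * ∣ O₂ ∣ᵐ)        ≡⟨ shuffle A (6 * ∣ O₁ ∣ᵐ) (6 * ∣ O₂ ∣ᵐ) ⟩
        6 * ∣ O₁ ∣ᵐ + (A + 6 * ∣ O₂ ∣ᵐ)        ≤⟨ ℕₚ.+-monoʳ-≤ (6 * ∣ O₁ ∣ᵐ) le' ⟩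
        6 * ∣ O₁ ∣ᵐ + 6 * ∣ O' ∣ᵐ              ∎)

    -- A vertex with at most six partners is removed again and again. Its copies join `O₁` or `O₂`
    -- according to its role, after keeping the commonest partner; `k` bounds the number of rounds.
    degeneracy : ∀ k S → ∣ S ∣ᵐ ≤ k → Roles c S → (∀ {a} → a ∈ L → Det S a t) → Oriented S
    degeneracy k S size roles top = by-emptiness k size (∣ S ∣ᵐ ℕ.≟ 0)
      where
      by-emptiness : ∀ k → ∣ S ∣ᵐ ≤ k → Dec (∣ S ∣ᵐ ≡ 0) → Oriented S
      by-emptiness k size (yes z) =
        (λ _ → false) , (λ _ → false) , (λ _ ()) , (λ _ ()) , (λ ()) , (λ ()) , ℕₚ.≤-trans (ℕₚ.≤-reflexive z) z≤n
      by-emptiness zero size (no nz) = ⊥-elim (nz (ℕₚ.n≤0⇒n≡0 size))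
      by-emptiness (suc k) size (no nz) =
        [ (λ few → own-v S few (rest v t few)) , (λ few → own-t S few (rest t v few)) ]′
          (LowDegree.low-degree S roles conn t∈L top v∉L w∈L vw (let (i , _ , si) = #-pos⁻ S Ixs (ℕₚ.n≢0⇒n>0 nz) in i , si))
        where
        rest : ∀ p q (few : FewPartners S p q) → Oriented (avoid S p (proj₁ few))
        rest p q few = degeneracy k (avoid S p (proj₁ few)) (avoid-smaller S p q few size)
          (Roles-mono (λ i → proj₁ ∘ ∧⁻ {S i}) roles) (λ a∈ → Det-mono (λ i → proj₁ ∘ ∧⁻ {S i}) (top a∈))

    orient : ∀ S → Roles c S → (∀ {a} → a ∈ L → Det S a t) →
      ∃ λ S' → S' ⊑ᵐ S × ∣ S ∣ᵐ ≤ 12 * ∣ S' ∣ᵐ × (Det S' v t ⊎ Det S' t v)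
    orient S roles top with degeneracy ∣ S ∣ᵐ S ℕₚ.≤-refl roles top
    ... | O₁ , O₂ , sub₁ , sub₂ , d₁ , d₂ , le with ℕₚ.≤-total ∣ O₁ ∣ᵐ ∣ O₂ ∣ᵐ
    ...   | inj₁ h = O₂ , sub₂ , ℕₚ.≤-trans le (ℕₚ.≤-trans (ℕₚ.+-monoˡ-≤ _ (ℕₚ.*-monoʳ-≤ 6 h)) (ℕₚ.≤-reflexive (double ∣ O₂ ∣ᵐ))) , inj₂ d₂
      where
      double : ∀ a → 6 * a + 6 * a ≡ 12 * a
      double = solve-∀
    ...   | inj₂ h = O₁ , sub₁ , ℕₚ.≤-trans le (ℕₚ.≤-trans (ℕₚ.+-monoʳ-≤ (6 * ∣ O₁ ∣ᵐ) (ℕₚ.*-monoʳ-≤ 6 h)) (ℕₚ.≤-reflexive (double ∣ O₁ ∣ᵐ))) , inj₁ d₁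
      where
      double : ∀ a → 6 * a + 6 * a ≡ 12 * a
      double = solve-∀

  -- Let `t` be the top of `L` and attach `v`. If `v` determines `t`, then `t` stays the top; if `t`
  -- determines `v`, then by transitivity `v` is the new top.
  ensure-top : ∀ L S → Roles c S → ∃ λ S' → S' ⊑ᵐ S × ∣ S ∣ᵐ ≤ 12 ^ length L * ∣ S' ∣ᵐ × HasTop L S'
  ensure-top [] S roles = S , (λ _ → id) , ℕₚ.≤-reflexive (≡-sym (ℕₚ.+-identityʳ _)) , λ ()
  ensure-top (v ∷ L) S roles with connList? H (v ∷ L)
  ... | no nc = S , (λ _ → id) , ℕₚ.m≤n*m _ (12 ^ length (v ∷ L)) {{ℕₚ.m^n≢0 12 (length (v ∷ L))}} , λ conn → ⊥-elim (nc conn)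
  ... | yes (one .v) = S , (λ _ → id) , ℕₚ.m≤n*m _ 12 , λ _ → v , here refl , λ { (here refl) _ _ e → e }
  ... | yes (add {w = w} conn w∈ vw v∉) with ensure-top L S roles
  ...   | S₁ , sub₁ , le₁ , tops with tops conn
  ...     | t , t∈ , top with orient conn t∈ v∉ w∈ vw S₁ (Roles-mono sub₁ roles) top
  ...       | S₂ , sub₂ , le₂ , d = S₂ , (λ i → sub₁ i ∘ sub₂ i) , size , λ _ → newTop d
    where
    size : ∣ S ∣ᵐ ≤ 12 * 12 ^ length L * ∣ S₂ ∣ᵐ
    size = ℕₚ.≤-trans le₁ (ℕₚ.≤-trans (ℕₚ.*-monoʳ-≤ (12 ^ length L) le₂) (ℕₚ.≤-reflexive (shuffle (12 ^ length L) ∣ S₂ ∣ᵐ)))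
      where
      shuffle : ∀ a b → a * (12 * b) ≡ 12 * a * b
      shuffle = solve-∀
    newTop : Det S₂ v t ⊎ Det S₂ t v → ∃ λ t' → t' ∈ v ∷ L × (∀ {a} → a ∈ v ∷ L → Det S₂ a t')
    newTop (inj₁ vt) = t , there t∈ , λ { (here refl) → vt ; (there a∈) → Det-mono sub₂ (top a∈) }
    newTop (inj₂ tv) = v , here refl , λ { (here refl) _ _ e → e ; (there a∈) si sj e → tv si sj (Det-mono sub₂ (top a∈) si sj e) }

  tops-cost : ℕ
  tops-cost = costs (λ L → 12 ^ length L) (listsUpTo {m} m)

  ensure-tops : ∀ S → Roles c S → ∃ λ S' → S' ⊑ᵐ S × ∣ S ∣ᵐ ≤ tops-cost * ∣ S' ∣ᵐ × (∀ {L} → length L ≤ m → HasTop L S')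
  ensure-tops S roles with shrink-all HasTop (λ L → 12 ^ length L) (Roles c) HasTop-mono Roles-mono
                             (λ L S r → ensure-top L S r) (listsUpTo m) S roles
  ... | S' , sub , le , tops = S' , sub , le , λ {L} len → tops (∈-listsUpTo m L len)

-- Edge-disjoint copies in a far graph

-- Functions are enumerated by their values and recovered only up to pointwise equality, which `P`
-- therefore has to respect.
anyFunction? : ∀ k {n} (P : (Fin k → Fin n) → Set) → (∀ f → Dec (P f)) →
  (∀ {f g} → (∀ i → f i ≡ g i) → P f → P g) → Dec (∃ P)
anyFunction? zero    P P? ext = map′ (empty ,_) (λ { (f , p) → ext {f} {empty} (λ ()) p }) (P? empty)
  where
  empty : Fin 0 → Fin _
  empty ()
anyFunction? (suc k) {n} P P? ext = map′ (λ { (x , f , p) → consᶠ x f , p }) (λ { (f , p) → f zero , (f ∘ suc) , ext (λ { zero → refl ; (suc i) → refl }) p })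
  (Finₚ.any? (λ x → anyFunction? k (P ∘ consᶠ x) (P? ∘ consᶠ x) (λ h → ext (λ { zero → refl ; (suc i) → h i }))))
  where
  consᶠ : Fin n → (Fin k → Fin n) → Fin (suc k) → Fin n
  consᶠ x f zero    = x
  consᶠ x f (suc i) = f i

copy? : ∀ {k n} (H : Graph k) (G : Graph n) → Dec (CopyOf H G)
copy? {k} {n} H G = map′ (λ { (f , i , e) → f , (λ {a} {b} → i a b) , e }) (λ { (f , i , e) → f , (λ a b → i) , e })
  (anyFunction? k (λ f → (∀ a b → f a ≡ f b → a ≡ b) × (∀ a b → adj H a b ≡ true → adj G (f a) (f b) ≡ true))
    (λ f → Finₚ.all? (λ a → Finₚ.all? (λ b → (f a ≟ f b) →-dec (a ≟ b))) ×-dec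
           Finₚ.all? (λ a → Finₚ.all? (λ b → ≡true? (adj H a b) →-dec ≡true? (adj G (f a) (f b)))))
    (λ h (i , e) → (λ a b q → i a b (trans (h a) (trans q (≡-sym (h b))))) ,
                   (λ a b q → subst (_≡ true) (cong₂ (adj G) (h a) (h b)) (e a b q))))

module _ {m} (H : Graph m) {n : ℕ} where

  Used : (Fin m → Fin n) → Fin n → Fin n → Set
  Used f i j = ∃ λ a → ∃ λ b → adj H a b ≡ true × f a ≡ i × f b ≡ j

  used? : ∀ f i j → Dec (Used f i j)
  used? f i j = Finₚ.any? (λ a → Finₚ.any? (λ b → ≡true? (adj H a b) ×-dec (f a ≟ i) ×-dec (f b ≟ j)))

  deleteCopy : Graph n → (Fin m → Fin n) → Graph n
  deleteCopy G f = record
    { adj    = λ i j → adj G i j ∧ not ⌊ used? f i j ⌋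
    ; sym    = λ i j → cong₂ (λ p q → p ∧ not q) (sym G i j) (⌊⌋-cong (used? f i j) (used? f j i) turn turn)
    ; irrefl = λ i → cong (_∧ not ⌊ used? f i i ⌋) (irrefl G i) }
    where
    turn : ∀ {i j} → Used f i j → Used f j i
    turn (a , b , h , p , q) = b , a , trans (sym H b a) h , q , p

  deleteCopy⁻ : ∀ G f {i j} → adj (deleteCopy G f) i j ≡ true → adj G i j ≡ true × ¬ Used f i j
  deleteCopy⁻ G f {i} {j} h with ∧⁻ {adj G i j} h
  ... | a , u = a , λ used → not⁻ u (⌊⌋⁺ (used? f i j) used)

  deleteCopy-loses : ∀ G f → edgeCount G ≤ edgeCount (deleteCopy G f) + length (allPairs m)
  deleteCopy-loses G f = begin
    edgeCount G                          ≡⟨ #-partition (λ p → ⌊ used? f (proj₁ p) (proj₂ p) ⌋) (edgesOf G) ⟩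
    # isUsed es + # (not ∘ isUsed) es    ≡⟨ ℕₚ.+-comm (# isUsed es) _ ⟩
    # (not ∘ isUsed) es + # isUsed es    ≤⟨ ℕₚ.+-mono-≤ kept lost ⟩
    edgeCount (deleteCopy G f) + length (allPairs m) ∎
    where
    open ℕₚ.≤-Reasoning
    es = edgesOf G
    isUsed : Dart n → Bool
    isUsed (i , j) = ⌊ used? f i j ⌋
    kept : # (not ∘ isUsed) es ≤ edgeCount (deleteCopy G f)
    kept = Unique-⊆⇒length≤ {ys = edgesOf (deleteCopy G f)} (Unique-filterᵇ (not ∘ isUsed) (Unique-edgesOf G)) (λ {d} d∈ →
      let (d∈es , nu) = ∈-filterᵇ⁻ (not ∘ isUsed) es d∈
          (a , lt) = ∧⁻ {adjᵈ G d} (proj₂ (∈-filterᵇ⁻ (isEdge G) (allPairs n) d∈es))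
      in ∈-filterᵇ⁺ (isEdge (deleteCopy G f)) (∈-allPairs _ _) (∧⁺ (∧⁺ a nu) lt))
    image : Fin m × Fin m → Dart n
    image (a , b) = f a , f b
    lost : # isUsed es ≤ length (allPairs m)
    lost = ℕₚ.≤-trans (Unique-⊆⇒length≤ {ys = map image (allPairs m)} (Unique-filterᵇ isUsed (Unique-edgesOf G)) into)
      (ℕₚ.≤-reflexive (Listₚ.length-map image (allPairs m)))
      where
      into : ∀ {d} → d ∈ filterᵇ isUsed es → d ∈ map image (allPairs m)
      into {i , j} d∈ with ⌊⌋⁻ (used? f i j) (proj₂ (∈-filterᵇ⁻ isUsed es d∈))
      ... | a , b , _ , refl , refl = ∈ₚ.∈-map⁺ image (∈-allPairs a b)

  deleteCopy-smaller : ∀ G f {a b} → adj H a b ≡ true → adj G (f a) (f b) ≡ true →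
    edgeCount (deleteCopy G f) ℕ.< edgeCount G
  deleteCopy-smaller G f {a} {b} hab gab = Unique-⊆⇒length≤ {xs = e ∷ edgesOf G'}
    (All.tabulate (λ {d} d∈ e≡d → not-there (subst (_∈ edgesOf G') (≡-sym e≡d) d∈)) ∷ Unique-edgesOf G') into
    where
    G' = deleteCopy G f
    e = canonical (f a , f b)
    not-there : ¬ e ∈ edgesOf G'
    not-there e∈ = canonical-elim (λ d → adjᵈ G' d ≡ true → ⊥) (f a , f b)
      (λ h → proj₂ (deleteCopy⁻ G f h) (a , b , hab , refl , refl))
      (λ h → proj₂ (deleteCopy⁻ G f h) (b , a , trans (sym H b a) hab , refl , refl))
      (∈-edgesOf⁻ G' e∈)
    into : ∀ {d} → d ∈ e ∷ edgesOf G' → d ∈ edgesOf G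
    into (here refl) = canonical-∈ G (f a , f b) gab
    into {d} (there d∈) with ∧⁻ {adjᵈ G' d} (proj₂ (∈-filterᵇ⁻ (isEdge G') (allPairs n) d∈))
    ... | a' , lt = ∈-filterᵇ⁺ (isEdge G) (∈-allPairs _ _) (∧⁺ (proj₁ (deleteCopy⁻ G f a')) lt)

  EdgeDisjoint : ∀ {N} → (Fin N → Fin m → Fin n) → Set
  EdgeDisjoint c = ∀ {i j a b a' b'} → adj H a b ≡ true → adj H a' b' ≡ true →
    c i a ≡ c j a' → c i b ≡ c j b' → i ≡ j

  record DisjointCopies (G : Graph n) : Set where
    field
      N         : ℕ
      c         : Fin N → Fin m → Fin n
      injective : ∀ i → Injective _≡_ _≡_ (c i)
      hom       : ∀ i {a b} → adj H a b ≡ true → adj G (c i a) (c i b) ≡ true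
      disjoint  : EdgeDisjoint c
      rest      : Graph n
      rest⊑     : rest ⊑ G
      rest-free : Free H rest
      loss      : edgeCount G ≤ edgeCount rest + N * length (allPairs m)

  -- Greedy deletion. The edge `a₀` `b₀` of `H` makes every deletion remove an edge, so the edge
  -- count serves as fuel.
  disjointCopies : ∀ {a₀ b₀} → adj H a₀ b₀ ≡ true → ∀ fuel G → edgeCount G ≤ fuel → DisjointCopies G
  disjointCopies {a₀} {b₀} h₀ fuel G le with copy? H G
  ... | no none = record { N = 0 ; c = λ () ; injective = λ () ; hom = λ () ; disjoint = λ {}
    ; rest = G ; rest⊑ = λ _ _ → id ; rest-free = none ; loss = ℕₚ.m≤m+n _ _ }
  disjointCopies {a₀} {b₀} h₀ zero G le | yes (f , _ , e) =
    ⊥-elim (ℕₚ.n≮0 (ℕₚ.<-≤-trans (deleteCopy-smaller G f h₀ (e a₀ b₀ h₀)) le))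
  disjointCopies {a₀} {b₀} h₀ (suc fuel) G le | yes (f , i , e) = record
    { N = suc D.N ; c = c' ; injective = inj' ; hom = hom' ; disjoint = disj
    ; rest = D.rest ; rest⊑ = λ x y h → proj₁ (deleteCopy⁻ G f (D.rest⊑ x y h)) ; rest-free = D.rest-free
    ; loss = begin
        edgeCount G                              ≤⟨ deleteCopy-loses G f ⟩
        edgeCount G' + P                         ≤⟨ ℕₚ.+-monoˡ-≤ P D.loss ⟩
        (edgeCount D.rest + D.N * P) + P         ≡⟨ shuffle (edgeCount D.rest) (D.N * P) P ⟩
        edgeCount D.rest + (P + D.N * P)         ∎ }
    where
    open ℕₚ.≤-Reasoning
    P = length (allPairs m)
    G' = deleteCopy G f
    module D = DisjointCopies (disjointCopies h₀ fuel G'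
      (ℕₚ.≤-pred (ℕₚ.≤-trans (deleteCopy-smaller G f h₀ (e a₀ b₀ h₀)) le)))
    shuffle : ∀ a b c → (a + b) + c ≡ a + (c + b)
    shuffle = solve-∀
    c' : Fin (suc D.N) → Fin m → Fin n
    c' zero    = f
    c' (suc j) = D.c j
    inj' : ∀ j → Injective _≡_ _≡_ (c' j)
    inj' zero    = i
    inj' (suc j) = D.injective j
    hom' : ∀ j {a b} → adj H a b ≡ true → adj G (c' j a) (c' j b) ≡ true
    hom' zero    h = e _ _ h
    hom' (suc j) h = proj₁ (deleteCopy⁻ G f (D.hom j h))
    clash : ∀ j {a b a' b'} → adj H a b ≡ true → adj H a' b' ≡ true → f a ≡ D.c j a' → f b ≡ D.c j b' → ⊥
    clash j h h' p q = proj₂ (deleteCopy⁻ G f (D.hom j h')) (_ , _ , h , p , q)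
    disj : EdgeDisjoint c'
    disj {zero}  {zero}  h h' p q = refl
    disj {zero}  {suc j} h h' p q = ⊥-elim (clash j h h' p q)
    disj {suc j} {zero}  h h' p q = ⊥-elim (clash j h' h (≡-sym p) (≡-sym q))
    disj {suc j} {suc k} h h' p q = cong suc (D.disjoint h h' p q)

-- A positive `ε` is at least the reciprocal of its denominator; with this coarser bound the
-- counting takes place in the natural numbers.
far⇒< : ∀ ε → 0ℚᵘ < ε → ∀ n D → ε ℚ.* ℕ→ℚ n < ℕ→ℚ D → n ℕ.< D * ℚ.↧ₙ ε
far⇒< (ℚ.mkℚᵘ (ℤ.+ zero) d) (ℚ.*<* (ℤ.+<+ ())) n D far
far⇒< (ℚ.mkℚᵘ (ℤ.+ suc p) d) pos n D (ℚ.*<* lt) = ℕₚ.≤-<-trans (ℕₚ.m≤n*m n (suc p))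
  (subst₂ ℕ._<_ (ℕₚ.*-identityʳ _) (cong (D *_) (ℕₚ.*-identityʳ _))
    (ℤₚ.drop‿+<+ (subst₂ ℤ._<_ lhs (≡-sym (ℤₚ.pos-* D (suc d * 1))) lt)))
  where
  lhs : (ℤ.+ suc p ℤ.* ℤ.+ n) ℤ.* ℤ.+ 1 ≡ ℤ.+ (suc p * n * 1)
  lhs = trans (cong (ℤ._* ℤ.+ 1) (≡-sym (ℤₚ.pos-* (suc p) n))) (≡-sym (ℤₚ.pos-* (suc p * n) 1))
far⇒< (ℚ.mkℚᵘ ℤ.-[1+ p ] d) (ℚ.*<* ()) n D far

-- Farness applied to the `H`-free remainder: more than ε n edges are gone, and each copy accounts
-- for at most m * m of them.
many-copies : ∀ {m n} (H : Graph m) (G : Graph n) ε → 0ℚᵘ < ε → Far ε H G → (D : DisjointCopies H G) →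
  n ℕ.< DisjointCopies.N D * length (allPairs m) * ℚ.↧ₙ ε
many-copies {m} {n} H G ε pos far D = ℕₚ.<-≤-trans
  (far⇒< ε pos n (edgeCount G ∸ edgeCount rest) (far rest rest⊑ rest-free))
  (ℕₚ.*-monoˡ-≤ (ℚ.↧ₙ ε) (ℕₚ.m≤n+o⇒m∸n≤o (edgeCount G) (edgeCount rest) {N * length (allPairs m)} loss))
  where open DisjointCopies D

length-cartesianProduct : ∀ {A B : Set} (xs : List A) (ys : List B) → length (cartesianProduct xs ys) ≡ length xs * length ys
length-cartesianProduct []       ys = refl
length-cartesianProduct (x ∷ xs) ys = trans (Listₚ.length-++ (map (x ,_) ys))
  (cong₂ _+_ (Listₚ.length-map (x ,_) ys) (length-cartesianProduct xs ys))

length-darts≤ : ∀ {n} (G : Graph n) → length (darts G) ≤ 2 * edgeCount G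
length-darts≤ {n} G = begin
  length (darts G)                  ≤⟨ Unique-⊆⇒length≤ (Unique-filterᵇ _ (Unique-allPairs n)) into ⟩
  length (es ++ map flip es)        ≡⟨ Listₚ.length-++ es ⟩
  length es + length (map flip es)  ≡⟨ cong (λ k → length es + k) (trans (Listₚ.length-map flip es) (≡-sym (ℕₚ.+-identityʳ _))) ⟩
  2 * edgeCount G                   ∎
  where
  open ℕₚ.≤-Reasoning
  es = edgesOf G
  into : ∀ {d} → d ∈ darts G → d ∈ es ++ map flip es
  into {d} d∈ with canonical-∈ G d (proj₂ (∈-filterᵇ⁻ _ (allPairs n) d∈)) | canonical-cases d
  ... | c∈ | inj₁ e = ∈ₚ.∈-++⁺ˡ (subst (_∈ es) e c∈)
  ... | c∈ | inj₂ e = ∈ₚ.∈-++⁺ʳ es (∈ₚ.∈-map⁺ flip (subst (_∈ es) e c∈))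

-- Discarding vertices of large degree

degree : ∀ {n} → Graph n → Fin n → ℕ
degree G x = length (neighbours G x)

module Cleanup {n} (G : Graph n) {N m} (c : Fin N → Fin m → Fin n) (M : ℕ) where

  at : Mask N → Fin n → Fin m → Mask N
  at S x a i = S i ∧ ⌊ c i a ≟ x ⌋

  Dense : Mask N → Set
  Dense S = ∀ {i} a → S i ≡ true → degree G (c i a) ≤ M * ∣ at S (c i a) a ∣ᵐ

  private
    -- A pair of vertex and role still occurring in `S` is counted once per dart leaving the vertex,
    -- so `act` is a sum of degrees and serves as a potential.
    active : Mask N → Dart n × Fin m → Bool
    active S ((x , _) , a) = any (at S x a) (allFin N)

    triples : List (Dart n × Fin m)
    triples = cartesianProduct (darts G) (allFin m)

    act : Mask N → ℕ
    act S = # (active S) triples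

    removed : Mask N → Fin n → Fin m → Mask N
    removed S x a i = S i ∧ not ⌊ c i a ≟ x ⌋

    act-drop : ∀ S x a → (∃ λ i → at S x a i ≡ true) → degree G x + act (removed S x a) ≤ act S
    act-drop S x a (i , ai) = begin
      degree G x + act S'                      ≤⟨ ℕₚ.+-monoˡ-≤ (act S') deg≤ ⟩
      # here? triples + act S'                 ≡⟨ #-disjoint-∨ here? (active S') triples disjoint ⟨
      # (λ t → here? t ∨ active S' t) triples  ≤⟨ #-mono _ (active S) triples (λ {t} _ → merge {t}) ⟩
      act S                                    ∎
      where
      open ℕₚ.≤-Reasoning
      S' = removed S x a
      here? : Dart n × Fin m → Bool
      here? ((y , _) , b) = ⌊ y ≟ x ⌋ ∧ ⌊ b ≟ a ⌋
      deg≤ : degree G x ≤ # here? triples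
      deg≤ = injection⇒length≤ (λ y → (x , y) , a) (neighbours G x) (filterᵇ here? triples)
        (Unique-filterᵇ _ (Uniqueₚ.allFin⁺ n)) (λ _ _ → cong (proj₂ ∘ proj₁))
        (λ {y} y∈ → ∈-filterᵇ⁺ here? (∈ₚ.∈-cartesianProduct⁺
            (∈-filterᵇ⁺ (λ p → adj G (proj₁ p) (proj₂ p)) (∈-allPairs x y) (proj₂ (∈-filterᵇ⁻ (adj G x) (allFin n) y∈))) (∈ₚ.∈-allFin a))
          (∧⁺ (⌊⌋⁺ (x ≟ x) refl) (⌊⌋⁺ (a ≟ a) refl)))
      disjoint : ∀ t → here? t ≡ true → active S' t ≡ true → ⊥
      disjoint ((y , _) , b) h h' with ∧⁻ {⌊ y ≟ x ⌋} h
      ... | p , q with ⌊⌋⁻ (y ≟ x) p | ⌊⌋⁻ (b ≟ a) q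
      ...   | refl | refl with any⁻ _ (allFin N) h'
      ...     | j , _ , aj with ∧⁻ {S' j} aj
      ...       | s'j , e = not⁻ (proj₂ (∧⁻ {S j} s'j)) e
      merge : ∀ {t} → here? t ∨ active S' t ≡ true → active S t ≡ true
      merge {(y , z) , b} h with ∨⁻ {here? ((y , z) , b)} h
      ... | inj₁ h₁ with ∧⁻ {⌊ y ≟ x ⌋} h₁
      ...   | p , q with ⌊⌋⁻ (y ≟ x) p | ⌊⌋⁻ (b ≟ a) q
      ...     | refl | refl = any⁺ (at S x a) (∈ₚ.∈-allFin i) ai
      merge {(y , z) , b} h | inj₂ h₂ with any⁻ _ (allFin N) h₂
      ...   | j , j∈ , aj with ∧⁻ {S' j} aj
      ...     | s'j , e = any⁺ (at S y b) j∈ (∧⁺ (proj₁ (∧⁻ {S j} s'j)) e)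

    Bad : Mask N → Fin n → Fin m → Set
    Bad S x a = (∃ λ i → at S x a i ≡ true) × M * ∣ at S x a ∣ᵐ ℕ.< degree G x

    bad? : ∀ S → Dec (∃ λ x → ∃ λ a → Bad S x a)
    bad? S = Finₚ.any? (λ x → Finₚ.any? (λ a → Finₚ.any? (λ i → ≡true? (at S x a i)) ×-dec (_ ℕ.<? _)))

    -- Removing a bad pair loses A copies with M A below the degree of the vertex, while the
    -- potential drops by at least that degree. So M times the copies lost is paid for by the drop
    -- of `act`.
    loop : ∀ k S → ∣ S ∣ᵐ ≤ k → ∃ λ S' → S' ⊑ᵐ S × M * ∣ S ∣ᵐ + act S' ≤ M * ∣ S' ∣ᵐ + act S × Dense S'
    loop k S size with bad? S
    ... | no none = S , (λ _ → id) , ℕₚ.≤-refl ,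
          λ {i} a si → ℕₚ.≮⇒≥ (λ lt → none (c i a , a , (i , ∧⁺ si (⌊⌋⁺ (c i a ≟ c i a) refl)) , lt))
    loop zero S size | yes (x , a , (i , ai) , lt) =
      ⊥-elim (ℕₚ.n≮0 (ℕₚ.<-≤-trans (#-pos S (allFin N) (∈ₚ.∈-allFin i) (proj₁ (∧⁻ {S i} ai))) size))
    loop (suc k) S size | yes (x , a , (i , ai) , lt) with loop k (removed S x a) smaller
      where
      smaller : ∣ removed S x a ∣ᵐ ≤ k
      smaller = ℕₚ.≤-pred (ℕₚ.≤-trans (ℕₚ.+-monoˡ-≤ _ (#-pos (at S x a) (allFin N) (∈ₚ.∈-allFin i) ai))
        (ℕₚ.≤-trans (ℕₚ.≤-reflexive (≡-sym (#-split S (λ i → ⌊ c i a ≟ x ⌋) (allFin N)))) size))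
    ... | S'' , sub , le , dense = S'' , (λ i → proj₁ ∘ ∧⁻ {S i} ∘ sub i) , ℕₚ.+-cancelˡ-≤ (M * ∣ S' ∣ᵐ + act S') _ _ (begin
      (M * ∣ S' ∣ᵐ + act S') + (M * ∣ S ∣ᵐ + act S'')      ≡⟨ cong (λ k → (M * ∣ S' ∣ᵐ + act S') + (k + act S'')) split ⟩
      (M * ∣ S' ∣ᵐ + act S') + ((M * A + M * ∣ S' ∣ᵐ) + act S'') ≡⟨ shuffle₁ (M * ∣ S' ∣ᵐ) (act S') (M * A) (act S'') ⟩
      (M * A + act S') + M * ∣ S' ∣ᵐ + (M * ∣ S' ∣ᵐ + act S'') ≤⟨ ℕₚ.+-mono-≤ (ℕₚ.+-monoˡ-≤ (M * ∣ S' ∣ᵐ) (ℕₚ.≤-trans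
                                                                  (ℕₚ.+-monoˡ-≤ (act S') (ℕₚ.<⇒≤ lt)) (act-drop S x a (i , ai)))) le ⟩
      act S + M * ∣ S' ∣ᵐ + (M * ∣ S'' ∣ᵐ + act S')        ≡⟨ shuffle₂ (act S) (M * ∣ S' ∣ᵐ) (M * ∣ S'' ∣ᵐ) (act S') ⟩
      (M * ∣ S' ∣ᵐ + act S') + (M * ∣ S'' ∣ᵐ + act S)      ∎) , dense
      where
      open ℕₚ.≤-Reasoning
      S' = removed S x a
      A = ∣ at S x a ∣ᵐ
      split : M * ∣ S ∣ᵐ ≡ M * A + M * ∣ S' ∣ᵐ
      split = trans (cong (M *_) (#-split S (λ i → ⌊ c i a ≟ x ⌋) (allFin N))) (ℕₚ.*-distribˡ-+ M A ∣ S' ∣ᵐ)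
      shuffle₁ : ∀ p q r s → (p + q) + ((r + p) + s) ≡ (r + q) + p + (p + s)
      shuffle₁ = solve-∀
      shuffle₂ : ∀ p q r s → p + q + (r + s) ≡ (q + s) + (r + p)
      shuffle₂ = solve-∀

  cleanup : ∀ S → ∃ λ S' → S' ⊑ᵐ S × M * ∣ S ∣ᵐ ≤ M * ∣ S' ∣ᵐ + 2 * edgeCount G * m × Dense S'
  cleanup S with loop ∣ S ∣ᵐ S ℕₚ.≤-refl
  ... | S' , sub , le , dense = S' , sub , ℕₚ.≤-trans (ℕₚ.m≤m+n _ (act S')) (ℕₚ.≤-trans le (ℕₚ.+-monoʳ-≤ (M * ∣ S' ∣ᵐ) act≤)) , dense
    where
    act≤ : act S ≤ 2 * edgeCount G * m
    act≤ = ℕₚ.≤-trans (#≤length (active S) triples) (ℕₚ.≤-trans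
      (ℕₚ.≤-reflexive (trans (length-cartesianProduct (darts G) (allFin m)) (cong (length (darts G) *_) (Listₚ.length-tabulate {n = m} id))))
      (ℕₚ.*-monoˡ-≤ m (length-darts≤ G)))

-- Lower bounds for probabilities

AllOut : ∀ {A : Set} → Dist A → (A → Set) → Set
AllOut D Q = All (Q ∘ proj₂) D

allOut->>= : ∀ {A B : Set} {Q : A → Set} {R : B → Set} (D : Dist A) {f : A → Dist B} →
  AllOut D Q → (∀ {x} → Q x → AllOut (f x) R) → AllOut (D >>= f) R
allOut->>= [] [] h = []
allOut->>= ((w , x) ∷ D) (q ∷ qs) h = Allₚ.++⁺ (Allₚ.map⁺ (h q)) (allOut->>= D qs h)

-- PrAtLeast together with the nonnegativity of the selected weights
Pr : ∀ {A : Set} → Dist A → (A → Set) → ℚᵘ → Set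
Pr D P δ = ∃ λ S → S ⊆ D × All (λ p → P (proj₂ p) × 0ℚᵘ ℚ.≤ proj₁ p) S × δ ℚ.≤ weight S

Pr⇒PrAtLeast : ∀ {A : Set} {D : Dist A} {P Q : A → Set} {δ} → Pr D P δ → (∀ {x} → P x → Q x) → PrAtLeast D Q δ
Pr⇒PrAtLeast (S , sub , ps , le) h = S , sub , All.map (h ∘ proj₁) ps , le

Pr-weaken : ∀ {A : Set} {D : Dist A} {P Q : A → Set} {δ δ'} → (∀ {x} → P x → Q x) → δ' ℚ.≤ δ → Pr D P δ → Pr D Q δ'
Pr-weaken h le (S , sub , ps , w) = S , sub , All.map (λ { (p , z) → h p , z }) ps , ℚₚ.≤-trans le w

Pr-with : ∀ {A : Set} {D : Dist A} {P Q : A → Set} {δ} → AllOut D Q → Pr D P δ → Pr D (λ x → P x × Q x) δ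
Pr-with {Q = Q} qs (S , sub , ps , w) = S , sub , All.zipWith (λ { ((p , z) , q) → (p , q) , z }) (ps , ⊆ₚ.All-resp-⊆ sub qs) , w

weight-++ : ∀ {A : Set} (S S' : Dist A) → weight (S ++ S') ℚ.≃ weight S ℚ.+ weight S'
weight-++ [] S' = ℚₚ.≃-sym (ℚₚ.+-identityˡ _)
weight-++ ((w , _) ∷ S) S' = ℚₚ.≃-trans (ℚₚ.+-congʳ w (weight-++ S S')) (ℚₚ.≃-sym (ℚₚ.+-assoc w _ _))

scale : ∀ {A : Set} → ℚᵘ → Dist A → Dist A
scale w = map (λ q → (w ℚ.* proj₁ q , proj₂ q))

weight-scale : ∀ {A : Set} w (S : Dist A) → weight (scale w S) ℚ.≃ w ℚ.* weight S
weight-scale w [] = ℚₚ.≃-sym (ℚₚ.*-zeroʳ w)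
weight-scale w ((u , _) ∷ S) = ℚₚ.≃-trans (ℚₚ.+-congʳ (w ℚ.* u) (weight-scale w S)) (ℚₚ.≃-sym (ℚₚ.*-distribˡ-+ w u (weight S)))

Pr-ret : ∀ {A : Set} {P : A → Set} {x} → P x → Pr (ret x) P 1ℚᵘ
Pr-ret {x = x} p = (1ℚᵘ , x) ∷ [] , refl ∷ [] , (p , ℚ.*≤* (ℤ.+≤+ z≤n)) ∷ [] , ℚₚ.≤-reflexive (ℚₚ.≃-sym (ℚₚ.+-identityʳ 1ℚᵘ))

0≤* : ∀ {p q} → 0ℚᵘ ℚ.≤ p → 0ℚᵘ ℚ.≤ q → 0ℚᵘ ℚ.≤ p ℚ.* q
0≤* {p} {q} hp hq = ℚₚ.nonNegative⁻¹ (p ℚ.* q) {{ℚₚ.nonNeg*nonNeg⇒nonNeg p {{ℚ.nonNegative hp}} q {{ℚ.nonNegative hq}}}}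

-- Each chosen outcome of `D` brings the chosen outcomes of its continuation, scaled by its weight.
-- Nonnegative weights allow the lower bounds to be multiplied.
Pr->>= : ∀ {A B : Set} {D : Dist A} {f : A → Dist B} {P : A → Set} {R : B → Set} {δ₁ δ₂} → 0ℚᵘ ℚ.≤ δ₂ →
  Pr D P δ₁ → (∀ {x} → P x → Pr (f x) R δ₂) → Pr (D >>= f) R (δ₁ ℚ.* δ₂)
Pr->>= {D = D} {f} {P} {R} {δ₁} {δ₂} nn (S , sub , ps , w) h with go sub ps
  where
  go : ∀ {S D} → S ⊆ D → All (λ p → P (proj₂ p) × 0ℚᵘ ℚ.≤ proj₁ p) S →
    ∃ λ S' → S' ⊆ (D >>= f) × All (λ p → R (proj₂ p) × 0ℚᵘ ℚ.≤ proj₁ p) S' × weight S ℚ.* δ₂ ℚ.≤ weight S'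
  go [] [] = [] , [] , [] , ℚₚ.≤-reflexive (ℚₚ.*-zeroˡ δ₂)
  go (y ∷ʳ sub) ps with go sub ps
  ... | S' , sub' , ps' , le = S' , ⊆ₚ.++⁺ˡ (scale (proj₁ y) (f (proj₂ y))) sub' , ps' , le
  go {(w , x) ∷ S} (refl ∷ sub) ((p , 0≤w) ∷ ps) with go sub ps | h p
  ... | S' , sub' , ps' , le | T , subT , psT , leT =
    scale w T ++ S' , ⊆ₚ.++⁺ (⊆ₚ.map⁺ _ subT) sub' ,
    Allₚ.++⁺ (Allₚ.map⁺ (All.map (λ { (r , z) → r , 0≤* 0≤w z }) psT)) ps' , (begin
      (w ℚ.+ weight S) ℚ.* δ₂            ≃⟨ ℚₚ.*-distribʳ-+ δ₂ w (weight S) ⟩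
      w ℚ.* δ₂ ℚ.+ weight S ℚ.* δ₂       ≤⟨ ℚₚ.+-mono-≤ (ℚₚ.*-monoʳ-≤-nonNeg w {{ℚ.nonNegative 0≤w}} leT) le ⟩
      w ℚ.* weight T ℚ.+ weight S'       ≃⟨ ℚₚ.+-congˡ (weight S') (weight-scale w T) ⟨
      weight (scale w T) ℚ.+ weight S'   ≃⟨ weight-++ (scale w T) S' ⟨
      weight (scale w T ++ S')           ∎)
    where open ℚₚ.≤-Reasoning
... | S' , sub' , ps' , le = S' , sub' , ps' , ℚₚ.≤-trans (ℚₚ.*-monoˡ-≤-nonNeg δ₂ {{ℚ.nonNegative nn}} w) le

-- This is 1/(M' + 1): the second field stores the denominator minus one.
unit : ℕ → ℚᵘ
unit M' = ℚ.mkℚᵘ (ℤ.+ 1) M'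

0≤unit : ∀ M' → 0ℚᵘ ℚ.≤ unit M'
0≤unit M' = ℚ.*≤* (ℤ.+≤+ z≤n)

unit≤1 : ∀ M' → unit M' ℚ.≤ 1ℚᵘ
unit≤1 M' = ℚ.*≤* (ℤ.+≤+ (s≤s z≤n))

weight-const : ∀ {A B : Set} (L : ℕ) (f : A → B) (ys : List A) →
  weight (map (λ x → (unit L , f x)) ys) ℚ.≃ ℚ.mkℚᵘ (ℤ.+ length ys) L
weight-const L f [] = ℚ.*≡* refl
weight-const L f (y ∷ ys) = ℚₚ.≃-trans (ℚₚ.+-congʳ (unit L) (weight-const L f ys))
  (ℚ.*≡* (trans (cong (ℤ._* ℤ.+ suc L) (cong₂ ℤ._+_ (ℤₚ.*-identityˡ (ℤ.+ suc L)) (≡-sym (ℤₚ.pos-* (length ys) (suc L)))))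
    (trans (≡-sym (ℤₚ.pos-* (suc L + length ys * suc L) (suc L)))
      (trans (cong (λ k → ℤ.+ k) (ℕₚ.*-assoc (suc (length ys)) (suc L) (suc L))) (ℤₚ.pos-* (suc (length ys)) (suc L * suc L))))))

Pr-uniform : ∀ {A : Set} M' (p : A → Bool) xs → 1 ≤ length xs → length xs ≤ suc M' * # p xs →
  Pr (uniform xs) (λ o → ∃ λ x → o ≡ just x × p x ≡ true) (unit M')
Pr-uniform M' p xs@(x₀ ∷ xs') 1≤ le =
  map (λ x → (unit L , just x)) (filterᵇ p xs) , ⊆ₚ.map⁺ _ (⊆ₚ.filter-⊆ (T? ∘ p) xs) ,
  Allₚ.map⁺ (All.tabulate (λ {x} x∈ → (x , refl , proj₂ (∈-filterᵇ⁻ p xs x∈)) , 0≤unit L)) ,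
  ℚₚ.≤-trans (ℚ.*≤* bound) (ℚₚ.≤-reflexive (ℚₚ.≃-sym (weight-const L just (filterᵇ p xs))))
  where
  L = length xs'
  bound : ℤ.+ 1 ℤ.* ℤ.+ suc L ℤ.≤ ℤ.+ # p xs ℤ.* ℤ.+ suc M'
  bound = subst₂ ℤ._≤_ (≡-sym (ℤₚ.*-identityˡ (ℤ.+ suc L))) (ℤₚ.pos-* (# p xs) (suc M'))
    (ℤ.+≤+ (ℕₚ.≤-trans le (ℕₚ.≤-reflexive (ℕₚ.*-comm (suc M') (# p xs)))))

pow : ℚᵘ → ℕ → ℚᵘ
pow r zero    = 1ℚᵘ
pow r (suc e) = pow r e ℚ.* r

module _ (M' : ℕ) where
  private r = unit M'

  0≤pow : ∀ e → 0ℚᵘ ℚ.≤ pow r e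
  0≤pow zero    = ℚ.*≤* (ℤ.+≤+ z≤n)
  0≤pow (suc e) = 0≤* (0≤pow e) (0≤unit M')

  0<pow : ∀ e → 0ℚᵘ < pow r e
  0<pow zero    = ℚ.*<* (ℤ.+<+ (s≤s z≤n))
  0<pow (suc e) = ℚₚ.positive⁻¹ _ {{ℚₚ.pos*pos⇒pos (pow r e) {{ℚ.positive (0<pow e)}} r}}

  pow-+ : ∀ a b → pow r (a + b) ℚ.≃ pow r a ℚ.* pow r b
  pow-+ a zero    = ℚₚ.≃-trans (ℚₚ.≃-reflexive (cong (pow r) (ℕₚ.+-identityʳ a))) (ℚₚ.≃-sym (ℚₚ.*-identityʳ _))
  pow-+ a (suc b) = ℚₚ.≃-trans (ℚₚ.≃-reflexive (cong (pow r) (ℕₚ.+-suc a b)))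
    (ℚₚ.≃-trans (ℚₚ.*-congʳ {r} (pow-+ a b)) (ℚₚ.*-assoc (pow r a) (pow r b) r))

  pow-step : ∀ e → pow r (suc e) ℚ.≤ pow r e
  pow-step e = ℚₚ.≤-trans (ℚₚ.*-monoʳ-≤-nonNeg (pow r e) {{ℚ.nonNegative (0≤pow e)}} (unit≤1 M')) (ℚₚ.≤-reflexive (ℚₚ.*-identityʳ _))

  pow-anti : ∀ {a b} → a ≤ b → pow r b ℚ.≤ pow r a
  pow-anti {a} a≤b with ℕₚ.m≤n⇒∃[o]m+o≡n a≤b
  ... | o , refl = go o
    where
    go : ∀ o → pow r (a + o) ℚ.≤ pow r a
    go zero    = ℚₚ.≤-reflexive (ℚₚ.≃-reflexive (cong (pow r) (ℕₚ.+-identityʳ a)))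
    go (suc o) = ℚₚ.≤-trans (ℚₚ.≤-reflexive (ℚₚ.≃-reflexive (cong (pow r) (ℕₚ.+-suc a o)))) (ℚₚ.≤-trans (pow-step (a + o)) (go o))

-- Query complexity

length-queries : ∀ {n} (G : Graph n) u d → AllOut (queries G u d) (λ Γ → length Γ ≤ d)
length-queries G u zero = z≤n ∷ []
length-queries G u (suc d) = allOut->>= (queries G u d) (length-queries G u d)
  (λ le → allOut->>= {Q = λ _ → ⊤} (query G u) (All.universal (λ _ → tt) _)
    (λ { {nothing} _ → ℕₚ.m≤n⇒m≤1+n le ∷ [] ; {just x} _ → s≤s le ∷ [] }))

length-layerEdges : ∀ {n} (G : Graph n) d us → AllOut (layerEdges G d us) (λ es → length es ≤ d * length us)
length-layerEdges G d [] = z≤n ∷ []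
length-layerEdges G d (u ∷ us) = allOut->>= (queries G u d) (length-queries G u d) (λ {Γ} leΓ →
  allOut->>= (layerEdges G d us) (length-layerEdges G d us) (λ {es} le → (begin
    length (map (λ x → (u , x)) Γ ++ es)        ≡⟨ Listₚ.length-++ (map (λ x → (u , x)) Γ) ⟩
    length (map (λ x → (u , x)) Γ) + length es  ≡⟨ cong (_+ length es) (Listₚ.length-map _ Γ) ⟩
    length Γ + length es                        ≤⟨ ℕₚ.+-mono-≤ leΓ le ⟩
    d + d * length us                           ≡⟨ ℕₚ.*-suc d (length us) ⟨
    d * suc (length us)                         ∎) ∷ []))
  where open ℕₚ.≤-Reasoning

newVertices : ∀ {n} → List (Fin n) → List (Dart n) → List (Fin n)
newVertices vs es = deduplicate _≟_ (filterᵇ (λ x → not (elemᵇ x vs)) (map proj₂ es))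

length-newVertices : ∀ {n} (vs : List (Fin n)) es → length (newVertices vs es) ≤ length es
length-newVertices vs es = ℕₚ.≤-trans (Listₚ.length-deduplicate _≟_ (filterᵇ (λ x → not (elemᵇ x vs)) (map proj₂ es)))
  (ℕₚ.≤-trans (#≤length (λ x → not (elemᵇ x vs)) (map proj₂ es)) (ℕₚ.≤-reflexive (Listₚ.length-map proj₂ es)))

newVertices-cover : ∀ {n} (vs : List (Fin n)) es {u y} → (u , y) ∈ es → y ∈ vs ++ newVertices vs es
newVertices-cover vs es {u} {y} e∈ with ≡true? (elemᵇ y vs)
... | no ne = ∈ₚ.∈-++⁺ʳ vs (∈ₚ.∈-deduplicate⁺ _≟_ (∈-filterᵇ⁺ (λ x → not (elemᵇ x vs)) (∈ₚ.∈-map⁺ proj₂ e∈) (not⁺ ne)))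
... | yes el with any⁻ (y ==_) vs el
...   | z , z∈ , e = ∈ₚ.∈-++⁺ˡ (subst (_∈ vs) (≡-sym (⌊⌋⁻ (y ≟ z) e)) z∈)

-- Invariant after `j` rounds: the current layer has at most d ^ j vertices, so the next round adds
-- at most d ^ (j + 1) queries.
queryCount-traverse : ∀ {n} (G : Graph n) d ℓ j s → length (layer s) ≤ d ^ j → nQueries s ≤ geomSum d j →
  AllOut (traverseFrom G d ℓ s) (λ s' → nQueries s' ≤ geomSum d (j + ℓ))
queryCount-traverse G d zero j s le nq = ℕₚ.≤-trans nq (ℕₚ.≤-reflexive (cong (geomSum d) (≡-sym (ℕₚ.+-identityʳ j)))) ∷ []
queryCount-traverse G d (suc ℓ) j s le nq = allOut->>= (layerEdges G d (layer s)) (length-layerEdges G d (layer s))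
  (λ {es} le-es → subst (λ k → AllOut (traverseFrom G d ℓ (next es)) (λ s' → nQueries s' ≤ geomSum d k)) (≡-sym (ℕₚ.+-suc j ℓ))
    (queryCount-traverse G d ℓ (suc j) (next es)
      (ℕₚ.≤-trans (length-newVertices (visited s) es) (ℕₚ.≤-trans le-es (ℕₚ.*-monoʳ-≤ d le)))
      (ℕₚ.+-mono-≤ nq (ℕₚ.*-monoʳ-≤ d le))))
  where
  next : List (Dart _) → TState _
  next es = tstate (visited s ++ newVertices (visited s) es) (newVertices (visited s) es)
    (recorded s ++ es) (nQueries s + d * length (layer s))

queryCount-RLBD : ∀ {n k} (G : Graph n) (H : Graph k) d ℓ →
  All (λ o → QueryCount (proj₂ o) ≤ geomSum d ℓ) (RLBD G H d ℓ)
queryCount-RLBD {n} G H d ℓ = allOut->>= {Q = λ _ → ⊤} (uniform (allFin n)) (All.universal (λ _ → tt) _)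
  (λ { {nothing} _ → z≤n ∷ []
     ; {just v} _ → allOut->>= (Traverse G v d ℓ) (queryCount-traverse G d ℓ 0 _ ℕₚ.≤-refl z≤n) (λ le → le ∷ []) })

-- Bounds the number of queries in ℓ rounds from l vertices; each query succeeds with
-- probability 1/(1+M'), so this is the exponent in the success probability.
traverse-cost : ℕ → ℕ → ℕ → ℕ
traverse-cost d zero    l = 0
traverse-cost d (suc ℓ) l = d * l + traverse-cost d ℓ (d * l)

-- Either nothing is asked of `u`, or a fraction of at least 1/(1 + M') of its neighbours are hits;
-- a nonempty neighbourhood keeps the query from returning `nothing`.
Demand : ∀ {n} → Graph n → ℕ → Fin n → Set → (Fin n → Set) → Set
Demand G M' u Act Hit = (¬ Act) ⊎ (∃ λ p → (∀ {y} → p y ≡ true → Hit y) ×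
  1 ≤ length (neighbours G u) × length (neighbours G u) ≤ suc M' * # p (neighbours G u))

-- Success probability of an exploration

module Exploration {n} (G : Graph n) (m M' : ℕ)
  (Act : Fin n → Fin m → Set) (Hit : Fin n → Fin m → Fin n → Set)
  (demand : ∀ u b → Demand G M' u (Act u b) (Hit u b)) where

  private r = unit M'

  Served : Fin n → Fin m → List (Fin n) → Set
  Served u b Γ = Act u b → ∃ λ y → y ∈ Γ × Hit u b y

  -- An idle query is charged the factor `r` too, so that the exponent just counts queries.
  query-any : ∀ u → Pr (query G u) (λ _ → ⊤) r
  query-any u with neighbours G u
  ... | [] = Pr-weaken id (unit≤1 M') (Pr-ret tt)
  ... | xs@(_ ∷ xs') = Pr-weaken {P = λ o → ∃ λ x → o ≡ just x × true ≡ true} (λ _ → tt) ℚₚ.≤-refl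
    (Pr-uniform M' (λ _ → true) xs (s≤s z≤n)
      (ℕₚ.≤-trans (ℕₚ.≤-reflexive (≡-sym (#-all (λ _ → true) xs (λ _ → refl)))) (ℕₚ.m≤n*m (# (λ _ → true) xs) (suc M'))))

  -- One query is devoted to each role of `bs`; further answers never undo a demand already met.
  queries-serve : ∀ u (bs : List (Fin m)) → Pr (queries G u (length bs)) (λ Γ → ∀ {b} → b ∈ bs → Served u b Γ) (pow r (length bs))
  queries-serve u [] = Pr-ret (λ ())
  queries-serve u (b ∷ bs) = Pr->>= (0≤unit M') (queries-serve u bs) (λ {Γ} served →
    Pr-weaken id (ℚₚ.≤-reflexive (ℚₚ.≃-sym (ℚₚ.*-identityʳ r))) (next refl (λ _ → refl) served (demand u b)))
    where
    -- The continuation `f` enters through its two defining equations, in place of the pattern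
    -- lambda inside `queries`.
    next : ∀ {Γ} {f : Maybe (Fin n) → Dist (List (Fin n))} → f nothing ≡ ret Γ → (∀ x → f (just x) ≡ ret (x ∷ Γ)) →
      (∀ {b'} → b' ∈ bs → Served u b' Γ) → Demand G M' u (Act u b) (Hit u b) →
      Pr (query G u >>= f) (λ Γ' → ∀ {b'} → b' ∈ b ∷ bs → Served u b' Γ') (r ℚ.* 1ℚᵘ)
    next {Γ} fn fj served (inj₁ idle) = Pr->>= (0≤pow M' 0) (query-any u)
      λ { {nothing} _ → subst (λ D → Pr D _ 1ℚᵘ) (≡-sym fn) (Pr-ret
            λ { (here refl) act → ⊥-elim (idle act) ; (there b∈) act → served b∈ act })
        ; {just x} _ → subst (λ D → Pr D _ 1ℚᵘ) (≡-sym (fj x)) (Pr-ret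
            λ { (here refl) act → ⊥-elim (idle act)
              ; (there b∈) act → let (y , y∈ , h) = served b∈ act in y , there y∈ , h }) }
    next {Γ} fn fj served (inj₂ (p , p⇒hit , 1≤ , le)) = Pr->>= (0≤pow M' 0) (Pr-uniform M' p (neighbours G u) 1≤ le)
      λ { (x , refl , px) → subst (λ D → Pr D _ 1ℚᵘ) (≡-sym (fj x)) (Pr-ret
            λ { (here refl) act → x , here refl , p⇒hit px
              ; (there b∈) act → let (y , y∈ , h) = served b∈ act in y , there y∈ , h }) }

  queries-good : ∀ u → Pr (queries G u m) (λ Γ → ∀ b → Served u b Γ) (pow r m)
  queries-good u = subst (λ k → Pr (queries G u k) (λ Γ → ∀ b → Served u b Γ) (pow r k)) (Listₚ.length-tabulate {n = m} id)
    (Pr-weaken (λ s b → s (∈ₚ.∈-allFin b)) ℚₚ.≤-refl (queries-serve u (allFin m)))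

  ServedIn : Fin n → Fin m → List (Dart n) → Set
  ServedIn u b es = Act u b → ∃ λ y → (u , y) ∈ es × Hit u b y

  layer-good : ∀ us → Pr (layerEdges G m us) (λ es → ∀ {u} → u ∈ us → ∀ b → ServedIn u b es) (pow r (m * length us))
  layer-good [] = Pr-weaken {P = λ _ → ⊤} (λ _ ()) (pow-anti M' {0} {m * 0} z≤n) (Pr-ret tt)
  layer-good (u ∷ us) = Pr-weaken id
    (ℚₚ.≤-reflexive (ℚₚ.≃-trans (ℚₚ.≃-reflexive (cong (pow r) (ℕₚ.*-suc m (length us)))) (pow-+ M' m (m * length us))))
    (Pr->>= (0≤pow M' (m * length us)) (queries-good u) (λ {Γ} servedΓ →
      Pr-weaken id (ℚₚ.≤-reflexive (ℚₚ.≃-sym (ℚₚ.*-identityʳ _))) (Pr->>= (0≤pow M' 0) (layer-good us) (λ {es} served →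
        Pr-ret λ { (here refl) b act → let (y , y∈ , h) = servedΓ b act in y , ∈ₚ.∈-++⁺ˡ (∈ₚ.∈-map⁺ (λ x → (u , x)) y∈) , h
                 ; (there u∈) b act → let (y , y∈ , h) = served u∈ b act in y , ∈ₚ.∈-++⁺ʳ (map (λ x → (u , x)) Γ) y∈ , h }))))

  Depth : List (Dart n) → ℕ → Fin n → Set
  Depth es zero    x = ⊤
  Depth es (suc i) x = ∀ b → Act x b → ∃ λ y → (x , y) ∈ es × Hit x b y × Depth es i y

  Depth-mono : ∀ {es i i' x} → i ≤ i' → Depth es i' x → Depth es i x
  Depth-mono z≤n       deep = tt
  Depth-mono (s≤s le) deep b act = let (y , e∈ , h , deep') = deep b act in y , e∈ , h , Depth-mono le deep'

  Settled : TState n → Set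
  Settled s = ∀ {x} → x ∈ visited s → x ∈ layer s ⊎
    (∀ b → Act x b → ∃ λ y → (x , y) ∈ recorded s × Hit x b y × y ∈ visited s)

  Progress : ℕ → TState n → TState n → Set
  Progress ℓ s s' = (∀ {e} → e ∈ recorded s → e ∈ recorded s') × (∀ {x} → x ∈ visited s → Depth (recorded s') ℓ x)

  -- Depth is claimed for all visited vertices, not only for the layer: an answer may have been
  -- visited before, and is then not queried again. `Settled` says that its demands were met in an
  -- earlier round.
  traverse-good : ∀ ℓ l s → length (layer s) ≤ l → (∀ {x} → x ∈ layer s → x ∈ visited s) → Settled s →
    Pr (traverseFrom G m ℓ s) (Progress ℓ s) (pow r (traverse-cost m ℓ l))
  traverse-good zero l s le sub settled = Pr-ret {P = Progress zero s} ((λ e∈ → e∈) , (λ _ → tt))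
  traverse-good (suc ℓ) l s le sub settled =
    Pr-weaken id (ℚₚ.≤-reflexive (pow-+ M' (m * l) (traverse-cost m ℓ (m * l))))
      (Pr->>= (0≤pow M' (traverse-cost m ℓ (m * l)))
        (Pr-weaken id (pow-anti M' (ℕₚ.*-monoʳ-≤ m le)) (Pr-with (length-layerEdges G m (layer s)) (layer-good (layer s))))
        (λ {es} (served , len) → continue es served len))
    where
    continue : ∀ es → (∀ {u} → u ∈ layer s → ∀ b → ServedIn u b es) → length es ≤ m * length (layer s) →
      Pr (traverseFrom G m ℓ (tstate (visited s ++ newVertices (visited s) es) (newVertices (visited s) es)
           (recorded s ++ es) (nQueries s + m * length (layer s)))) (Progress (suc ℓ) s) (pow r (traverse-cost m ℓ (m * l)))
    continue es served len = Pr-weaken (λ {s'} → finish {s'}) ℚₚ.≤-refl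
      (traverse-good ℓ (m * l) s₁ (ℕₚ.≤-trans (length-newVertices (visited s) es) (ℕₚ.≤-trans len (ℕₚ.*-monoʳ-≤ m le)))
        (∈ₚ.∈-++⁺ʳ (visited s)) settled₁)
      where
      new = newVertices (visited s) es
      s₁ = tstate (visited s ++ new) new (recorded s ++ es) (nQueries s + m * length (layer s))
      answered : ∀ {x} → x ∈ visited s → ∀ b → Act x b → ∃ λ y → (x , y) ∈ recorded s₁ × Hit x b y × y ∈ visited s₁
      answered x∈ b act with settled x∈
      ... | inj₁ inLayer = let (y , e∈ , h) = served inLayer b act in
              y , ∈ₚ.∈-++⁺ʳ (recorded s) e∈ , h , newVertices-cover (visited s) es e∈
      ... | inj₂ old = let (y , e∈ , h , y∈) = old b act in y , ∈ₚ.∈-++⁺ˡ e∈ , h , ∈ₚ.∈-++⁺ˡ y∈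
      settled₁ : Settled s₁
      settled₁ x∈ with ∈ₚ.∈-++⁻ (visited s) x∈
      ... | inj₁ old = inj₂ (answered old)
      ... | inj₂ isNew = inj₁ isNew
      finish : ∀ {s'} → Progress ℓ s₁ s' → Progress (suc ℓ) s s'
      finish (keep , deep) = (λ e∈ → keep (∈ₚ.∈-++⁺ˡ e∈)) , λ x∈ b act →
        let (y , e∈ , h , y∈) = answered x∈ b act in y , keep e∈ , h , deep y∈

  Explored : ℕ → (Fin n → Bool) → Maybe (Fin n × TState n) → Set
  Explored ℓ start nothing        = ⊥
  Explored ℓ start (just (v , s)) = start v ≡ true × Depth (recorded s) ℓ v

  RLBD-good : ∀ {k} (H : Graph k) ℓ B' (start : Fin n → Bool) → 1 ≤ n → n ≤ suc B' * # start (allFin n) →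
    Pr (RLBD G H m ℓ) (Explored ℓ start) (unit B' ℚ.* pow r (traverse-cost m ℓ 1))
  RLBD-good H ℓ B' start 1≤n le = Pr->>= (0≤pow M' (traverse-cost m ℓ 1))
    (Pr-uniform B' start (allFin n) (subst (1 ≤_) (≡-sym len) 1≤n) (subst (_≤ suc B' * # start (allFin n)) (≡-sym len) le))
    (λ { (v , refl , sv) → Pr-weaken id (ℚₚ.≤-reflexive (ℚₚ.≃-sym (ℚₚ.*-identityʳ _)))
      (Pr->>= (0≤pow M' 0) (traverse-good ℓ 1 _ ℕₚ.≤-refl id inj₁) (λ { (_ , deep) → Pr-ret (sv , deep (here refl)) })) })
    where
    len : length (allFin n) ≡ n
    len = Listₚ.length-tabulate {n = n} id

-- Assembling a copy from an exploration

ConnList-unique : ∀ {m} {H : Graph m} {L} → ConnList H L → Unique L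
ConnList-unique (one v) = [] ∷ []
ConnList-unique (add c _ _ v∉) = All.tabulate (λ x∈ e → v∉ (subst (_∈ _) (≡-sym e) x∈)) ∷ ConnList-unique c

ConnList-length : ∀ {m} {H : Graph m} {L} → ConnList H L → length L ≤ m
ConnList-length {m} {L = L} c = subst (length L ≤_) (Listₚ.length-tabulate {n = m} id)
  (Unique-⊆⇒length≤ (ConnList-unique c) (λ _ → ∈ₚ.∈-allFin _))

crossing : ∀ {m} {H : Graph m} {L} → ConnList H L → {Q : Fin m → Set} → (∀ x → Dec (Q x)) →
  ∀ {x y} → x ∈ L → Q x → y ∈ L → ¬ Q y →
  ∃ λ x' → ∃ λ y' → x' ∈ L × y' ∈ L × Q x' × ¬ Q y' × adj H x' y' ≡ true
crossing (one v) Q? (here refl) qx (here refl) ¬qy = ⊥-elim (¬qy qx)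
crossing {H = H} (add {v} {w} {L} cL w∈ vw v∉) {Q} Q? {x} {y} x∈ qx y∈ ¬qy with Q? v | Q? w
... | yes qv | no ¬qw = v , w , here refl , there w∈ , qv , ¬qw , vw
... | no ¬qv | yes qw = w , v , there w∈ , here refl , qw , ¬qv , trans (sym H w v) vw
... | yes qv | yes qw = lift (crossing cL Q? w∈ qw (tail y∈) ¬qy)
  where
  tail : y ∈ v ∷ L → y ∈ L
  tail (here refl) = ⊥-elim (¬qy qv)
  tail (there i) = i
  lift : _ → _
  lift (x' , y' , x'∈ , y'∈ , r) = x' , y' , there x'∈ , there y'∈ , r
... | no ¬qv | no ¬qw = lift (crossing cL Q? (tail x∈) qx w∈ ¬qw)
  where
  tail : x ∈ v ∷ L → x ∈ L
  tail (here refl) = ⊥-elim (¬qv qx)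
  tail (there i) = i
  lift : _ → _
  lift (x' , y' , x'∈ , y'∈ , r) = x' , y' , there x'∈ , there y'∈ , r

module _ {m} (H : Graph m) where

  Closed : List (Fin m) → List (Fin m) → Set
  Closed M P = ∀ {p b} → p ∈ P → b ∈ M → adj H p b ≡ true → b ∈ P

  -- `P` grows by adjacent vertices of `M` until none is left; `k` bounds the growth, since a
  -- duplicate-free `P` cannot outgrow `M`.
  component : ∀ M k P → ConnList H P → (∀ {p} → p ∈ P → p ∈ M) → length M ≤ length P + k →
    ∃ λ P' → ConnList H P' × (∀ {p} → p ∈ P → p ∈ P') × (∀ {p} → p ∈ P' → p ∈ M) × Closed M P'
  component M k P conn sub size with Any.any? (λ b → ¬? (member? _≟_ b P) ×-dec Any.any? (λ p → ≡true? (adj H b p)) P) M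
  component M k P conn sub size | no none = P , conn , id , sub , closed'
    where
    closed' : Closed M P
    closed' {p} {b} p∈ b∈ a with member? _≟_ b P
    ... | yes b∈P = b∈P
    ... | no b∉P = ⊥-elim (none (lose b∈ (b∉P , lose p∈ (trans (sym H b p) a))))
  component M k P conn sub size | yes found with find found
  ... | b , b∈M , b∉P , adjacent with find adjacent
  ...   | p , p∈P , bp = grow k size
    where
    conn' = add conn p∈P bp b∉P
    sub' : ∀ {q} → q ∈ b ∷ P → q ∈ M
    sub' (here refl) = b∈M
    sub' (there q∈) = sub q∈
    grow : ∀ k → length M ≤ length P + k →
      ∃ λ P' → ConnList H P' × (∀ {p} → p ∈ P → p ∈ P') × (∀ {p} → p ∈ P' → p ∈ M) × Closed M P'
    grow zero size = ⊥-elim (ℕₚ.<-irrefl refl (ℕₚ.≤-trans (Unique-⊆⇒length≤ (ConnList-unique conn') sub')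
      (ℕₚ.≤-trans size (ℕₚ.≤-reflexive (ℕₚ.+-identityʳ _)))))
    grow (suc k) size with component M k (b ∷ P) conn' sub' (ℕₚ.≤-trans size (ℕₚ.≤-reflexive (ℕₚ.+-suc (length P) k)))
    ... | P' , c' , inc , s' , cl = P' , c' , inc ∘ there , s' , cl

  component-of : ∀ M {a} → a ∈ M → ∃ λ P → ConnList H P × a ∈ P × (∀ {p} → p ∈ P → p ∈ M) × Closed M P
  component-of M {a} a∈ with component M (length M) (a ∷ []) (one a) (λ { (here refl) → a∈ }) (ℕₚ.m≤n+m (length M) 1)
  ... | P , c , inc , sub , cl = P , c , inc (here refl) , sub , cl

  spanning : Connected H → Fin m → ∃ λ L → ConnList H L × (∀ a → a ∈ L)
  spanning walks a with component-of (allFin m) (∈ₚ.∈-allFin a)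
  ... | L , c , a∈ , _ , cl = L , c , λ b → follow a∈ (walks a b)
    where
    follow : ∀ {x y} → x ∈ L → Walk H x y → y ∈ L
    follow x∈ here = x∈
    follow x∈ (step e w) = follow (cl x∈ (∈ₚ.∈-allFin _) e) w

  -- One round leads from a deleted top into a component, at most `m` rounds climb to the top of
  -- that component, and the recursion continues there. The final 1 leaves every placed vertex a
  -- round for its edges to the tops above.
  depth : ℕ → ℕ
  depth zero    = 1
  depth (suc s) = suc (m + depth s)

-- Reached k x : the vertex x was discovered early enough for k further rounds of queries.
module Assemble {n m N} (H : Graph m) (c : Fin N → Fin m → Fin n) (S : Mask N) (roles : Roles c S)
  (es : List (Dart n)) (Reached : ℕ → Fin n → Set)
  (reached-mono : ∀ {k k' x} → k ≤ k' → Reached k' x → Reached k x)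
  (query-step : ∀ {i a b k} → S i ≡ true → adj H a b ≡ true → Reached (suc k) (c i a) →
    ∃ λ j → S j ≡ true × c j a ≡ c i a × (c i a , c j b) ∈ es × Reached k (c j b)) where

  private
    Det : Fin m → Fin m → Set
    Det a b = ∀ {i j} → S i ≡ true → S j ≡ true → c i a ≡ c j a → c i b ≡ c j b

  -- Each step may switch to another copy, but that copy shares the current vertex, whose role
  -- determines `t`; so the vertex in role `t` never changes. The path follows the order of `K` and
  -- needs at most `length K` rounds.
  navigate : ∀ {K} → ConnList H K → ∀ {t} → (∀ {a} → a ∈ K → Det a t) → ∀ {p q} → p ∈ K → q ∈ K →
    ∀ {i k} → S i ≡ true → Reached (length K + k) (c i p) →
    ∃ λ j → S j ≡ true × c j t ≡ c i t × Reached k (c j q)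
  navigate (one v) det (here refl) (here refl) {i} si r = i , si , refl , reached-mono (ℕₚ.n≤1+n _) r
  navigate (add {v} {w} {L} cK w∈ vw _) det (here refl) (here refl) {i} {k} si r =
    i , si , refl , reached-mono (ℕₚ.m≤n+m k (suc (length L))) r
  navigate (add cK w∈ vw _) det (here refl) (there q∈) si r with query-step si vw r
  ... | j , sj , e , _ , r' with navigate cK (det ∘ there) w∈ q∈ sj r'
  ...   | j' , sj' , e' , r'' = j' , sj' , trans e' (det (here refl) sj si e) , r''
  navigate (add {v} {w} {L} cK w∈ vw _) det {p} (there p∈) (here refl) {i} {k} si r
    with navigate cK (det ∘ there) p∈ w∈ {k = suc k} si (subst (λ z → Reached z (c i p)) (≡-sym (ℕₚ.+-suc (length L) k)) r)
  ... | j , sj , e , r' with query-step sj (trans (sym H w v) vw) r'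
  ...   | j' , sj' , e' , _ , r'' = j' , sj' , trans (det (there w∈) sj' sj e') e , r''
  navigate (add cK w∈ vw _) det (there p∈) (there q∈) si r =
    navigate cK (det ∘ there) p∈ q∈ si (reached-mono (ℕₚ.n≤1+n _) r)

  Recorded : (Fin m → Fin n) → Fin m → Fin m → Set
  Recorded f a b = (f a , f b) ∈ es ⊎ (f b , f a) ∈ es

  -- The copy witnessing `f a` may vary with `a`; all these copies have `z` in role `t`.
  Placed : Fin m → Fin n → (Fin m → Fin n) → Fin m → Set
  Placed t z f a = (∃ λ j → S j ≡ true × c j a ≡ f a × c j t ≡ z) × Reached 1 (f a)

  Embeds : Fin m → Fin n → List (Fin m) → (Fin m → Fin n) → Set
  Embeds t z L f = (∀ {a} → a ∈ L → Placed t z f a) ×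
    (∀ {a b} → a ∈ L → b ∈ L → adj H a b ≡ true → Recorded f a b)

  module _ (tops : ∀ {L} → ConnList H L → ∃ λ t → t ∈ L × (∀ {a} → a ∈ L → Det a t)) where

    1≤depth : ∀ s → 1 ≤ depth H s
    1≤depth zero    = s≤s z≤n
    1≤depth (suc s) = s≤s z≤n

    -- Deleting the top t splits L into components; each is reached from the given
    -- vertex of role t, and everything found in it still determines that vertex.
    assemble : ∀ s {L} → ConnList H L → length L ≤ s → ∀ {t} → t ∈ L → (∀ {a} → a ∈ L → Det a t) →
      ∀ {i} → S i ≡ true → Reached (depth H s) (c i t) → ∃ (Embeds t (c i t) L)
    assemble zero (one v) () t∈ top si r
    assemble zero (add _ _ _ _) () t∈ top si r
    assemble (suc s) {L} conn len {t} t∈ top {i} si r with cover M id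
      where
      M = filterᵇ (λ a → not ⌊ a ≟ t ⌋) L
      M⁻ : ∀ {a} → a ∈ M → a ∈ L × a ≢ t
      M⁻ {a} a∈ with ∈-filterᵇ⁻ (λ a → not ⌊ a ≟ t ⌋) L a∈
      ... | a∈L , ne = a∈L , λ e → not⁻ ne (⌊⌋⁺ (a ≟ t) e)
      M⁺ : ∀ {a} → a ∈ L → a ≢ t → a ∈ M
      M⁺ {a} a∈ ne = ∈-filterᵇ⁺ (λ a → not ⌊ a ≟ t ⌋) a∈ (not⁺ (ne ∘ ⌊⌋⁻ (a ≟ t)))
      z = c i t

      part : ∀ {P} → ConnList H P → (∀ {p} → p ∈ P → p ∈ M) → Closed H M P → ∀ {a} → a ∈ P → ∃ (Embeds t z P)
      part {P} cP P⊆M cl {a} a∈P with tops cP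
      -- `L` is connected, so some edge leaves `P` within `L`. As `P` is closed in `M`, the far end
      -- of that edge can only be `t`.
      ... | t' , t'∈ , top' with crossing conn (λ x → member? _≟_ x P) (proj₁ (M⁻ (P⊆M a∈P))) a∈P t∈ (λ t∈P → proj₂ (M⁻ (P⊆M t∈P)) refl)
      ...   | x , y , x∈L , y∈L , x∈P , y∉P , xy with y ≟ t
      ...     | no y≢t = ⊥-elim (y∉P (cl x∈P (M⁺ y∈L y≢t) xy))
      ...     | yes refl with query-step si (trans (sym H t x) xy) r
      ...       | j₁ , s₁ , e₁ , _ , r₁ with navigate cP top' x∈P t'∈ {k = depth H s} s₁
                      (reached-mono (ℕₚ.+-monoˡ-≤ (depth H s) (ConnList-length cP)) r₁)
      ...         | j₂ , s₂ , e₂ , r₂ with assemble s cP (ℕₚ.≤-pred (ℕₚ.≤-trans shorter len)) t'∈ top' s₂ r₂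
        where
        shorter : suc (length P) ≤ length L
        shorter = Unique-⊆⇒length≤ {xs = t ∷ P}
          (All.tabulate (λ p∈ e → proj₂ (M⁻ (P⊆M p∈)) (≡-sym e)) ∷ ConnList-unique cP)
          (λ { (here refl) → t∈ ; (there p∈) → proj₁ (M⁻ (P⊆M p∈)) })
      ...           | f , placed , recs = f , placed' , recs
        where
        t'-t : Det t' t
        t'-t = top (proj₁ (M⁻ (P⊆M t'∈)))
        -- The copies agree along a chain: with `j₂` in role `t'`, hence in role `t`, then `j₂` with
        -- `j₁` for the same reason, and `j₁` with `i` in role `t`.
        placed' : ∀ {a} → a ∈ P → Placed t z f a
        placed' a∈ with placed a∈
        ... | (j , sj , e , et') , ra = (j , sj , e , trans (t'-t sj s₂ et') (trans (t'-t s₂ s₁ e₂) (top t∈ s₁ si e₁))) , ra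

      -- `U` is the union of the components treated so far. It is closed in `M`, so no edge of `H`
      -- joins it to a new component and the two embeddings can be glued.
      cover : ∀ as → (∀ {a} → a ∈ as → a ∈ M) →
        ∃ λ U → (∀ {a} → a ∈ as → a ∈ U) × (∀ {a} → a ∈ U → a ∈ M) × Closed H M U × ∃ (Embeds t z U)
      cover [] as⊆ = [] , (λ ()) , (λ ()) , (λ ()) , (λ _ → z) , (λ ()) , (λ ())
      cover (a ∷ as) as⊆ with cover as (as⊆ ∘ there)
      ... | U , as⊆U , U⊆M , clU , f , placed , recs with member? _≟_ a U
      ...   | yes a∈U = U , (λ { (here refl) → a∈U ; (there b∈) → as⊆U b∈ }) , U⊆M , clU , f , placed , recs
      ...   | no a∉U with component-of H M (as⊆ (here refl))
      ...     | P , cP , a∈P , P⊆M , clP with part cP P⊆M clP a∈P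
      ...       | f' , placed' , recs' = P ++ U ,
        (λ { (here refl) → ∈ₚ.∈-++⁺ˡ a∈P ; (there b∈) → ∈ₚ.∈-++⁺ʳ P (as⊆U b∈) }) ,
        (λ b∈ → [ P⊆M , U⊆M ]′ (∈ₚ.∈-++⁻ P b∈)) ,
        (λ p∈ b∈ e → [ (λ p∈P → ∈ₚ.∈-++⁺ˡ (clP p∈P b∈ e)) , (λ p∈U → ∈ₚ.∈-++⁺ʳ P (clU p∈U b∈ e)) ]′ (∈ₚ.∈-++⁻ P p∈)) ,
        g , placed'' , recs''
        where
        disjoint : ∀ {p} → p ∈ P → p ∈ U → ⊥
        disjoint p∈P p∈U with crossing cP (λ x → member? _≟_ x U) p∈P p∈U a∈P a∉U
        ... | x , y , x∈P , y∈P , x∈U , y∉U , xy = y∉U (clU x∈U (P⊆M y∈P) xy)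
        g : Fin m → Fin n
        g x = if ⌊ member? _≟_ x P ⌋ then f' x else f x
        g-P : ∀ {x} → x ∈ P → g x ≡ f' x
        g-P {x} x∈ rewrite ⌊⌋⁺ (member? _≟_ x P) x∈ = refl
        g-U : ∀ {x} → x ∈ U → g x ≡ f x
        g-U {x} x∈ rewrite ⌊⌋-false (member? _≟_ x P) (λ x∈P → disjoint x∈P x∈) = refl
        placed'' : ∀ {b} → b ∈ P ++ U → Placed t z g b
        placed'' {b} b∈ with ∈ₚ.∈-++⁻ P b∈
        ... | inj₁ b∈P = subst (λ w → (∃ λ j → S j ≡ true × c j b ≡ w × c j t ≡ z) × Reached 1 w) (≡-sym (g-P b∈P)) (placed' b∈P)
        ... | inj₂ b∈U = subst (λ w → (∃ λ j → S j ≡ true × c j b ≡ w × c j t ≡ z) × Reached 1 w) (≡-sym (g-U b∈U)) (placed b∈U)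
        recs'' : ∀ {x y} → x ∈ P ++ U → y ∈ P ++ U → adj H x y ≡ true → Recorded g x y
        recs'' {x} {y} x∈ y∈ e with ∈ₚ.∈-++⁻ P x∈ | ∈ₚ.∈-++⁻ P y∈
        ... | inj₁ xP | inj₁ yP = subst₂ (λ u w → (u , w) ∈ es ⊎ (w , u) ∈ es) (≡-sym (g-P xP)) (≡-sym (g-P yP)) (recs' xP yP e)
        ... | inj₂ xU | inj₂ yU = subst₂ (λ u w → (u , w) ∈ es ⊎ (w , u) ∈ es) (≡-sym (g-U xU)) (≡-sym (g-U yU)) (recs xU yU e)
        ... | inj₁ xP | inj₂ yU = ⊥-elim (disjoint xP (clU yU (P⊆M xP) (trans (sym H y x) e)))
        ... | inj₂ xU | inj₁ yP = ⊥-elim (disjoint yP (clU xU (P⊆M yP) e))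
    ... | U , M⊆U , _ , _ , f , placed , recs = g , placed' , recs'
      where
      z = c i t
      in-U : ∀ {a} → a ∈ L → a ≢ t → a ∈ U
      in-U {a} a∈ ne = M⊆U (∈-filterᵇ⁺ (λ a → not ⌊ a ≟ t ⌋) a∈ (not⁺ (ne ∘ ⌊⌋⁻ (a ≟ t))))
      g : Fin m → Fin n
      g x = if ⌊ x ≟ t ⌋ then z else f x
      g-U : ∀ {x} → x ≢ t → g x ≡ f x
      g-U {x} ne rewrite ⌊⌋-false (x ≟ t) ne = refl
      placed' : ∀ {a} → a ∈ L → Placed t z g a
      placed' {a} a∈ with a ≟ t
      ... | yes refl = (i , si , refl , refl) , reached-mono (1≤depth (suc s)) r
      ... | no ne = placed (in-U a∈ ne)
      -- The answer recorded at `f a` for role `t` may come from another copy `j'` through `f a`.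
      -- Since `a` determines `t`, that answer is still `z`.
      to-top : ∀ {a} → a ∈ L → a ≢ t → adj H a t ≡ true → (f a , z) ∈ es
      to-top {a} a∈ ne e with placed (in-U a∈ ne)
      ... | (j , sj , eq , et) , ra with query-step sj e (subst (Reached 1) (≡-sym eq) ra)
      ...   | j' , sj' , eq' , rec , _ = subst₂ (λ u w → (u , w) ∈ es) eq (trans (top a∈ sj' sj eq') et) rec
      recs' : ∀ {a b} → a ∈ L → b ∈ L → adj H a b ≡ true → Recorded g a b
      recs' {a} {b} a∈ b∈ e with a ≟ t | b ≟ t
      ... | yes refl | yes refl = ⊥-elim (adj-irrefl H e refl)
      ... | yes refl | no nb = inj₂ (to-top b∈ nb (trans (sym H b a) e))
      ... | no na | yes refl = inj₁ (to-top a∈ na e)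
      ... | no na | no nb = recs (in-U a∈ na) (in-U b∈ nb) e

    -- ℓ rounds suffice: m to climb from the start to the top, then depth m
    contains-copy : Connected H → (∀ a → ∃ λ b → adj H a b ≡ true) → ∀ {i a₀} → S i ≡ true →
      Reached (m + depth H m) (c i a₀) → ∀ v → ContainsCopy H v es
    contains-copy walks neighbour {i} {a₀} si r v with spanning H walks a₀
    ... | L , cL , all∈ with tops cL
    ...   | t , t∈ , top with navigate cL top (all∈ a₀) t∈ {k = depth H m} si
              (reached-mono (ℕₚ.+-monoˡ-≤ (depth H m) (ConnList-length cL)) r)
    ...     | j , sj , _ , r' with assemble m cL (ConnList-length cL) t∈ top sj r'
    ...       | f , placed , recs = f , injective , member , (λ a b → recs (all∈ a) (all∈ b))
      where
      injective : Injective _≡_ _≡_ f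
      -- The two vertices may come from different copies; `roles` separates distinct roles even
      -- then.
      injective {a} {b} e with placed (all∈ a) | placed (all∈ b)
      ... | (j , sj , ea , _) , _ | (j' , sj' , eb , _) , _ = roles sj sj' (trans ea (trans e (≡-sym eb)))
      member : ∀ a → f a ∈ v ∷ map proj₁ es ++ map proj₂ es
      member a with neighbour a
      ... | b , ab with recs (all∈ a) (all∈ b) ab
      ...   | inj₁ e∈ = there (∈ₚ.∈-++⁺ˡ (∈ₚ.∈-map⁺ proj₁ e∈))
      ...   | inj₂ e∈ = there (∈ₚ.∈-++⁺ʳ (map proj₁ es) (∈ₚ.∈-map⁺ proj₂ e∈))

-- Running the test on the copies in a far graph

inhabited⇒1≤ : ∀ {n} → Fin n → 1 ≤ n
inhabited⇒1≤ {suc n} _ = s≤s z≤n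

some-neighbour : ∀ {k} (H : Graph (suc (suc k))) → Connected H → ∀ a → ∃ λ b → adj H a b ≡ true
some-neighbour H walks a = first-step (walks a (other a)) (other≢ a)
  where
  other : Fin _ → Fin _
  other zero    = suc zero
  other (suc _) = zero
  other≢ : ∀ a → a ≢ other a
  other≢ zero    ()
  other≢ (suc _) ()
  first-step : ∀ {a b} → Walk H a b → a ≢ b → ∃ λ b → adj H a b ≡ true
  first-step here ne = ⊥-elim (ne refl)
  first-step (step e _) _ = _ , e

unit*pow-pos : ∀ B' M' e → 0ℚᵘ < unit B' ℚ.* pow (unit M') e
unit*pow-pos B' M' e = ℚₚ.positive⁻¹ _ {{ℚₚ.pos*pos⇒pos (unit B') (pow (unit M') e) {{ℚ.positive (0<pow M' e)}}}}

-- In the cleaned-up family S a random neighbour of a vertex in role a lies, with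
-- probability at least 1/(1+M'), on a copy using that vertex in role a.
module Test {n} (G : Graph n) {m} (H : Graph m) (walks : Connected H) (neighbour : ∀ a → ∃ λ b → adj H a b ≡ true)
  {N} (c : Fin N → Fin m → Fin n) (hom : ∀ i {a b} → adj H a b ≡ true → adj G (c i a) (c i b) ≡ true)
  (disjoint : EdgeDisjoint H c) (M' : ℕ) (S : Mask N) (roles : Roles c S) (dense : Cleanup.Dense G c (suc M') S)
  (tops : ∀ {L} → ConnList H L → ∃ λ t → t ∈ L ×
    (∀ {a} → a ∈ L → ∀ {i j} → S i ≡ true → S j ≡ true → c i a ≡ c j a → c i t ≡ c j t)) where

  private
    Ixs = allFin N
    at = Cleanup.at G c (suc M') S

  Act : Fin n → Fin m → Set
  Act u b = ∃ λ a → ∃ λ i → S i ≡ true × c i a ≡ u × adj H a b ≡ true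

  Hit : Fin n → Fin m → Fin n → Set
  Hit u b y = ∃ λ a → ∃ λ j → S j ≡ true × c j a ≡ u × adj H a b ≡ true × c j b ≡ y

  at⁻ : ∀ {x a j} → at x a j ≡ true → S j ≡ true × c j a ≡ x
  at⁻ {x} {a} {j} h = let (sj , e) = ∧⁻ {S j} h in sj , ⌊⌋⁻ (c j a ≟ x) e

  -- Copies sharing `u` in role `a` have distinct vertices in role `b`, being edge-disjoint. So
  -- there are at least as many hits as copies, and `dense` compares these with the degree.
  demand : ∀ u b → Demand G M' u (Act u b) (Hit u b)
  demand u b with Finₚ.any? (λ a → Finₚ.any? (λ i → ≡true? (S i) ×-dec (c i a ≟ u) ×-dec ≡true? (adj H a b)))
  ... | no idle = inj₁ idle
  ... | yes (a , i , si , refl , ab) = inj₂ (p , p⇒hit , #-pos (adj G u) (allFin n) (∈ₚ.∈-allFin (c i b)) (hom i ab) ,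
          ℕₚ.≤-trans (dense a si) (ℕₚ.*-monoʳ-≤ (suc M') many))
    where
    p : Fin n → Bool
    p y = any (λ j → at (c i a) a j ∧ ⌊ c j b ≟ y ⌋) Ixs
    p⇒hit : ∀ {y} → p y ≡ true → Hit u b y
    p⇒hit {y} py with any⁻ _ Ixs py
    ... | j , _ , h with ∧⁻ {at (c i a) a j} h
    ...   | aj , e = a , j , proj₁ (at⁻ aj) , proj₂ (at⁻ aj) , ab , ⌊⌋⁻ (c j b ≟ y) e
    many : # (at (c i a) a) Ixs ≤ # p (neighbours G u)
    many = injection⇒length≤ (λ j → c j b) (filterᵇ (at (c i a) a) Ixs) (filterᵇ p (neighbours G u))
      (Unique-filterᵇ (at (c i a) a) (Uniqueₚ.allFin⁺ N))
      (λ j∈ k∈ e → disjoint ab ab (trans (value j∈) (≡-sym (value k∈))) e)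
      (λ {j} j∈ → ∈-filterᵇ⁺ p
        (∈-filterᵇ⁺ (adj G u) (∈ₚ.∈-allFin (c j b)) (subst (λ z → adj G z (c j b) ≡ true) (value j∈) (hom j ab)))
        (any⁺ (λ k → at (c i a) a k ∧ ⌊ c k b ≟ c j b ⌋) (∈ₚ.∈-allFin j)
          (∧⁺ (proj₂ (∈-filterᵇ⁻ (at (c i a) a) Ixs j∈)) (⌊⌋⁺ (c j b ≟ c j b) refl))))
      where
      value : ∀ {j} → j ∈ filterᵇ (at (c i a) a) Ixs → c j a ≡ c i a
      value j∈ = proj₂ (at⁻ (proj₂ (∈-filterᵇ⁻ (at (c i a) a) Ixs j∈)))

  open Exploration G m M' Act Hit demand

  rounds : ℕ
  rounds = m + depth H m

  starts : Fin m → Fin n → Bool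
  starts a x = any (at x a) Ixs

  -- Adjacent roles are comparable, and a vertex determining a neighbour in its copy
  -- lies in one copy only, since distinct copies share no edge.
  many-starts : ∀ a₀ → ∃ λ a → ∣ S ∣ᵐ ≤ # (starts a) (allFin n)
  many-starts a₀ with neighbour a₀
  ... | b₀ , ab with tops (add (one b₀) (here refl) ab (λ { (here refl) → adj-irrefl H ab refl }))
  ...   | t , t∈ , top = choose t∈
    where
    count : ∀ a → (∀ {i j} → S i ≡ true → S j ≡ true → c i a ≡ c j a → i ≡ j) → ∣ S ∣ᵐ ≤ # (starts a) (allFin n)
    count a inj-a = injection⇒length≤ (λ i → c i a) (filterᵇ S Ixs) (filterᵇ (starts a) (allFin n))
      (Unique-filterᵇ S (Uniqueₚ.allFin⁺ N))
      (λ i∈ j∈ → inj-a (proj₂ (∈-filterᵇ⁻ S Ixs i∈)) (proj₂ (∈-filterᵇ⁻ S Ixs j∈)))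
      (λ {i} i∈ → ∈-filterᵇ⁺ (starts a) (∈ₚ.∈-allFin _) (any⁺ (at (c i a) a) (∈ₚ.∈-allFin i)
        (∧⁺ (proj₂ (∈-filterᵇ⁻ S Ixs i∈)) (⌊⌋⁺ (c i a ≟ c i a) refl))))
    choose : t ∈ a₀ ∷ b₀ ∷ [] → ∃ λ a → ∣ S ∣ᵐ ≤ # (starts a) (allFin n)
    choose (here refl) = b₀ , count b₀ (λ si sj e → disjoint ab ab (top (there (here refl)) si sj e) e)
    choose (there (here refl)) = a₀ , count a₀ (λ si sj e → disjoint ab ab e (top (here refl) si sj e))

  explored⇒copy : ∀ a o → Explored rounds (starts a) o → FindsCopy H o
  explored⇒copy a (just (v , s)) (sv , deep) with any⁻ (at v a) Ixs sv
  ... | i , _ , ai with at⁻ ai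
  ...   | si , refl = Assemble.contains-copy H c S roles (recorded s) (Depth (recorded s)) (Depth-mono {recorded s}) query-step tops
            walks neighbour si deep v
    where
    query-step : ∀ {i a b k} → S i ≡ true → adj H a b ≡ true → Depth (recorded s) (suc k) (c i a) →
      ∃ λ j → S j ≡ true × c j a ≡ c i a × (c i a , c j b) ∈ recorded s × Depth (recorded s) k (c j b)
    query-step {i} {a} {b} si ab deep with deep b (a , i , si , refl , ab)
    -- A hit may be witnessed through some role `a'` of the same vertex; `roles` identifies it with
    -- `a`.
    ... | y , e∈ , (a' , j , sj , e , _ , refl) , deep' with roles sj si e
    ...   | refl = j , sj , e , e∈ , deep'

  finds : ∀ a₀ B' → 1 ≤ n → n ≤ suc B' * ∣ S ∣ᵐ →
    PrAtLeast (RLBD G H m rounds) (FindsCopy H) (unit B' ℚ.* pow (unit M') (traverse-cost m rounds 1))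
  finds a₀ B' 1≤n n≤ with many-starts a₀
  ... | a , le = Pr⇒PrAtLeast (RLBD-good H rounds B' (starts a) 1≤n (ℕₚ.≤-trans n≤ (ℕₚ.*-monoʳ-≤ (suc B') le)))
    (λ {o} → explored⇒copy a o)

-- With `q` the denominator of ε, `B` bounds n per copy left after colouring and tops. `X` bounds
-- the pairs of a dart and a role per such copy: 2 for the orientations, 3 from the edge density,
-- `m` roles. Density 1 + 2X then makes the cleanup lose at most half, whence `B'` = 2B.
module Constants (m : ℕ) (q : ℕ) where

  B X M' B' : ℕ
  B  = suc (costs (λ _ → 4) (allPairs m) * costs (λ L → 12 ^ length L) (listsUpTo {m} m) * (length (allPairs m) * q))
  X  = 6 * m * B
  M' = 2 * X
  B' = 2 * B

test-succeeds : ∀ {m} (H : Graph m) → Connected H → (∀ a → ∃ λ b → adj H a b ≡ true) → Fin m → ∀ ε → 0ℚᵘ < ε →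
  let open Constants m (ℚ.↧ₙ ε) in
  ∀ n (G : Graph n) → Planar G → Far ε H G →
  PrAtLeast (RLBD G H m (m + depth H m)) (FindsCopy H) (unit B' ℚ.* pow (unit M') (traverse-cost m (m + depth H m) 1))
test-succeeds {m} H walks neighbour a₀ ε pos n G planar@(ρ , euler) far
  with disjointCopies H (proj₂ (neighbour a₀)) (edgeCount G) G ℕₚ.≤-refl
... | D with many-copies H G ε pos far D | colour-roles (DisjointCopies.c D) (DisjointCopies.injective D)
...   | n<N | S₁ , N≤ , roles₁
  with Family.ensure-tops G ρ euler H (DisjointCopies.c D) (DisjointCopies.hom D) S₁ roles₁
...   | S₂ , sub₂ , S₁≤ , tops₂
  with Cleanup.cleanup G (DisjointCopies.c D) (suc (Constants.M' m (ℚ.↧ₙ ε))) S₂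
...   | S₃ , sub₃ , S₂≤ , dense =
  Test.finds G H walks neighbour c hom disjoint M' S₃
    (λ si sj → roles₁ (sub₂ _ (sub₃ _ si)) (sub₂ _ (sub₃ _ sj))) dense
    (λ conn → let (t , t∈ , d) = tops₂ (ConnList-length conn) conn in
      t , t∈ , λ a∈ si sj → d a∈ (sub₃ _ si) (sub₃ _ sj))
    a₀ B' 1≤n n≤B'S₃
  where
  q = ℚ.↧ₙ ε
  open Constants m q
  open DisjointCopies D
  open ℕₚ.≤-Reasoning
  R = costs (λ _ → 4) (allPairs m)
  T = costs (λ L → 12 ^ length L) (listsUpTo {m} m)
  P = length (allPairs m)

  1≤n : 1 ≤ n
  1≤n = go N c n<N
    where
    go : ∀ N → (Fin N → Fin m → Fin n) → n ℕ.< N * P * q → 1 ≤ n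
    go zero    c ()
    go (suc N) c _ = inhabited⇒1≤ (c zero a₀)

  n≤BS₂ : n ≤ B * ∣ S₂ ∣ᵐ
  n≤BS₂ = begin
    n                                ≤⟨ ℕₚ.<⇒≤ n<N ⟩
    N * P * q                        ≡⟨ ℕₚ.*-assoc N P q ⟩
    N * (P * q)                      ≤⟨ ℕₚ.*-monoˡ-≤ (P * q) (ℕₚ.≤-trans N≤ (ℕₚ.*-monoʳ-≤ R S₁≤)) ⟩
    R * (T * ∣ S₂ ∣ᵐ) * (P * q)       ≡⟨ shuffle R T ∣ S₂ ∣ᵐ (P * q) ⟩
    R * T * (P * q) * ∣ S₂ ∣ᵐ         ≤⟨ ℕₚ.*-monoˡ-≤ ∣ S₂ ∣ᵐ (ℕₚ.n≤1+n (R * T * (P * q))) ⟩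
    B * ∣ S₂ ∣ᵐ                       ∎
    where
    shuffle : ∀ r t s p → r * (t * s) * p ≡ r * t * p * s
    shuffle = solve-∀

  -- The cleanup loses at most X/(1 + 2X) of the copies, less than half.
  S₂≤2S₃ : ∣ S₂ ∣ᵐ ≤ 2 * ∣ S₃ ∣ᵐ
  S₂≤2S₃ = ℕₚ.*-cancelˡ-≤ (suc X) (ℕₚ.+-cancelˡ-≤ (X * ∣ S₂ ∣ᵐ) _ _ (begin
    X * ∣ S₂ ∣ᵐ + suc X * ∣ S₂ ∣ᵐ                        ≡⟨ shuffle₁ X ∣ S₂ ∣ᵐ ⟩
    suc M' * ∣ S₂ ∣ᵐ                                     ≤⟨ S₂≤ ⟩
    suc M' * ∣ S₃ ∣ᵐ + 2 * edgeCount G * m               ≤⟨ ℕₚ.+-mono-≤ (ℕₚ.m≤n+m _ ∣ S₃ ∣ᵐ) edges ⟩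
    (∣ S₃ ∣ᵐ + suc M' * ∣ S₃ ∣ᵐ) + X * ∣ S₂ ∣ᵐ           ≡⟨ shuffle₂ X ∣ S₃ ∣ᵐ (X * ∣ S₂ ∣ᵐ) ⟩
    X * ∣ S₂ ∣ᵐ + suc X * (2 * ∣ S₃ ∣ᵐ)                  ∎))
    where
    shuffle₁ : ∀ x s → x * s + (1 + x) * s ≡ (1 + 2 * x) * s
    shuffle₁ = solve-∀
    shuffle₂ : ∀ x s y → (s + (1 + 2 * x) * s) + y ≡ y + (1 + x) * (2 * s)
    shuffle₂ = solve-∀
    shuffle₃ : ∀ m b s → 2 * (3 * (b * s)) * m ≡ 6 * m * b * s
    shuffle₃ = solve-∀
    edges : 2 * edgeCount G * m ≤ X * ∣ S₂ ∣ᵐ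
    edges = begin
      2 * edgeCount G * m               ≤⟨ ℕₚ.*-monoˡ-≤ m (ℕₚ.*-monoʳ-≤ 2 (ℕₚ.≤-trans (edgeCount≤3n G planar) (ℕₚ.*-monoʳ-≤ 3 n≤BS₂))) ⟩
      2 * (3 * (B * ∣ S₂ ∣ᵐ)) * m        ≡⟨ shuffle₃ m B ∣ S₂ ∣ᵐ ⟩
      X * ∣ S₂ ∣ᵐ                        ∎

  n≤B'S₃ : n ≤ suc B' * ∣ S₃ ∣ᵐ
  n≤B'S₃ = begin
    n                      ≤⟨ n≤BS₂ ⟩
    B * ∣ S₂ ∣ᵐ             ≤⟨ ℕₚ.*-monoʳ-≤ B S₂≤2S₃ ⟩
    B * (2 * ∣ S₃ ∣ᵐ)       ≡⟨ shuffle B ∣ S₃ ∣ᵐ ⟩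
    B' * ∣ S₃ ∣ᵐ            ≤⟨ ℕₚ.m≤n+m _ ∣ S₃ ∣ᵐ ⟩
    suc B' * ∣ S₃ ∣ᵐ        ∎
    where
    shuffle : ∀ b s → b * (2 * s) ≡ 2 * b * s
    shuffle = solve-∀

-- The start vertex is itself a copy, so no demands are made. Farness excludes the graph without
-- vertices, which is `H`-free.
single-vertex-succeeds : (H : Graph 1) → ∀ ε → 0ℚᵘ < ε → ∀ n (G : Graph n) → Far ε H G →
  PrAtLeast (RLBD G H 1 1) (FindsCopy H) (unit 0 ℚ.* pow (unit 0) (traverse-cost 1 1 1))
single-vertex-succeeds H ε pos n G far = Pr⇒PrAtLeast
  (Exploration.RLBD-good G 1 0 (λ _ _ → ⊥) (λ _ _ _ → ⊥) (λ _ _ → inj₁ id) H 1 0 (λ _ → true) (1≤n n G far)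
    (ℕₚ.≤-reflexive (≡-sym (trans (ℕₚ.+-identityʳ _) (trans (#-all (λ _ → true) (allFin n) (λ _ → refl)) (Listₚ.length-tabulate {n = n} id))))))
  λ { {just (v , s)} _ → (λ _ → v) , (λ { {zero} {zero} _ → refl }) , (λ _ → here refl) ,
      (λ { zero zero e → ⊥-elim (true≢false (trans (≡-sym e) (irrefl H zero))) }) }
  where
  1≤n : ∀ n (G : Graph n) → Far ε H G → 1 ≤ n
  1≤n (suc n) G far = s≤s z≤n
  1≤n zero G far = ⊥-elim (ℕₚ.n≮0 (far⇒< ε pos 0 0 (far G (λ _ _ → id) (λ { (f , _) → no-vertex (f zero) }))))
    where
    no-vertex : Fin 0 → ⊥
    no-vertex ()

theorem3p2 : ∀ {k} (H : Graph (suc k)) → Connected H →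
    ∀ (ε : ℚᵘ) → 0ℚᵘ < ε →
    ∃ λ (d : ℕ) → ∃ λ (ℓ : ℕ) → Σ ℚᵘ λ δ → 1 ≤ d × 1 ≤ ℓ × 0ℚᵘ < δ ×
    (∀ n (G : Graph n) → Planar G → Far ε H G →
    PrAtLeast (RLBD G H d ℓ) (FindsCopy H) δ) ×
    (∀ n (G : Graph n) →
    All (λ o → QueryCount (proj₂ o) ≤ geomSum d ℓ) (RLBD G H d ℓ))
-- A single vertex has no incident edge, so this case is separate from the greedy packing.
theorem3p2 {zero} H walks ε pos =
  1 , 1 , _ , s≤s z≤n , s≤s z≤n , unit*pow-pos 0 0 (traverse-cost 1 1 1) ,
  (λ n G _ → single-vertex-succeeds H ε pos n G) , λ n G → queryCount-RLBD G H 1 1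
theorem3p2 {suc k} H walks ε pos =
  -- Each vertex makes one query per role; `m` rounds lead to the top of all roles and `depth H m`
  -- more assemble the copy.
  m , m + depth H m , _ , s≤s z≤n , s≤s z≤n , unit*pow-pos B' M' (traverse-cost m (m + depth H m) 1) ,
  test-succeeds H walks (some-neighbour H walks) zero ε pos , λ n G → queryCount-RLBD G H m (m + depth H m)
  where
  m = suc (suc k)
  open Constants m (ℚ.↧ₙ ε)
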